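{- For integers $k \ge 0$ and $r\ge 0$ put \[\hat\beta_{k,r}=\dim_{\mathbb{Z}_3}\tilde H_{k-1+r}(\mathsf{M}_{2k+1+3r};\mathbb{Z}_3),\qquad \hat\alpha_{k,r}=\dim_{\mathbb{Z}_3}\tilde H_{k-1+r}(\mathsf{M}_{2k+1+3r}\setminus 12;\mathbb{Z}_3).\] For each $k\ge 0$ there are polynomials $f_k(r)$ and $g_k(r)$ of degree $3k$, each with leading term $\frac{3^k}{k!}r^{3k}$, such that $\hat\beta_{k,r}\le f_k(r)$ and $\hat\alpha_{k,r}\le g_k(r)$ for all $r\ge k+2$. Equivalently, writing $\beta(n,d)=\dim_{\mathbb{Z}_3}\tilde H_d(\mathsf{M}_n;\mathbb{Z}_3)$ and $\alpha(n,d)=\dim_{\mathbb{Z}_3}\tilde H_d(\mathsf{M}_n\setminus 12;\mathbb{Z}_3)$, we have $\beta(n,d)\le f_{3d-n+4}(n-2d-3)$ and $\alpha(n,d)\le g_{3d-n+4}(n-2d-3)$ for all $n\ge 7$ and $\lceil\frac{n-4}{3}\rceil\le d\le\lfloor\frac{2n-9}{5}\rfloor$.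
   Context: For a finite set $S$, $\mathsf{M}[S]$ is the matching complex of the complete graph on $S$: the simplicial complex whose vertices are the edges $ab=\{a,b\}$ ($a\ne b\in S$) and whose faces are the sets of pairwise disjoint edges (matchings). $\mathsf{M}_n=\mathsf{M}[[n]]$ with $[n]=\{1,\dots,n\}$. $\mathsf{M}_n\setminus 12$ denotes the subcomplex of $\mathsf{M}_n$ obtained by deleting the vertex (0-cell) $12=\{1,2\}$, i.e. consisting of all matchings not containing the edge $\{1,2\}$. $\tilde H$ denotes reduced simplicial homology. -}

module Defs where

open import Data.Bool using (Bool; true; false; _∧_; not)
open import Data.Nat using (ℕ; zero; suc; _+_; _*_; _^_; _!; _<ᵇ_; _≡ᵇ_)
open import Data.Nat.Properties using (_!≢0)
open import Data.Fin using (Fin; toℕ) renaming (zero to fz; suc to fs)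
open import Data.Fin.Properties using () renaming (_≟_ to _≟F_)
open import Data.List using (List; []; _∷_; map; _++_; length; lookup; allFin; filterᵇ; concatMap; foldr)
open import Data.Product using (_×_; _,_; Σ; ∃; proj₁; proj₂)
open import Data.Unit using (⊤)
open import Data.Integer using (+_)
open import Data.Rational using (ℚ; _/_; 0ℚ) renaming (_+_ to _+ℚ_; _*_ to _*ℚ_)
open import Data.Vec using (Vec)
open import Relation.Binary.PropositionalEquality using (_≡_)
open import Relation.Nullary.Decidable using (does)

data 𝔽₃ : Set where
  𝟘 𝟙 𝟚 : 𝔽₃

_⊕_ : 𝔽₃ → 𝔽₃ → 𝔽₃
𝟘 ⊕ y = y
𝟙 ⊕ 𝟘 = 𝟙
𝟙 ⊕ 𝟙 = 𝟚
𝟙 ⊕ 𝟚 = 𝟘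
𝟚 ⊕ 𝟘 = 𝟚
𝟚 ⊕ 𝟙 = 𝟘
𝟚 ⊕ 𝟚 = 𝟙

_⊗_ : 𝔽₃ → 𝔽₃ → 𝔽₃
𝟘 ⊗ y = 𝟘
𝟙 ⊗ y = y
𝟚 ⊗ 𝟘 = 𝟘
𝟚 ⊗ 𝟙 = 𝟚
𝟚 ⊗ 𝟚 = 𝟙

⊖_ : 𝔽₃ → 𝔽₃
⊖ 𝟘 = 𝟘
⊖ 𝟙 = 𝟚
⊖ 𝟚 = 𝟙

Σ𝔽 : (m : ℕ) → (Fin m → 𝔽₃) → 𝔽₃
Σ𝔽 zero    f = 𝟘
Σ𝔽 (suc m) f = f fz ⊕ Σ𝔽 m (λ i → f (fs i))

-- Edges of the complete graph on [n] = Fin n (vertex i of Fin n is i+1)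
-- An edge {a,b} is stored as (a , b) with a < b; these are the vertices
-- of the matching complex.

Edge : ℕ → Set
Edge n = Fin n × Fin n

_==E_ : ∀ {n} → Edge n → Edge n → Bool
(a , b) ==E (c , d) = does (a ≟F c) ∧ does (b ≟F d)

_==L_ : ∀ {n} → List (Edge n) → List (Edge n) → Bool
[] ==L [] = true
[] ==L (_ ∷ _) = false
(_ ∷ _) ==L [] = false
(x ∷ xs) ==L (y ∷ ys) = (x ==E y) ∧ (xs ==L ys)

allEdges : (n : ℕ) → List (Edge n)
allEdges n = concatMap (λ a → map (λ b → (a , b)) (filterᵇ (λ b → toℕ a <ᵇ toℕ b) (allFin n))) (allFin n)

-- all edges of K_n except 12 = {1,2} (i.e. (0,1) in Fin n)
is12 : ∀ {n} → Edge n → Bool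
is12 (a , b) = (toℕ a ≡ᵇ 0) ∧ (toℕ b ≡ᵇ 1)

allEdgesMinus12 : (n : ℕ) → List (Edge n)
allEdgesMinus12 n = filterᵇ (λ e → not (is12 e)) (allEdges n)

disjointE : ∀ {n} → Edge n → Edge n → Bool
disjointE (a , b) (c , d) =
  not (does (a ≟F c)) ∧ not (does (a ≟F d)) ∧ not (does (b ≟F c)) ∧ not (does (b ≟F d))

isMatching : ∀ {n} → List (Edge n) → Bool
isMatching [] = true
isMatching (e ∷ es) = foldr (λ f acc → disjointE e f ∧ acc) true es ∧ isMatching es

-- Simplices of a matching complex: all s-element subsets of the vertex
-- list (kept in the list order, which fixes the orientation) which are
-- matchings.  Size s means dimension s - 1; size 0 is the empty face.

combs : ∀ {A : Set} → ℕ → List A → List (List A)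
combs zero    _        = [] ∷ []
combs (suc k) []       = []
combs (suc k) (x ∷ xs) = map (x ∷_) (combs k xs) ++ combs (suc k) xs

Faces : ∀ {n} → List (Edge n) → ℕ → List (List (Edge n))
Faces vs s = filterᵇ isMatching (combs s vs)

Chain : ∀ {n} → List (Edge n) → ℕ → Set
Chain vs s = Fin (length (Faces vs s)) → 𝔽₃

deletions : ∀ {n} → List (Edge n) → List (𝔽₃ × List (Edge n))
deletions [] = []
deletions (x ∷ xs) = (𝟙 , xs) ∷ map (λ p → (⊖ proj₁ p , x ∷ proj₂ p)) (deletions xs)

incidence : ∀ {n} → List (Edge n) → List (Edge n) → 𝔽₃
incidence σ τ = foldr (λ p acc → (if (proj₂ p ==L σ) then proj₁ p else 𝟘) ⊕ acc) 𝟘 (deletions τ)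
  where
  if_then_else_ : Bool → 𝔽₃ → 𝔽₃ → 𝔽₃
  if true then x else y = x
  if false then x else y = y

-- simplicial boundary map C_{s+1} → C_s (sizes), reduced (augmented) at size 0
∂ : ∀ {n} (vs : List (Edge n)) (s : ℕ) → Chain vs (suc s) → Chain vs s
∂ vs s c i = Σ𝔽 (length (Faces vs (suc s)))
  (λ j → incidence (lookup (Faces vs s) i) (lookup (Faces vs (suc s)) j) ⊗ c j)

_≈C_ : ∀ {m} → (Fin m → 𝔽₃) → (Fin m → 𝔽₃) → Set
x ≈C y = ∀ i → x i ≡ y i

zeroC : ∀ {m} → Fin m → 𝔽₃
zeroC _ = 𝟘

_-C_ : ∀ {m} → (Fin m → 𝔽₃) → (Fin m → 𝔽₃) → (Fin m → 𝔽₃)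
(x -C y) i = x i ⊕ (⊖ y i)

IsCycle : ∀ {n} (vs : List (Edge n)) (s : ℕ) → Chain vs s → Set
IsCycle vs zero    c = ⊤
IsCycle vs (suc s) c = ∂ vs s c ≈C zeroC

IsBoundary : ∀ {n} (vs : List (Edge n)) (s : ℕ) → Chain vs s → Set
IsBoundary vs s c = Σ (Chain vs (suc s)) (λ y → ∂ vs s y ≈C c)

linComb : ∀ {m} (h : ℕ) → (Fin h → 𝔽₃) → (Fin h → Fin m → 𝔽₃) → (Fin m → 𝔽₃)
linComb h a z j = Σ𝔽 h (λ i → a i ⊗ z i j)

-- HomDim vs s h : the reduced homology group H̃_{s-1}(complex; Z_3)
-- (faces of size s, i.e. dimension s - 1) has Z_3-dimension h, i.e.
-- there are h cycles whose classes form a basis of cycles / boundaries.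
HomDim : ∀ {n} (vs : List (Edge n)) (s : ℕ) (h : ℕ) → Set
HomDim vs s h = Σ (Fin h → Chain vs s) λ z →
    (∀ i → IsCycle vs s (z i))
  × (∀ (a : Fin h → 𝔽₃) → IsBoundary vs s (linComb h a z) → ∀ i → a i ≡ 𝟘)
  × (∀ (c : Chain vs s) → IsCycle vs s c → Σ (Fin h → 𝔽₃) λ a → IsBoundary vs s (c -C linComb h a z))

-- dim H̃_d(M_n ; Z_3) = h   (d = s - 1)
βdim : (n s h : ℕ) → Set
βdim n s h = HomDim (allEdges n) s h

-- dim H̃_d(M_n \ 12 ; Z_3) = h   (d = s - 1)
αdim : (n s h : ℕ) → Set
αdim n s h = HomDim (allEdgesMinus12 n) s h

evalPoly : ∀ {m} → Vec ℚ m → ℚ → ℚ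
evalPoly Vec.[] x = 0ℚ
evalPoly (c Vec.∷ cs) x = c +ℚ (x *ℚ evalPoly cs x)

leadCoeff : ℕ → ℚ
leadCoeff k = ((+ (3 ^ k)) / (k !)) {{k !≢0}}

{-# OPTIONS --safe #-}
module Submission where

-- Matching complexes of arbitrary graphs are studied by deleting one edge e at a time: the long exact
-- sequence of the pair gives dim H(G) ≤ dim H(G ∖ e) + dim H(G − endpoints of e), one dimension lower in
-- the last term, and the homology vanishes once some edge is disjoint from all others. Deleting edges
-- around three vertices of the complete graph in a suitable order yields, with n the number of vertices
-- and s the number of edges of a matching,
--   α(n, s) ≤ (n − 3) α(n − 2, s − 1) + (n − 3) (n − 4) β(n − 5, s − 2) + β(n − 3, s − 1),
--   β(n, s) ≤ α(n, s) + β(n − 2, s − 1).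
-- Both vanish for n ≥ 3 s + 2. For n = 3 s + 1 they are at most 1, by induction from H₁(M₇ ∖ 12), for which
-- an explicit deletion order is given. In terms of (k, r) the first two coefficients go with k − 1 and are
-- at most 9 r² up to lower order, so that k! α and k! β are at most 3ᵏ (r + D)³ᵏ for a constant D = D(k).

open import Defs
open import Algebra.Bundles using (CommutativeRing)
open import Data.Bool using (Bool; true; false; T; not; _∧_; if_then_else_)
open import Data.Bool.ListAction using (all; any)
open import Data.Empty using (⊥-elim)
open import Data.Fin using (Fin; toℕ; #_; funToFin; finToFun; combine) renaming (zero to fz; suc to fs)
import Data.Fin as Fin
open import Data.Fin.Properties using (injective⇒≤; funToFin-finToFin; finToFun-funToFin)
import Data.Fin.Properties as Fin
open import Data.Integer using (+_)
import Data.Integer as ℤ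
import Data.Integer.Properties as ℤ
open import Data.List using (List; []; _∷_; length; map; _++_; foldr; filterᵇ; allFin; tabulate)
import Data.List as List
open import Data.List.Membership.Propositional using (_∈_; _∉_; lose)
import Data.List.Membership.DecPropositional as DecMembership
open import Data.List.Membership.Propositional.Properties using (∈-map⁺; ∈-map⁻; ∈-++⁺ˡ; ∈-++⁺ʳ; ∈-++⁻; ∈-filter⁺; ∈-filter⁻; ∈-lookup; ∈-concatMap⁺; ∈-concatMap⁻; ∈-allFin; ∈-tabulate⁺; ∈-tabulate⁻)
open import Data.List.Properties using (∷-injectiveʳ; length-tabulate) renaming (≡-dec to List-≡-dec)
open import Data.List.Relation.Unary.All as All using (All; []; _∷_)
import Data.List.Relation.Unary.All.Properties as All
open import Data.List.Relation.Unary.AllPairs as AllPairs using (AllPairs; []; _∷_)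
import Data.List.Relation.Unary.AllPairs.Properties as AllPairs
open import Data.List.Relation.Unary.Any using (here; there; index; satisfied)
open import Data.List.Relation.Unary.Any.Properties using (lookup-index)
open import Data.List.Relation.Unary.Unique.Propositional using (Unique)
open import Data.List.Relation.Unary.Unique.Propositional.Properties using (map⁺; ++⁺; filter⁺; concat⁺; allFin⁺; Unique[x∷xs]⇒x∉xs)
open import Data.Maybe using (just; nothing)
open import Data.Nat using (ℕ; zero; suc; _+_; _*_; _^_; _!; _≤_; _<ᵇ_; _≤?_; z≤n; s≤s; NonZero)
open import Data.Nat.Properties using (suc-injective; +-identityʳ; +-assoc; +-suc; *-zeroʳ; *-suc; *-comm; *-identityʳ; _!≢0; m^n>0; ≤-refl; ≤-reflexive; ≤-trans; ≰⇒>; <⇒≱; <ᵇ⇒<; <⇒<ᵇ; n≤1+n; m≤m+n; m≤n+m; m≤n⇒∃[o]m+o≡n; +-mono-≤; +-monoˡ-≤; +-monoʳ-≤; *-mono-≤; *-monoˡ-≤; *-monoʳ-≤; ^-monoˡ-≤; ^-monoʳ-<; module ≤-Reasoning)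
import Data.Nat.Tactic.RingSolver as ℕ-Solver
open import Data.Product using (_×_; _,_; Σ; proj₁; proj₂)
open import Data.Product.Properties using (,-injectiveʳ) renaming (≡-dec to ×-≡-dec)
open import Data.Rational using (ℚ; _/_; 0ℚ; toℚᵘ) renaming (_≤_ to _≤ℚ_; _+_ to _+ℚ_; _*_ to _*ℚ_)
import Data.Rational.Properties as ℚ
open import Data.Rational.Unnormalised as ℚᵘ using (mkℚᵘ; *≡*; *≤*)
import Data.Rational.Unnormalised.Properties as ℚᵘ
open import Data.Sum using (_⊎_; inj₁; inj₂; swap; [_,_])
open import Data.Unit using (tt)
open import Data.Vec using (Vec; []; _∷_; last; lookup; _[_]≔_; replicate)
open import Data.Vec.Properties using (lookup∘update; lookup∘update′; []≔-lookup; []≔-idempotent)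
open import Function using (_∘_; id)
open import Level using (0ℓ)
open import Relation.Binary using (tri<; tri≈; tri>)
open import Relation.Binary.PropositionalEquality hiding ([_])
open import Relation.Nullary using (¬_; Dec; yes; no; contradiction)
open import Relation.Nullary.Decidable using (¬¬-excluded-middle; decidable-stable; T?; toWitness; _⊎-dec_; _×-dec_)
open import Tactic.RingSolver using (solve-∀)
open import Tactic.RingSolver.Core.AlmostCommutativeRing using (AlmostCommutativeRing; fromCommutativeRing)

-- Linear algebra over 𝔽₃

-- Put k = 3 s - n + 1, so that n = 2 k + 1 + 3 r and s = k + r; the vanishing range is k < 0. Among
-- the terms bounding α(n, s), only β(n - 3, s - 1) keeps k, and it does so with coefficient 1 while
-- lowering r by one. For fixed k this is a difference inequality in r, and summing 9 r² · 3ᵏ⁻¹ / (k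
-- - 1)! · r³ᵏ⁻³ over r gives the leading term 3ᵏ / k! · r³ᵏ. Deleting the star of a single vertex
-- would involve k + 1 and is useless for this induction. It serves only at r = k + 2 for k ≥ 1,
-- where the recurrence would leave the range r ≥ k + 2: any finite starting value will do there,
-- since it enters only D and thus only the lower coefficients. Since only upper bounds are claimed,
-- no homology group has to be computed: it suffices to span the cycles modulo boundaries. The final
-- inequality between natural numbers is decidable, so the spanning sets may be found under double
-- negation, with excluded middle at hand.

⊕-comm : ∀ x y → x ⊕ y ≡ y ⊕ x
⊕-comm 𝟘 𝟘 = refl
⊕-comm 𝟘 𝟙 = refl
⊕-comm 𝟘 𝟚 = refl
⊕-comm 𝟙 𝟘 = refl
⊕-comm 𝟙 𝟙 = refl
⊕-comm 𝟙 𝟚 = refl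
⊕-comm 𝟚 𝟘 = refl
⊕-comm 𝟚 𝟙 = refl
⊕-comm 𝟚 𝟚 = refl

⊗-comm : ∀ x y → x ⊗ y ≡ y ⊗ x
⊗-comm 𝟘 𝟘 = refl
⊗-comm 𝟘 𝟙 = refl
⊗-comm 𝟘 𝟚 = refl
⊗-comm 𝟙 𝟘 = refl
⊗-comm 𝟙 𝟙 = refl
⊗-comm 𝟙 𝟚 = refl
⊗-comm 𝟚 𝟘 = refl
⊗-comm 𝟚 𝟙 = refl
⊗-comm 𝟚 𝟚 = refl

⊕-assoc : ∀ x y z → (x ⊕ y) ⊕ z ≡ x ⊕ (y ⊕ z)
⊕-assoc 𝟘 y z = refl
⊕-assoc 𝟙 𝟘 z = refl
⊕-assoc 𝟙 𝟙 𝟘 = refl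
⊕-assoc 𝟙 𝟙 𝟙 = refl
⊕-assoc 𝟙 𝟙 𝟚 = refl
⊕-assoc 𝟙 𝟚 𝟘 = refl
⊕-assoc 𝟙 𝟚 𝟙 = refl
⊕-assoc 𝟙 𝟚 𝟚 = refl
⊕-assoc 𝟚 𝟘 z = refl
⊕-assoc 𝟚 𝟙 𝟘 = refl
⊕-assoc 𝟚 𝟙 𝟙 = refl
⊕-assoc 𝟚 𝟙 𝟚 = refl
⊕-assoc 𝟚 𝟚 𝟘 = refl
⊕-assoc 𝟚 𝟚 𝟙 = refl
⊕-assoc 𝟚 𝟚 𝟚 = refl

⊗-assoc : ∀ x y z → (x ⊗ y) ⊗ z ≡ x ⊗ (y ⊗ z)
⊗-assoc 𝟘 y z = refl
⊗-assoc 𝟙 y z = refl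
⊗-assoc 𝟚 𝟘 z = refl
⊗-assoc 𝟚 𝟙 z = refl
⊗-assoc 𝟚 𝟚 𝟘 = refl
⊗-assoc 𝟚 𝟚 𝟙 = refl
⊗-assoc 𝟚 𝟚 𝟚 = refl

⊗-distribˡ-⊕ : ∀ x y z → x ⊗ (y ⊕ z) ≡ (x ⊗ y) ⊕ (x ⊗ z)
⊗-distribˡ-⊕ 𝟘 y z = refl
⊗-distribˡ-⊕ 𝟙 y z = refl
⊗-distribˡ-⊕ 𝟚 𝟘 z = refl
⊗-distribˡ-⊕ 𝟚 𝟙 𝟘 = refl
⊗-distribˡ-⊕ 𝟚 𝟙 𝟙 = refl
⊗-distribˡ-⊕ 𝟚 𝟙 𝟚 = refl
⊗-distribˡ-⊕ 𝟚 𝟚 𝟘 = refl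
⊗-distribˡ-⊕ 𝟚 𝟚 𝟙 = refl
⊗-distribˡ-⊕ 𝟚 𝟚 𝟚 = refl

⊕-identityʳ : ∀ x → x ⊕ 𝟘 ≡ x
⊕-identityʳ x = ⊕-comm x 𝟘

⊕-inverseˡ : ∀ x → (⊖ x) ⊕ x ≡ 𝟘
⊕-inverseˡ 𝟘 = refl
⊕-inverseˡ 𝟙 = refl
⊕-inverseˡ 𝟚 = refl

⊕-inverseʳ : ∀ x → x ⊕ (⊖ x) ≡ 𝟘
⊕-inverseʳ x = trans (⊕-comm x (⊖ x)) (⊕-inverseˡ x)

𝔽₃-commutativeRing : CommutativeRing 0ℓ 0ℓ
𝔽₃-commutativeRing = record
  { isCommutativeRing = record
    { isRing = record
      { +-isAbelianGroup = record
        { isGroup = record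
          { isMonoid = record
            { isSemigroup = record
              { isMagma = record { isEquivalence = isEquivalence ; ∙-cong = cong₂ _⊕_ }
              ; assoc = ⊕-assoc }
            ; identity = (λ _ → refl) , ⊕-identityʳ }
          ; inverse = ⊕-inverseˡ , ⊕-inverseʳ
          ; ⁻¹-cong = cong ⊖_ }
        ; comm = ⊕-comm }
      ; *-cong = cong₂ _⊗_
      ; *-assoc = ⊗-assoc
      ; *-identity = (λ _ → refl) , λ x → ⊗-comm x 𝟙
      ; distrib = ⊗-distribˡ-⊕ , λ x y z → trans (⊗-comm (y ⊕ z) x)
          (trans (⊗-distribˡ-⊕ x y z) (cong₂ _⊕_ (⊗-comm x y) (⊗-comm x z))) }
    ; *-comm = ⊗-comm } }

𝔽₃-ring : AlmostCommutativeRing 0ℓ 0ℓ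
𝔽₃-ring = fromCommutativeRing 𝔽₃-commutativeRing λ { 𝟘 → just refl ; _ → nothing }

Σ𝔽-cong : ∀ m {f g : Fin m → 𝔽₃} → (∀ i → f i ≡ g i) → Σ𝔽 m f ≡ Σ𝔽 m g
Σ𝔽-cong zero    eq = refl
Σ𝔽-cong (suc m) eq = cong₂ _⊕_ (eq fz) (Σ𝔽-cong m (eq ∘ fs))

Σ𝔽-zero : ∀ m {f : Fin m → 𝔽₃} → (∀ i → f i ≡ 𝟘) → Σ𝔽 m f ≡ 𝟘
Σ𝔽-zero zero    eq = refl
Σ𝔽-zero (suc m) eq = cong₂ _⊕_ (eq fz) (Σ𝔽-zero m (eq ∘ fs))

⊕-interchange : ∀ a b c d → (a ⊕ b) ⊕ (c ⊕ d) ≡ (a ⊕ c) ⊕ (b ⊕ d)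
⊕-interchange = solve-∀ 𝔽₃-ring

Σ𝔽-⊕ : ∀ m (f g : Fin m → 𝔽₃) → Σ𝔽 m (λ i → f i ⊕ g i) ≡ Σ𝔽 m f ⊕ Σ𝔽 m g
Σ𝔽-⊕ zero    f g = refl
Σ𝔽-⊕ (suc m) f g = trans (cong ((f fz ⊕ g fz) ⊕_) (Σ𝔽-⊕ m (f ∘ fs) (g ∘ fs)))
  (⊕-interchange (f fz) (g fz) _ _)

Σ𝔽-⊗ : ∀ m a (f : Fin m → 𝔽₃) → Σ𝔽 m (λ i → a ⊗ f i) ≡ a ⊗ Σ𝔽 m f
Σ𝔽-⊗ zero    a f = ⊗-comm 𝟘 a
Σ𝔽-⊗ (suc m) a f = trans (cong ((a ⊗ f fz) ⊕_) (Σ𝔽-⊗ m a (f ∘ fs)))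
  (sym (⊗-distribˡ-⊕ a (f fz) _))

⊖-⊗ : ∀ x → 𝟚 ⊗ x ≡ ⊖ x
⊖-⊗ 𝟘 = refl
⊖-⊗ 𝟙 = refl
⊖-⊗ 𝟚 = refl

⊕-double : ∀ x → x ⊕ x ≡ 𝟚 ⊗ x
⊕-double 𝟘 = refl
⊕-double 𝟙 = refl
⊕-double 𝟚 = refl

⊗-zeroʳ : ∀ x → x ⊗ 𝟘 ≡ 𝟘
⊗-zeroʳ x = ⊗-comm x 𝟘

Σ𝔽-swap : ∀ m n (f : Fin m → Fin n → 𝔽₃) →
  Σ𝔽 m (λ i → Σ𝔽 n (f i)) ≡ Σ𝔽 n (λ j → Σ𝔽 m (λ i → f i j))
Σ𝔽-swap zero    n f = sym (Σ𝔽-zero n (λ _ → refl))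
Σ𝔽-swap (suc m) n f = trans (cong (Σ𝔽 n (f fz) ⊕_) (Σ𝔽-swap m n (f ∘ fs)))
  (sym (Σ𝔽-⊕ n (f fz) _))

⊖-cancel : ∀ x y → x ⊕ (⊖ y) ≡ 𝟘 → x ≡ y
⊖-cancel x y eq = trans (rearrange x y) (cong (_⊕ y) eq)
  where
  rearrange : ∀ x y → x ≡ (x ⊕ (⊖ y)) ⊕ y
  rearrange = solve-∀ 𝔽₃-ring

≡𝟘? : ∀ x → Dec (x ≡ 𝟘)
≡𝟘? 𝟘 = yes refl
≡𝟘? 𝟙 = no λ ()
≡𝟘? 𝟚 = no λ ()

⊗-self-inverse : ∀ x → x ≢ 𝟘 → x ⊗ x ≡ 𝟙
⊗-self-inverse 𝟘 x≢𝟘 = contradiction refl x≢𝟘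
⊗-self-inverse 𝟙 x≢𝟘 = refl
⊗-self-inverse 𝟚 x≢𝟘 = refl

-- Subspaces, linear maps and spanning sets

_+C_ : ∀ {X : Set} → (X → 𝔽₃) → (X → 𝔽₃) → X → 𝔽₃
(c +C d) x = c x ⊕ d x

_·C_ : ∀ {X : Set} → 𝔽₃ → (X → 𝔽₃) → X → 𝔽₃
(a ·C c) x = a ⊗ c x

combination : ∀ {X : Set} (h : ℕ) → (Fin h → 𝔽₃) → (Fin h → X → 𝔽₃) → X → 𝔽₃
combination h a z x = Σ𝔽 h (λ i → a i ⊗ z i x)

_⊝C_ : ∀ {X : Set} → (X → 𝔽₃) → (X → 𝔽₃) → X → 𝔽₃
(c ⊝C d) x = c x ⊕ (⊖ d x)

record IsSubspace {X : Set} (P : (X → 𝔽₃) → Set) : Set where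
  field
    respS : ∀ {c d} → (∀ x → c x ≡ d x) → P c → P d
    zeroS : P (λ _ → 𝟘)
    addS : ∀ {c d} → P c → P d → P (c +C d)

  -- The scalars of 𝔽₃ are 0, 1 and 1 + 1, so scaling reduces to addition.
  scaleS : ∀ a {c} → P c → P (a ·C c)
  scaleS 𝟘 p = zeroS
  scaleS 𝟙 p = p
  scaleS 𝟚 {c} p = respS (λ x → ⊕-double (c x)) (addS p p)

  subS : ∀ {c d} → P c → P d → P (c ⊝C d)
  subS {c} {d} p q = respS (λ x → cong (c x ⊕_) (⊖-⊗ (d x))) (addS p (scaleS 𝟚 q))

  combinationS : ∀ h a {z} → (∀ i → P (z i)) → P (combination h a z)
  combinationS zero    a p = zeroS
  combinationS (suc h) a p = addS (scaleS (a fz) (p fz)) (combinationS h (a ∘ fs) (p ∘ fs))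

record IsLinear {X Y : Set} (L : (X → 𝔽₃) → (Y → 𝔽₃)) : Set where
  field
    L-cong : ∀ {c d} → (∀ x → c x ≡ d x) → ∀ y → L c y ≡ L d y
    L-add : ∀ c d y → L (c +C d) y ≡ L c y ⊕ L d y

  L-zero : ∀ y → L (λ _ → 𝟘) y ≡ 𝟘
  L-zero y = idem⇒zero _ (trans (sym (L-add (λ _ → 𝟘) (λ _ → 𝟘) y)) (L-cong (λ _ → refl) y))
    where
    idem⇒zero : ∀ x → x ⊕ x ≡ x → x ≡ 𝟘
    idem⇒zero 𝟘 _ = refl

  L-scale : ∀ a c y → L (a ·C c) y ≡ a ⊗ L c y
  L-scale 𝟘 c y = L-zero y
  L-scale 𝟙 c y = refl
  L-scale 𝟚 c y = trans (L-cong (λ x → sym (⊕-double (c x))) y) (trans (L-add c c y) (⊕-double (L c y)))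

  L-sub : ∀ c d y → L (c ⊝C d) y ≡ L c y ⊕ (⊖ L d y)
  L-sub c d y = begin
    L (c ⊝C d) y           ≡⟨ L-cong (λ x → cong (c x ⊕_) (sym (⊖-⊗ (d x)))) y ⟩
    L (c +C (𝟚 ·C d)) y    ≡⟨ L-add c _ y ⟩
    L c y ⊕ L (𝟚 ·C d) y   ≡⟨ cong (L c y ⊕_) (trans (L-scale 𝟚 d y) (⊖-⊗ _)) ⟩
    L c y ⊕ (⊖ L d y)      ∎
    where open ≡-Reasoning

  L-combination : ∀ h a z y → L (combination h a z) y ≡ combination h a (L ∘ z) y
  L-combination zero    a z y = L-zero y
  L-combination (suc h) a z y = trans (L-add _ _ y)
    (cong₂ _⊕_ (L-scale (a fz) (z fz) y) (L-combination h (a ∘ fs) (z ∘ fs) y))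

open IsSubspace
open IsLinear

combination-⊕ : ∀ {X : Set} h (a b : Fin h → 𝔽₃) (z : Fin h → X → 𝔽₃) x →
  combination h (λ i → a i ⊕ b i) z x ≡ combination h a z x ⊕ combination h b z x
combination-⊕ h a b z x = trans
  (Σ𝔽-cong h (λ i → distribʳ (a i) (b i) (z i x))) (Σ𝔽-⊕ h _ _)
  where
  distribʳ : ∀ a b z → (a ⊕ b) ⊗ z ≡ (a ⊗ z) ⊕ (b ⊗ z)
  distribʳ = solve-∀ 𝔽₃-ring

combination-⊗ : ∀ {X : Set} h k (a : Fin h → 𝔽₃) (z : Fin h → X → 𝔽₃) x →
  combination h (λ i → k ⊗ a i) z x ≡ k ⊗ combination h a z x
combination-⊗ h k a z x = trans (Σ𝔽-cong h (λ i → ⊗-assoc k (a i) (z i x))) (Σ𝔽-⊗ h k _)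

infixr 5 _∷ᶠ_
_∷ᶠ_ : ∀ {A : Set} {n} → A → (Fin n → A) → Fin (suc n) → A
(x ∷ᶠ f) fz     = x
(x ∷ᶠ f) (fs i) = f i

-- The image of `P` under `L` has dimension at most `N` modulo `Q`, witnessed by elements of `P`
-- itself. The long exact sequence needs these lifts, not only their images. For `L = id`, cycles
-- and boundaries, this bounds a homology group.
Spanning : ∀ {X Y : Set} → ((X → 𝔽₃) → (Y → 𝔽₃)) → ((X → 𝔽₃) → Set) → ((Y → 𝔽₃) → Set) → ℕ → Set
Spanning {X} L P Q N = Σ (Fin N → X → 𝔽₃) λ p →
  (∀ i → P (p i)) × (∀ c → P c → Σ (Fin N → 𝔽₃) λ a → Q (L (c ⊝C combination N a p)))

-- By induction on N, asking whether some element of P has a non-zero first coordinate.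
spanning-subspace : ∀ {X Y : Set} {L : (X → 𝔽₃) → (Y → 𝔽₃)} {P Q} →
  IsLinear L → IsSubspace P → IsSubspace Q → ∀ N (w : Fin N → Y → 𝔽₃) →
  (∀ c → P c → Σ (Fin N → 𝔽₃) λ a → Q (L c ⊝C combination N a w)) → ¬ ¬ Spanning L P Q N
spanning-subspace {L = L} lin subP subQ zero w span k = k ((λ ()) , (λ ()) , λ c p → (λ ()) ,
  respS subQ (λ y → trans (⊕-identityʳ _) (L-cong lin (λ x → sym (⊕-identityʳ (c x))) y))
    (proj₂ (span c p)))
spanning-subspace {X} {Y} {L} {P} {Q} lin subP subQ (suc N) w span k =
  spanning-subspace lin subP′ subQ N (w ∘ fs) (λ _ → proj₂) λ rest →
  ¬¬-excluded-middle λ em → k (extend rest em)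
  where
  -- The elements of `P` whose image can be written without `w fz`; the induction hypothesis applies
  -- to them.
  P′ : (X → 𝔽₃) → Set
  P′ c = P c × Σ (Fin N → 𝔽₃) λ a → Q (L c ⊝C combination N a (w ∘ fs))

  subP′ : IsSubspace P′
  respS subP′ eq (p , a , q) = respS subP eq p , a ,
    respS subQ (λ y → cong (_⊕ _) (L-cong lin eq y)) q
  zeroS subP′ = zeroS subP , (λ _ → 𝟘) , respS subQ
    (λ y → sym (cong₂ (λ u v → u ⊕ (⊖ v)) (L-zero lin y) (Σ𝔽-zero N (λ _ → refl)))) (zeroS subQ)
  addS subP′ {c} {d} (p , a , q) (p₁ , b , q₁) = addS subP p p₁ , (λ i → a i ⊕ b i) ,
    respS subQ (λ y → sym (trans
      (cong₂ (λ u v → u ⊕ (⊖ v)) (L-add lin c d y) (combination-⊕ N a b (w ∘ fs) y))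
      (regroup (L c y) (L d y) _ _))) (addS subQ q q₁)
    where
    regroup : ∀ u v s t → (u ⊕ v) ⊕ (⊖ (s ⊕ t)) ≡ (u ⊕ (⊖ s)) ⊕ (v ⊕ (⊖ t))
    regroup = solve-∀ 𝔽₃-ring

  Pivot : Set
  Pivot = Σ (X → 𝔽₃) λ p₀ → P p₀ × Σ (Fin (suc N) → 𝔽₃) λ a →
    a fz ≡ 𝟙 × Q (L p₀ ⊝C combination (suc N) a w)

  extend : Spanning L P′ Q N → Dec Pivot → Spanning L P Q (suc N)
  extend (p , p∈ , gen) (yes (p₀ , p₀∈ , a , a₀≡𝟙 , q)) =
    p₀ ∷ᶠ p , (λ { fz → p₀∈ ; (fs i) → proj₁ (p∈ i) }) , generate
    where
    generate : ∀ c → P c → Σ (Fin (suc N) → 𝔽₃) λ e → Q (L (c ⊝C combination (suc N) e (p₀ ∷ᶠ p)))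
    generate c c∈ = b fz ∷ᶠ e , respS subQ
      (L-cong lin λ x → regroup′ (c x) (b fz ⊗ p₀ x) (combination N e p x)) qe
      where
      b : Fin (suc N) → 𝔽₃
      b = proj₁ (span c c∈)
      -- The pivot has first coordinate 1, so subtracting `b fz` times it clears the first
      -- coordinate of `c` and leads into `P′`.
      c′ : X → 𝔽₃
      c′ = c ⊝C (b fz ·C p₀)
      b′ : Fin N → 𝔽₃
      b′ i = b (fs i) ⊕ (𝟚 ⊗ (b fz ⊗ a (fs i)))
      regroup′ : ∀ c u v → (c ⊕ (⊖ u)) ⊕ (⊖ v) ≡ c ⊕ (⊖ (u ⊕ v))
      regroup′ = solve-∀ 𝔽₃-ring
      regroup : ∀ l l₀ s t b₀ w₀ →
        (l ⊕ (⊖ ((b₀ ⊗ w₀) ⊕ s))) ⊕ (⊖ (b₀ ⊗ (l₀ ⊕ (⊖ ((𝟙 ⊗ w₀) ⊕ t)))))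
        ≡ (l ⊕ (⊖ (b₀ ⊗ l₀))) ⊕ (⊖ (s ⊕ (⊖ (b₀ ⊗ t))))
      regroup = solve-∀ 𝔽₃-ring
      open ≡-Reasoning
      expand : ∀ y → ((L c ⊝C combination (suc N) b w) ⊝C
          (b fz ·C (L p₀ ⊝C combination (suc N) a w))) y ≡ (L c′ ⊝C combination N b′ (w ∘ fs)) y
      expand y = begin
        _ ≡⟨ cong (λ a₀ → (L c y ⊕ (⊖ (combination (suc N) b w y))) ⊕ (⊖ (b fz ⊗ (L p₀ y ⊕
               (⊖ ((a₀ ⊗ w fz y) ⊕ combination N (a ∘ fs) (w ∘ fs) y)))))) a₀≡𝟙 ⟩
        _ ≡⟨ regroup (L c y) (L p₀ y) (combination N (b ∘ fs) (w ∘ fs) y)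
               (combination N (a ∘ fs) (w ∘ fs) y) (b fz) (w fz y) ⟩
        _ ≡⟨ cong₂ (λ u v → u ⊕ (⊖ v))
               (sym (trans (L-sub lin c _ y) (cong (λ v → L c y ⊕ (⊖ v)) (L-scale lin (b fz) p₀ y))))
               (sym (trans (combination-⊕ N (b ∘ fs) _ (w ∘ fs) y)
                 (cong (combination N (b ∘ fs) (w ∘ fs) y ⊕_)
                   (trans (combination-⊗ N 𝟚 _ (w ∘ fs) y)
                   (trans (⊖-⊗ _) (cong ⊖_ (combination-⊗ N (b fz) (a ∘ fs) (w ∘ fs) y))))))) ⟩
        _ ∎
      c′∈ : P′ c′
      c′∈ = subS subP c∈ (scaleS subP (b fz) p₀∈) , b′ ,
        respS subQ expand (subS subQ (proj₂ (span c c∈)) (scaleS subQ (b fz) q))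
      e : Fin N → 𝔽₃
      e = proj₁ (gen c′ c′∈)
      qe : Q (L (c′ ⊝C combination N e p))
      qe = proj₂ (gen c′ c′∈)
  extend (p , p∈ , gen) (no ¬pivot) =
    (λ _ → 𝟘) ∷ᶠ p , (λ { fz → zeroS subP ; (fs i) → proj₁ (p∈ i) }) , generate
    where
    generate : ∀ c → P c →
      Σ (Fin (suc N) → 𝔽₃) λ e → Q (L (c ⊝C combination (suc N) e ((λ _ → 𝟘) ∷ᶠ p)))
    generate c c∈ with span c c∈
    ... | b , q with ≡𝟘? (b fz)
    -- A non-zero element of 𝔽₃ is its own inverse, so `b fz ·C c` would be a pivot.
    ... | no b₀≢𝟘 = contradiction
      ( b fz ·C c , scaleS subP (b fz) c∈ , (λ i → b fz ⊗ b i) , ⊗-self-inverse (b fz) b₀≢𝟘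
      , respS subQ (λ y → trans (distrib (b fz) (L c y) _)
          (cong₂ (λ u v → u ⊕ (⊖ v)) (sym (L-scale lin (b fz) c y))
            (sym (combination-⊗ (suc N) (b fz) b w y)))) (scaleS subQ (b fz) q)) ¬pivot
      where
      distrib : ∀ b l s → b ⊗ (l ⊕ (⊖ s)) ≡ (b ⊗ l) ⊕ (⊖ (b ⊗ s))
      distrib = solve-∀ 𝔽₃-ring
    ... | yes b₀≡𝟘 with gen c (c∈ , b ∘ fs , respS subQ
            (λ y → cong (λ b₀ → L c y ⊕ (⊖ ((b₀ ⊗ w fz y) ⊕ combination N (b ∘ fs) (w ∘ fs) y))) b₀≡𝟘) q)
    ... | e , qe = 𝟘 ∷ᶠ e , qe

toFin3 : 𝔽₃ → Fin 3
toFin3 𝟘 = fz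
toFin3 𝟙 = fs fz
toFin3 𝟚 = fs (fs fz)

fromFin3 : Fin 3 → 𝔽₃
fromFin3 fz           = 𝟘
fromFin3 (fs fz)      = 𝟙
fromFin3 (fs (fs fz)) = 𝟚

from-to : ∀ x → fromFin3 (toFin3 x) ≡ x
from-to 𝟘 = refl
from-to 𝟙 = refl
from-to 𝟚 = refl

to-from : ∀ i → toFin3 (fromFin3 i) ≡ i
to-from fz           = refl
to-from (fs fz)      = refl
to-from (fs (fs fz)) = refl

funToFin-cong : ∀ {m n} {f g : Fin m → Fin n} → (∀ i → f i ≡ g i) → funToFin f ≡ funToFin g
funToFin-cong {zero}  eq = refl
funToFin-cong {suc m} eq = cong₂ combine (eq fz) (funToFin-cong (eq ∘ fs))

-- By counting: M defines an injection of a set of size 3 ^ h into one of size 3 ^ N.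
independent⇒≤ : ∀ h N (M : Fin h → Fin N → 𝔽₃) →
  (∀ a → (∀ j → combination h a M j ≡ 𝟘) → ∀ i → a i ≡ 𝟘) → h ≤ N
independent⇒≤ h N M indep = decidable-stable (h ≤? N) λ h≰N →
  <⇒≱ (^-monoʳ-< 3 (s≤s (s≤s z≤n)) (≰⇒> h≰N)) (injective⇒≤ {f = code} code-injective)
  where
  vec : Fin (3 ^ h) → Fin h → 𝔽₃
  vec u i = fromFin3 (finToFun u i)
  code : Fin (3 ^ h) → Fin (3 ^ N)
  code u = funToFin (λ j → toFin3 (combination h (vec u) M j))
  code-injective : ∀ {u v} → code u ≡ code v → u ≡ v
  code-injective {u} {v} eq = begin
    u                       ≡⟨ sym (funToFin-finToFin {h} u) ⟩
    funToFin (finToFun {3} {h} u) ≡⟨ funToFin-cong same ⟩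
    funToFin (finToFun {3} {h} v) ≡⟨ funToFin-finToFin {h} v ⟩
    v                       ∎
    where
    open ≡-Reasoning
    same-image : ∀ j → combination h (vec u) M j ≡ combination h (vec v) M j
    same-image j = begin
      _ ≡⟨ sym (from-to _) ⟩
      _ ≡⟨ cong fromFin3 (sym (finToFun-funToFin (λ j → toFin3 (combination h (vec u) M j)) j)) ⟩
      fromFin3 (finToFun {3} {N} (code u) j) ≡⟨ cong (λ z → fromFin3 (finToFun {3} {N} z j)) eq ⟩
      fromFin3 (finToFun {3} {N} (code v) j)
        ≡⟨ cong fromFin3 (finToFun-funToFin (λ j → toFin3 (combination h (vec v) M j)) j) ⟩
      _ ≡⟨ from-to _ ⟩
      _ ∎
    difference : ∀ i → vec u i ⊕ (𝟚 ⊗ vec v i) ≡ 𝟘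
    difference = indep (λ i → vec u i ⊕ (𝟚 ⊗ vec v i)) λ j →
      trans (combination-⊕ h (vec u) _ M j)
      (trans (cong₂ _⊕_ (same-image j) (trans (combination-⊗ h 𝟚 (vec v) M j)
          (⊖-⊗ (combination h (vec v) M j)))) (⊕-inverseʳ (combination h (vec v) M j)))
    same : ∀ i → finToFun {3} {h} u i ≡ finToFun v i
    same i = trans (sym (to-from _)) (trans (cong toFin3
      (⊖-cancel _ _ (trans (cong (vec u i ⊕_) (sym (⊖-⊗ (vec v i)))) (difference i)))) (to-from _))

-- Clique complexes in the exterior algebra

-- The exterior algebra on m generators: c S is the coefficient of the product, in increasing order, of
-- the generators in S. The boundary bd is the sum of all contractions.
Λ : ℕ → Set
Λ m = Vec Bool m → 𝔽₃

-- Interior product with the i-th dual generator; each earlier generator in the set contributes a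
-- sign. On chains, contracting with `i` passes to the link of `i`, and `wedge i` is the cone with
-- apex `i`.
contract : ∀ {m} → Fin m → Λ m → Λ m
contract fz     c (true ∷ S)  = 𝟘
contract fz     c (false ∷ S) = c (true ∷ S)
contract (fs i) c (true ∷ S)  = ⊖ contract i (c ∘ (true ∷_)) S
contract (fs i) c (false ∷ S) = contract i (c ∘ (false ∷_)) S

wedge : ∀ {m} → Fin m → Λ m → Λ m
wedge fz     c (true ∷ S)  = c (false ∷ S)
wedge fz     c (false ∷ S) = 𝟘
wedge (fs i) c (true ∷ S)  = ⊖ wedge i (c ∘ (true ∷_)) S
wedge (fs i) c (false ∷ S) = wedge i (c ∘ (false ∷_)) S

bd : ∀ {m} → Λ m → Λ m
bd c []          = 𝟘
bd c (true ∷ S)  = ⊖ bd (c ∘ (true ∷_)) S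
bd c (false ∷ S) = c (true ∷ S) ⊕ bd (c ∘ (false ∷_)) S

⊖-⊕ : ∀ x y → ⊖ (x ⊕ y) ≡ (⊖ x) ⊕ (⊖ y)
⊖-⊕ = solve-∀ 𝔽₃-ring

⊖-⊖ : ∀ x → ⊖ (⊖ x) ≡ x
⊖-⊖ = solve-∀ 𝔽₃-ring

contract-linear : ∀ {m} (i : Fin m) → IsLinear (contract i)
L-cong (contract-linear fz) eq (true ∷ S)      = refl
L-cong (contract-linear fz) eq (false ∷ S)     = eq _
L-cong (contract-linear (fs i)) eq (true ∷ S)  = cong ⊖_ (L-cong (contract-linear i) (eq ∘ (true ∷_)) S)
L-cong (contract-linear (fs i)) eq (false ∷ S) = L-cong (contract-linear i) (eq ∘ (false ∷_)) S
L-add (contract-linear fz) c d (true ∷ S)      = refl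
L-add (contract-linear fz) c d (false ∷ S)     = refl
L-add (contract-linear (fs i)) c d (true ∷ S)  = trans (cong ⊖_ (L-add (contract-linear i) (c ∘ (true ∷_)) (d ∘ (true ∷_)) S))
  (⊖-⊕ (contract i (c ∘ (true ∷_)) S) (contract i (d ∘ (true ∷_)) S))
L-add (contract-linear (fs i)) c d (false ∷ S) = L-add (contract-linear i) _ _ S

wedge-linear : ∀ {m} (i : Fin m) → IsLinear (wedge i)
L-cong (wedge-linear fz) eq (true ∷ S)      = eq _
L-cong (wedge-linear fz) eq (false ∷ S)     = refl
L-cong (wedge-linear (fs i)) eq (true ∷ S)  = cong ⊖_ (L-cong (wedge-linear i) (eq ∘ (true ∷_)) S)
L-cong (wedge-linear (fs i)) eq (false ∷ S) = L-cong (wedge-linear i) (eq ∘ (false ∷_)) S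
L-add (wedge-linear fz) c d (true ∷ S)      = refl
L-add (wedge-linear fz) c d (false ∷ S)     = refl
L-add (wedge-linear (fs i)) c d (true ∷ S)  = trans (cong ⊖_ (L-add (wedge-linear i) (c ∘ (true ∷_)) (d ∘ (true ∷_)) S))
  (⊖-⊕ (wedge i (c ∘ (true ∷_)) S) (wedge i (d ∘ (true ∷_)) S))
L-add (wedge-linear (fs i)) c d (false ∷ S) = L-add (wedge-linear i) _ _ S

bd-linear : ∀ {m} → IsLinear (bd {m})
L-cong bd-linear eq []          = refl
L-cong bd-linear eq (true ∷ S)  = cong ⊖_ (L-cong bd-linear (eq ∘ (true ∷_)) S)
L-cong bd-linear eq (false ∷ S) = cong₂ _⊕_ (eq _) (L-cong bd-linear (eq ∘ (false ∷_)) S)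
L-add bd-linear c d []          = refl
L-add bd-linear c d (true ∷ S)  = trans (cong ⊖_ (L-add bd-linear (c ∘ (true ∷_)) (d ∘ (true ∷_)) S))
  (⊖-⊕ (bd (c ∘ (true ∷_)) S) (bd (d ∘ (true ∷_)) S))
L-add bd-linear c d (false ∷ S) = trans (cong ((c _ ⊕ d _) ⊕_) (L-add bd-linear _ _ S))
  (⊕-interchange (c _) (d _) _ _)

L-neg : ∀ {X Y : Set} {L : (X → 𝔽₃) → (Y → 𝔽₃)} → IsLinear L → ∀ c y → L (⊖_ ∘ c) y ≡ ⊖ L c y
L-neg lin c y = trans (L-cong lin (λ x → sym (⊖-⊗ (c x))) y) (trans (L-scale lin 𝟚 c y) (⊖-⊗ _))

-- `bd` is an antiderivation that sends every generator to 1. Coning from `i` is therefore a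
-- contracting homotopy.
bd-wedge : ∀ {m} i (c : Λ m) S → bd (wedge i c) S ⊕ wedge i (bd c) S ≡ c S
bd-wedge fz c (true ∷ S) = cancel (c (true ∷ S)) (bd (c ∘ (false ∷_)) S)
  where
  cancel : ∀ x y → (⊖ y) ⊕ (x ⊕ y) ≡ x
  cancel = solve-∀ 𝔽₃-ring
bd-wedge fz c (false ∷ S) = trans (⊕-identityʳ _)
  (trans (cong (c (false ∷ S) ⊕_) (L-zero bd-linear S)) (⊕-identityʳ _))
bd-wedge (fs i) c (true ∷ S) = trans
  (cong₂ (λ u v → (⊖ u) ⊕ (⊖ v)) (L-neg bd-linear (wedge i (c ∘ (true ∷_))) S)
    (L-neg (wedge-linear i) (bd (c ∘ (true ∷_))) S))
  (trans (cong₂ _⊕_ (⊖-⊖ (bd (wedge i (c ∘ (true ∷_))) S)) (⊖-⊖ (wedge i (bd (c ∘ (true ∷_))) S))) (bd-wedge i (c ∘ (true ∷_)) S))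
bd-wedge (fs i) c (false ∷ S) = trans
  (cong (((⊖ wedge i (c ∘ (true ∷_)) S) ⊕ bd (wedge i (c ∘ (false ∷_))) S) ⊕_)
    (L-add (wedge-linear i) (c ∘ (true ∷_)) (bd (c ∘ (false ∷_))) S))
  (trans (cancel (wedge i (c ∘ (true ∷_)) S) (bd (wedge i (c ∘ (false ∷_))) S) (wedge i (bd (c ∘ (false ∷_))) S)) (bd-wedge i (c ∘ (false ∷_)) S))
  where
  cancel : ∀ x y z → ((⊖ x) ⊕ y) ⊕ (x ⊕ z) ≡ y ⊕ z
  cancel = solve-∀ 𝔽₃-ring

-- Contractions anticommute and `bd` is their sum. Hence contraction is a chain map up to sign and
-- sends cycles to cycles.
bd-contract : ∀ {m} i (c : Λ m) S → bd (contract i c) S ⊕ contract i (bd c) S ≡ 𝟘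
bd-contract fz c (true ∷ S) = cong (λ u → (⊖ u) ⊕ 𝟘) (L-zero bd-linear S)
bd-contract fz c (false ∷ S) = ⊕-inverseʳ (bd (c ∘ (true ∷_)) S)
bd-contract (fs i) c (true ∷ S) = trans
  (cong₂ (λ u v → (⊖ u) ⊕ (⊖ v)) (L-neg bd-linear (contract i (c ∘ (true ∷_))) S)
    (L-neg (contract-linear i) (bd (c ∘ (true ∷_))) S))
  (trans (cong₂ _⊕_ (⊖-⊖ (bd (contract i (c ∘ (true ∷_))) S)) (⊖-⊖ (contract i (bd (c ∘ (true ∷_))) S))) (bd-contract i (c ∘ (true ∷_)) S))
bd-contract (fs i) c (false ∷ S) = trans
  (cong (((⊖ contract i (c ∘ (true ∷_)) S) ⊕ bd (contract i (c ∘ (false ∷_))) S) ⊕_)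
    (L-add (contract-linear i) (c ∘ (true ∷_)) (bd (c ∘ (false ∷_))) S))
  (trans (cancel (contract i (c ∘ (true ∷_)) S) (bd (contract i (c ∘ (false ∷_))) S) (contract i (bd (c ∘ (false ∷_))) S)) (bd-contract i (c ∘ (false ∷_)) S))
  where
  cancel : ∀ x y z → ((⊖ x) ⊕ y) ⊕ (x ⊕ z) ≡ y ⊕ z
  cancel = solve-∀ 𝔽₃-ring

contract-wedge : ∀ {m} i (c : Λ m) S → contract i (wedge i c) S ⊕ wedge i (contract i c) S ≡ c S
contract-wedge fz c (true ∷ S)  = refl
contract-wedge fz c (false ∷ S) = ⊕-identityʳ _
contract-wedge (fs i) c (true ∷ S) = trans
  (cong₂ (λ u v → (⊖ u) ⊕ (⊖ v)) (L-neg (contract-linear i) (wedge i (c ∘ (true ∷_))) S)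
    (L-neg (wedge-linear i) (contract i (c ∘ (true ∷_))) S))
  (trans (cong₂ _⊕_ (⊖-⊖ (contract i (wedge i (c ∘ (true ∷_))) S)) (⊖-⊖ (wedge i (contract i (c ∘ (true ∷_))) S))) (contract-wedge i (c ∘ (true ∷_)) S))
contract-wedge (fs i) c (false ∷ S) = contract-wedge i (c ∘ (false ∷_)) S

bd-bd : ∀ {m} (c : Λ m) S → bd (bd c) S ≡ 𝟘
bd-bd c [] = refl
bd-bd c (true ∷ S) = cong ⊖_ (trans (L-neg bd-linear (bd (c ∘ (true ∷_))) S) (cong ⊖_ (bd-bd (c ∘ (true ∷_)) S)))
bd-bd c (false ∷ S) = trans
  (cong ((⊖ bd (c ∘ (true ∷_)) S) ⊕_) (L-add bd-linear (c ∘ (true ∷_)) (bd (c ∘ (false ∷_))) S))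
  (trans (cancel (bd (c ∘ (true ∷_)) S) (bd (bd (c ∘ (false ∷_))) S)) (bd-bd (c ∘ (false ∷_)) S))
  where
  cancel : ∀ x y → (⊖ x) ⊕ (x ⊕ y) ≡ y
  cancel = solve-∀ 𝔽₃-ring

⊖-≢𝟘 : ∀ {x} → ⊖ x ≢ 𝟘 → x ≢ 𝟘
⊖-≢𝟘 ne eq = ne (cong ⊖_ eq)

⊖-≢𝟘⁻ : ∀ {x} → x ≢ 𝟘 → ⊖ x ≢ 𝟘
⊖-≢𝟘⁻ {x} ne eq = ne (trans (sym (⊖-⊖ x)) (cong ⊖_ eq))

⊕-≢𝟘 : ∀ {x y} → x ⊕ y ≢ 𝟘 → x ≢ 𝟘 ⊎ y ≢ 𝟘
⊕-≢𝟘 {𝟘} ne = inj₂ ne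
⊕-≢𝟘 {𝟙} ne = inj₁ λ ()
⊕-≢𝟘 {𝟚} ne = inj₁ λ ()

contract-support : ∀ {m} i (c : Λ m) S → contract i c S ≢ 𝟘 →
  lookup S i ≡ false × c (S [ i ]≔ true) ≢ 𝟘
contract-support fz c (true ∷ S) ne      = contradiction refl ne
contract-support fz c (false ∷ S) ne     = refl , ne
contract-support (fs i) c (true ∷ S) ne  = contract-support i _ S (⊖-≢𝟘 ne)
contract-support (fs i) c (false ∷ S) ne = contract-support i _ S ne

-- Turns the vanishing of `contract i c` into a criterion for `c` to avoid the vertex `i`.
contract-support⁻ : ∀ {m} i (c : Λ m) S → lookup S i ≡ true → c S ≢ 𝟘 →
  contract i c (S [ i ]≔ false) ≢ 𝟘
contract-support⁻ fz c (true ∷ S) i∈S ne      = ne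
contract-support⁻ (fs i) c (true ∷ S) i∈S ne  = ⊖-≢𝟘⁻ (contract-support⁻ i _ S i∈S ne)
contract-support⁻ (fs i) c (false ∷ S) i∈S ne = contract-support⁻ i _ S i∈S ne

wedge-support : ∀ {m} i (c : Λ m) S → wedge i c S ≢ 𝟘 →
  lookup S i ≡ true × c (S [ i ]≔ false) ≢ 𝟘
wedge-support fz c (true ∷ S) ne      = refl , ne
wedge-support fz c (false ∷ S) ne     = contradiction refl ne
wedge-support (fs i) c (true ∷ S) ne  = wedge-support i _ S (⊖-≢𝟘 ne)
wedge-support (fs i) c (false ∷ S) ne = wedge-support i _ S ne

bd-support : ∀ {m} (c : Λ m) S → bd c S ≢ 𝟘 →
  Σ (Fin m) λ i → lookup S i ≡ false × c (S [ i ]≔ true) ≢ 𝟘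
bd-support c [] ne = contradiction refl ne
bd-support c (true ∷ S) ne with bd-support _ S (⊖-≢𝟘 ne)
... | i , i∉S , ne′ = fs i , i∉S , ne′
bd-support c (false ∷ S) ne with ⊕-≢𝟘 ne
... | inj₁ ne′ = fz , refl , ne′
... | inj₂ ne′ with bd-support _ S ne′
...   | i , i∉S , ne″ = fs i , i∉S , ne″

card : ∀ {m} → Vec Bool m → ℕ
card []          = 0
card (true ∷ S)  = suc (card S)
card (false ∷ S) = card S

card-insert : ∀ {m} (S : Vec Bool m) i → lookup S i ≡ false → card (S [ i ]≔ true) ≡ suc (card S)
card-insert (false ∷ S) fz     i∉S = refl
card-insert (true ∷ S)  (fs i) i∉S = cong suc (card-insert S i i∉S)
card-insert (false ∷ S) (fs i) i∉S = card-insert S i i∉S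

card-zero : ∀ {m} (S : Vec Bool m) → card S ≡ 0 → ∀ i → lookup S i ≢ true
card-zero (false ∷ S) eq (fs i) = card-zero S eq i

card-suc : ∀ {m} (S : Vec Bool m) {s} → card S ≡ suc s → Σ (Fin m) λ i → lookup S i ≡ true
card-suc (true ∷ S)  eq = fz , refl
card-suc (false ∷ S) eq with card-suc S eq
... | i , i∈S = fs i , i∈S

update-same : ∀ {m} (S : Vec Bool m) i {b} → lookup S i ≡ b → S [ i ]≔ b ≡ S
update-same S i refl = []≔-lookup S i

-- Homology bounds for clique complexes

module Complex {m : ℕ} (Compat : Fin m → Fin m → Set)
  (compat-sym : ∀ {i j} → Compat i j → Compat j i) (compat-irrefl : ∀ {i} → ¬ Compat i i) where

  -- In a clique complex the deletion and the link of a vertex are again clique complexes, on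
  -- smaller vertex sets. One ambient relation and a varying predicate `A` thus describe every
  -- complex that occurs.
  record Face (A : Fin m → Set) (s : ℕ) (S : Vec Bool m) : Set where
    field
      size    : card S ≡ s
      allowed : ∀ i → lookup S i ≡ true → A i
      clique  : ∀ i j → lookup S i ≡ true → lookup S j ≡ true → i ≢ j → Compat i j
  open Face

  Link : Fin m → (Fin m → Set) → Fin m → Set
  Link i A j = A j × Compat i j

  Delete : Fin m → (Fin m → Set) → Fin m → Set
  Delete i A j = A j × j ≢ i

  face-remove : ∀ {A s S} i → lookup S i ≡ true → Face A (suc s) S → Face (Link i A) s (S [ i ]≔ false)
  face-remove {A} {s} {S} i i∈S f = record
    { size    = suc-injective (trans (sym (card-insert S′ i (lookup∘update i S false)))
                  (trans (cong card (trans ([]≔-idempotent S i) (update-same S i i∈S))) (size f)))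
    ; allowed = λ j j∈ → allowed f j (∈S j∈) , clique f i j i∈S (∈S j∈) (≢i j∈ ∘ sym)
    ; clique  = λ j k j∈ k∈ → clique f j k (∈S j∈) (∈S k∈)
    }
    where
    S′ : Vec Bool m
    S′ = S [ i ]≔ false
    ≢i : ∀ {j} → lookup S′ j ≡ true → j ≢ i
    ≢i j∈ refl = contradiction (trans (sym j∈) (lookup∘update i S false)) λ ()
    ∈S : ∀ {j} → lookup S′ j ≡ true → lookup S j ≡ true
    ∈S {j} j∈ = trans (sym (lookup∘update′ (≢i j∈) S false)) j∈

  face-insert : ∀ {A s S} i → lookup S i ≡ false → A i → Face (Link i A) s S → Face A (suc s) (S [ i ]≔ true)
  face-insert {A} {s} {S} i i∉S Ai f = record
    { size    = trans (card-insert S i i∉S) (cong suc (size f))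
    ; allowed = allowed′
    ; clique  = clique′
    }
    where
    ∈S : ∀ {j} → j ≢ i → lookup (S [ i ]≔ true) j ≡ true → lookup S j ≡ true
    ∈S j≢i j∈ = trans (sym (lookup∘update′ j≢i S true)) j∈
    allowed′ : ∀ j → lookup (S [ i ]≔ true) j ≡ true → A j
    allowed′ j j∈ with j Fin.≟ i
    ... | yes refl = Ai
    ... | no j≢i   = proj₁ (allowed f j (∈S j≢i j∈))
    clique′ : ∀ j k → lookup (S [ i ]≔ true) j ≡ true → lookup (S [ i ]≔ true) k ≡ true → j ≢ k → Compat j k
    clique′ j k j∈ k∈ j≢k with j Fin.≟ i | k Fin.≟ i
    ... | yes refl | yes refl = contradiction refl j≢k
    ... | yes refl | no k≢i   = proj₂ (allowed f k (∈S k≢i k∈))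
    ... | no j≢i   | yes refl = compat-sym (proj₂ (allowed f j (∈S j≢i j∈)))
    ... | no j≢i   | no k≢i   = clique f j k (∈S j≢i j∈) (∈S k≢i k∈) j≢k

  link⇒∉ : ∀ {A s S i} → Face (Link i A) s S → lookup S i ≡ false
  link⇒∉ {S = S} {i} f with lookup S i in eq
  ... | true  = contradiction (proj₂ (allowed f i eq)) compat-irrefl
  ... | false = refl

  In : (Fin m → Set) → ℕ → Λ m → Set
  In A s c = ∀ S → c S ≢ 𝟘 → Face A s S

  Cycle : (Fin m → Set) → ℕ → Λ m → Set
  Cycle A s c = In A s c × ∀ S → bd c S ≡ 𝟘

  Boundary : (Fin m → Set) → ℕ → Λ m → Set
  Boundary A s c = Σ (Λ m) λ y → In A (suc s) y × ∀ S → bd y S ≡ c S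

  -- Doubly negated, so that excluded middle is available when bounding a dimension.
  DimBound : (Fin m → Set) → ℕ → ℕ → Set
  DimBound A s N = ¬ ¬ Spanning id (Cycle A s) (Boundary A s) N

  In-⊆ : ∀ {A B s c} → (∀ i → A i → B i) → In A s c → In B s c
  In-⊆ A⊆B c∈ S ne = record
    { size = size f ; allowed = λ i i∈ → A⊆B i (allowed f i i∈) ; clique = clique f }
    where f = c∈ S ne

  Cycle-⊆ : ∀ {A B s c} → (∀ i → A i → B i) → Cycle A s c → Cycle B s c
  Cycle-⊆ A⊆B (c∈ , ∂c) = In-⊆ A⊆B c∈ , ∂c

  Boundary-⊆ : ∀ {A B s c} → (∀ i → A i → B i) → Boundary A s c → Boundary B s c
  Boundary-⊆ A⊆B (y , y∈ , ∂y) = y , In-⊆ A⊆B y∈ , ∂y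

  In-subspace : ∀ A s → IsSubspace (In A s)
  respS (In-subspace A s) eq c∈ S ne = c∈ S (ne ∘ trans (sym (eq S)))
  zeroS (In-subspace A s) S ne = contradiction refl ne
  addS (In-subspace A s) c∈ d∈ S ne with ⊕-≢𝟘 ne
  ... | inj₁ c≢𝟘 = c∈ S c≢𝟘
  ... | inj₂ d≢𝟘 = d∈ S d≢𝟘

  Cycle-subspace : ∀ A s → IsSubspace (Cycle A s)
  respS (Cycle-subspace A s) eq (c∈ , ∂c) = respS (In-subspace A s) eq c∈ ,
    λ S → trans (sym (L-cong bd-linear eq S)) (∂c S)
  zeroS (Cycle-subspace A s) = zeroS (In-subspace A s) , L-zero bd-linear
  addS (Cycle-subspace A s) (c∈ , ∂c) (d∈ , ∂d) = addS (In-subspace A s) c∈ d∈ ,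
    λ S → trans (L-add bd-linear _ _ S) (cong₂ _⊕_ (∂c S) (∂d S))

  Boundary-subspace : ∀ A s → IsSubspace (Boundary A s)
  respS (Boundary-subspace A s) eq (y , y∈ , ∂y) = y , y∈ , λ S → trans (∂y S) (eq S)
  zeroS (Boundary-subspace A s) = _ , zeroS (In-subspace A (suc s)) , L-zero bd-linear
  addS (Boundary-subspace A s) (y , y∈ , ∂y) (z , z∈ , ∂z) = _ , addS (In-subspace A (suc s)) y∈ z∈ ,
    λ S → trans (L-add bd-linear y z S) (cong₂ _⊕_ (∂y S) (∂z S))

  dimBound-≅ : ∀ {A B s N} → (∀ i → A i → B i) → (∀ i → B i → A i) → DimBound A s N → DimBound B s N
  dimBound-≅ A⊆B B⊆A d k = d λ (p , p∈ , gen) →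
    k (p , (λ i → Cycle-⊆ A⊆B (p∈ i)) , λ c c∈ →
      let a , b = gen c (Cycle-⊆ B⊆A c∈) in a , Boundary-⊆ A⊆B b)

  In-bd : ∀ {A s c} → In A (suc s) c → In A s (bd c)
  In-bd {c = c} c∈ S ne with bd-support c S ne
  ... | i , i∉S , ne′ = record
    { size    = size f
    ; allowed = λ j j∈ → proj₁ (allowed f j j∈)
    ; clique  = clique f }
    where
    f : Face _ _ S
    f = subst (Face _ _) (trans ([]≔-idempotent S i) (update-same S i i∉S))
      (face-remove i (lookup∘update i S true) (c∈ _ ne′))

  In-contract : ∀ {A s c} i → In A (suc s) c → In (Link i A) s (contract i c)
  In-contract {c = c} i c∈ S ne with contract-support i c S ne
  ... | i∉S , ne′ = subst (Face _ _) (trans ([]≔-idempotent S i) (update-same S i i∉S))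
    (face-remove i (lookup∘update i S true) (c∈ _ ne′))

  In-wedge : ∀ {A s c} i → A i → (∀ S → lookup S i ≡ false → c S ≢ 𝟘 → Face (Link i A) s S) →
    In A (suc s) (wedge i c)
  In-wedge {c = c} i Ai link S ne with wedge-support i c S ne
  ... | i∈S , ne′ = subst (Face _ _) (trans ([]≔-idempotent S i) (update-same S i i∈S))
    (face-insert i i∉ Ai (link _ i∉ ne′))
    where i∉ = lookup∘update i S false

  -- On a cycle, `bd-wedge` says that coning from `i` produces a filling. Terms already containing
  -- `i` are killed by the wedge, so only the faces missing `i` must be joinable to it.
  dimBound-apex : ∀ {A s} i → A i → (∀ S → lookup S i ≡ false → Face A s S → Face (Link i A) s S) →
    DimBound A s 0
  dimBound-apex {A} {s} i Ai link k = k ((λ ()) , (λ ()) , λ c (c∈ , ∂c) → (λ ()) ,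
    wedge i c , In-wedge i Ai (λ S i∉S ne → link S i∉S (c∈ S ne)) , λ S → begin
      bd (wedge i c) S                     ≡⟨ sym (⊕-identityʳ _) ⟩
      bd (wedge i c) S ⊕ 𝟘                 ≡⟨ cong (bd (wedge i c) S ⊕_) (sym (trans
                                                (L-cong (wedge-linear i) ∂c S) (L-zero (wedge-linear i) S))) ⟩
      bd (wedge i c) S ⊕ wedge i (bd c) S  ≡⟨ bd-wedge i c S ⟩
      c S                                  ≡⟨ sym (⊕-identityʳ _) ⟩
      c S ⊕ 𝟘                              ∎)
    where open ≡-Reasoning

  dimBound-cone : ∀ {A} s i → A i → (∀ j → A j → j ≢ i → Compat i j) → DimBound A s 0
  dimBound-cone s i Ai cone = dimBound-apex i Ai λ S i∉S f → record
    { size    = size f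
    ; allowed = λ j j∈ → allowed f j j∈ , cone j (allowed f j j∈)
        λ { refl → contradiction (trans (sym j∈) i∉S) λ () }
    ; clique  = clique f }

  dimBound-nonempty : ∀ {A} i → A i → DimBound A 0 0
  dimBound-nonempty i Ai = dimBound-apex i Ai λ S _ f → record
    { size    = size f
    ; allowed = λ j j∈ → contradiction j∈ (card-zero S (size f) j)
    ; clique  = clique f }

  dimBound-empty : ∀ {A} s → (∀ i → ¬ A i) → DimBound A (suc s) 0
  dimBound-empty {A} s empty k = k ((λ ()) , (λ ()) , λ c (c∈ , _) → (λ ()) ,
    respS (Boundary-subspace A (suc s)) (λ S → sym (vanish c c∈ S)) (zeroS (Boundary-subspace A (suc s))))
    where
    vanish : ∀ c → In A (suc s) c → ∀ S → c S ⊕ 𝟘 ≡ 𝟘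
    vanish c c∈ S with ≡𝟘? (c S)
    ... | yes eq = cong (_⊕ 𝟘) eq
    ... | no ne with card-suc S (size (c∈ S ne))
    ...   | i , i∈S = contradiction (allowed (c∈ S ne) i i∈S) (empty i)

  bd-size-0 : ∀ {A c} → In A 0 c → ∀ S → bd c S ≡ 𝟘
  bd-size-0 {c = c} c∈ S with ≡𝟘? (bd c S)
  ... | yes eq = eq
  ... | no ne with bd-support c S ne
  ...   | i , i∉S , ne′ = contradiction (trans (sym (card-insert S i i∉S)) (size (c∈ _ ne′))) λ ()

  dimBound-size-0 : ∀ A → DimBound A 0 1
  dimBound-size-0 A k = k ((λ _ → δ) , (λ _ → δ∈ , bd-size-0 δ∈) , λ c (c∈ , _) → (λ _ → c ∅) ,
    respS (Boundary-subspace A 0) (λ S → sym (multiple c c∈ S)) (zeroS (Boundary-subspace A 0)))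
    where
    ∅ : Vec Bool m
    ∅ = replicate m false
    char : ℕ → 𝔽₃
    char zero    = 𝟙
    char (suc _) = 𝟘
    δ : Λ m
    δ S = char (card S)
    char≢𝟘 : ∀ {s} → char s ≢ 𝟘 → s ≡ 0
    char≢𝟘 {zero}  ne = refl
    char≢𝟘 {suc s} ne = contradiction refl ne
    δ∈ : In A 0 δ
    δ∈ S ne = record
      { size    = char≢𝟘 ne
      ; allowed = λ i i∈ → contradiction i∈ (card-zero S (char≢𝟘 ne) i)
      ; clique  = λ i _ i∈ → contradiction i∈ (card-zero S (char≢𝟘 ne) i) }
    card≡0 : ∀ {n} (S : Vec Bool n) → card S ≡ 0 → S ≡ replicate n false
    card≡0 []          eq = refl
    card≡0 (false ∷ S) eq = cong (false ∷_) (card≡0 S eq)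
    multiple : ∀ c → In A 0 c → ∀ S → c S ⊕ (⊖ ((c ∅ ⊗ δ S) ⊕ 𝟘)) ≡ 𝟘
    multiple c c∈ S with card S in eq
    ... | zero rewrite card≡0 S eq =
      trans (cong (λ u → c ∅ ⊕ (⊖ u)) (trans (⊕-identityʳ _) (⊗-comm (c ∅) 𝟙))) (⊕-inverseʳ (c ∅))
    ... | suc s with ≡𝟘? (c S)
    ...   | yes eq′ = cong₂ (λ u v → u ⊕ (⊖ (v ⊕ 𝟘))) eq′ (⊗-zeroʳ (c ∅))
    ...   | no ne = contradiction (trans (sym eq) (size (c∈ S ne))) λ ()

  infixr 5 _++ᶠ_
  _++ᶠ_ : ∀ {X : Set} {M N} → (Fin M → X) → (Fin N → X) → Fin (M + N) → X
  _++ᶠ_ {M = zero}  f g = g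
  _++ᶠ_ {M = suc M} f g = f fz ∷ᶠ ((f ∘ fs) ++ᶠ g)

  ++ᶠ-all : ∀ {X : Set} (P : X → Set) {M N} (f : Fin M → X) (g : Fin N → X) →
    (∀ i → P (f i)) → (∀ i → P (g i)) → ∀ i → P ((f ++ᶠ g) i)
  ++ᶠ-all P {zero}  f g pf pg i      = pg i
  ++ᶠ-all P {suc M} f g pf pg fz     = pf fz
  ++ᶠ-all P {suc M} f g pf pg (fs i) = ++ᶠ-all P (f ∘ fs) g (pf ∘ fs) pg i

  combination-++ : ∀ {X : Set} M N (a : Fin M → 𝔽₃) (b : Fin N → 𝔽₃) (p : Fin M → X → 𝔽₃) q x →
    combination (M + N) (a ++ᶠ b) (p ++ᶠ q) x ≡ combination M a p x ⊕ combination N b q x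
  combination-++ zero    N a b p q x = refl
  combination-++ (suc M) N a b p q x = trans
    (cong ((a fz ⊗ p fz x) ⊕_) (combination-++ M N (a ∘ fs) b (p ∘ fs) q x)) (sym (⊕-assoc (a fz ⊗ p fz x) _ _))

  dimBound-≤ : ∀ {A s M N} → M ≤ N → DimBound A s M → DimBound A s N
  dimBound-≤ {A} {s} {M} M≤N d with m≤n⇒∃[o]m+o≡n M≤N
  ... | K , refl = λ k → d λ (p , p∈ , gen) → k (p ++ᶠ (λ (_ : Fin K) _ → 𝟘) ,
    ++ᶠ-all (Cycle A s) p _ p∈ (λ _ → zeroS (Cycle-subspace A s)) , λ c c∈ →
      let a , b = gen c c∈ in a ++ᶠ (λ _ → 𝟘) ,
        respS (Boundary-subspace A s) (λ S → cong (λ u → c S ⊕ (⊖ u)) (sym (trans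
          (combination-++ M K a _ p _ S)
          (trans (cong (combination M a p S ⊕_) (Σ𝔽-zero K (λ _ → refl))) (⊕-identityʳ _))))) b)

  -- The long exact sequence of the pair (A, A ∖ i), whose relative term is the suspended link of i.
  dimBound-delete : ∀ {A s M N} i → A i → DimBound (Delete i A) (suc s) M → DimBound (Link i A) s N →
    DimBound A (suc s) (N + M)
  dimBound-delete {A} {s} {M} {N} i Ai dDel dLink k =
    dLink λ (w , w∈ , genLink) →
    -- Not every class of the link need come from a cycle of `A`. This step replaces `w` by `N`
    -- cycles of `A` whose contractions span the image of the homology of `A` in that of the link.
    spanning-subspace (contract-linear i) (Cycle-subspace A (suc s)) (Boundary-subspace (Link i A) s) N w
      (λ c c∈ → genLink (contract i c) (contract-cycle c∈)) λ (p , p∈ , genP) →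
    dDel λ (q , q∈ , genDel) →
    k (p ++ᶠ q , ++ᶠ-all (Cycle A (suc s)) p q p∈ (λ j → Cycle-⊆ (λ _ → proj₁) (q∈ j)) , λ c c∈ →
      let
        a , y , y∈ , ∂y = genP c c∈
        c₁ = c ⊝C combination N a p
        c₁∈ : Cycle A (suc s) c₁
        c₁∈ = subS (Cycle-subspace A (suc s)) c∈ (combinationS (Cycle-subspace A (suc s)) N a p∈)
        -- The contraction of `c₁` is `bd y`, and that of `bd (wedge i y)` is its negative. Adding
        -- this boundary keeps the class of `c₁` in `A` and moves it off `i`.
        b , bnd = genDel (c₁ +C bd (wedge i y)) (reduced c₁∈ y∈ ∂y)
      in a ++ᶠ b , respS (Boundary-subspace A (suc s))
        (λ S → trans (regroup (c S) (combination N a p S) (bd (wedge i y) S) (combination M b q S))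
          (cong (λ u → c S ⊕ (⊖ u)) (sym (combination-++ N M a b p q S))))
        (subS (Boundary-subspace A (suc s)) (Boundary-⊆ (λ _ → proj₁) bnd)
          (wedge i y , wedge∈ y∈ , λ _ → refl)))
    where
    regroup : ∀ c u v w → ((((c ⊕ (⊖ u)) ⊕ v) ⊕ (⊖ w)) ⊕ (⊖ v)) ≡ c ⊕ (⊖ (u ⊕ w))
    regroup = solve-∀ 𝔽₃-ring

    contract-cycle : ∀ {c} → Cycle A (suc s) c → Cycle (Link i A) s (contract i c)
    contract-cycle {c} (c∈ , ∂c) = In-contract i c∈ , λ S → begin
      bd (contract i c) S                        ≡⟨ sym (⊕-identityʳ _) ⟩
      bd (contract i c) S ⊕ 𝟘                    ≡⟨ cong (bd (contract i c) S ⊕_) (sym (trans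
        (L-cong (contract-linear i) ∂c S) (L-zero (contract-linear i) S))) ⟩
      bd (contract i c) S ⊕ contract i (bd c) S  ≡⟨ bd-contract i c S ⟩
      𝟘                                          ∎
      where open ≡-Reasoning

    wedge∈ : ∀ {y} → In (Link i A) (suc s) y → In A (suc (suc s)) (wedge i y)
    wedge∈ y∈ = In-wedge i Ai λ S _ → y∈ S

    module _ {c₁ y} (c₁∈ : Cycle A (suc s) c₁) (y∈ : In (Link i A) (suc s) y)
      (∂y : ∀ S → bd y S ≡ contract i c₁ S) where

      c₂ : Λ m
      c₂ = c₁ +C bd (wedge i y)

      contract-y : ∀ S → contract i y S ≡ 𝟘
      contract-y S with ≡𝟘? (contract i y S)
      ... | yes eq = eq
      ... | no ne with contract-support i y S ne
      ...   | _ , ne′ = contradiction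
        (trans (sym (link⇒∉ (y∈ _ ne′))) (lookup∘update i S true)) λ ()

      contract-wedge-y : ∀ S → contract i (wedge i y) S ≡ y S
      contract-wedge-y S = trans (sym (trans (cong (contract i (wedge i y) S ⊕_) (trans
        (L-cong (wedge-linear i) contract-y S) (L-zero (wedge-linear i) S))) (⊕-identityʳ _)))
        (contract-wedge i y S)

      contract-c₂ : ∀ S → contract i c₂ S ≡ 𝟘
      contract-c₂ S = begin
        contract i c₂ S
          ≡⟨ L-add (contract-linear i) c₁ _ S ⟩
        contract i c₁ S ⊕ contract i (bd (wedge i y)) S
          ≡⟨ cong (_⊕ contract i (bd (wedge i y)) S)
               (sym (trans (L-cong bd-linear contract-wedge-y S) (∂y S))) ⟩
        bd (contract i (wedge i y)) S ⊕ contract i (bd (wedge i y)) S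
          ≡⟨ bd-contract i (wedge i y) S ⟩
        𝟘 ∎
        where open ≡-Reasoning

      reduced : Cycle (Delete i A) (suc s) c₂
      reduced = c₂∈′ , λ S → trans (L-add bd-linear c₁ _ S) (cong₂ _⊕_ (proj₂ c₁∈ S) (bd-bd (wedge i y) S))
        where
        c₂∈ : In A (suc s) c₂
        c₂∈ = addS (In-subspace A (suc s)) (proj₁ c₁∈) (In-bd (wedge∈ y∈))
        c₂∈′ : In (Delete i A) (suc s) c₂
        -- A face through `i` with non-zero coefficient would survive in `contract i c₂`, which
        -- vanishes.
        c₂∈′ S ne = record
          { size    = size (c₂∈ S ne)
          ; allowed = λ j j∈ → allowed (c₂∈ S ne) j j∈ ,
              λ { refl → contract-support⁻ i c₂ S j∈ ne (contract-c₂ _) }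
          ; clique  = clique (c₂∈ S ne) }

-- Comparison with simplicial chains

Disjoint : ∀ {n} → Edge n → Edge n → Set
Disjoint (a , b) (c , d) = a ≢ c × a ≢ d × b ≢ c × b ≢ d

disjoint-sym : ∀ {n} {e f : Edge n} → Disjoint e f → Disjoint f e
disjoint-sym (p , q , r , s) = p ∘ sym , r ∘ sym , q ∘ sym , s ∘ sym

disjointE⇒ : ∀ {n} (e f : Edge n) → T (disjointE e f) → Disjoint e f
disjointE⇒ (a , b) (c , d) t with a Fin.≟ c | a Fin.≟ d | b Fin.≟ c | b Fin.≟ d
... | no p | no q | no r | no s = p , q , r , s

⇒disjointE : ∀ {n} (e f : Edge n) → Disjoint e f → T (disjointE e f)
⇒disjointE (a , b) (c , d) (p , q , r , s) with a Fin.≟ c | a Fin.≟ d | b Fin.≟ c | b Fin.≟ d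
... | yes a≡c | _       | _       | _       = p a≡c
... | no _    | yes a≡d | _       | _       = q a≡d
... | no _    | no _    | yes b≡c | _       = r b≡c
... | no _    | no _    | no _    | yes b≡d = s b≡d
... | no _    | no _    | no _    | no _    = tt

T-∧⁻ : ∀ {x y} → T (x ∧ y) → T x × T y
T-∧⁻ {true} t = tt , t

T-∧⁺ : ∀ {x y} → T x → T y → T (x ∧ y)
T-∧⁺ {true} _ t = t

isMatching⇒ : ∀ {n} (σ : List (Edge n)) → T (isMatching σ) → AllPairs Disjoint σ
isMatching⇒ []      t = []
isMatching⇒ (e ∷ σ) t = disjoint-all σ (proj₁ (T-∧⁻ t)) ∷ isMatching⇒ σ (proj₂ (T-∧⁻ t))
  where
  disjoint-all : ∀ τ → T (foldr (λ f acc → disjointE e f ∧ acc) true τ) → All (Disjoint e) τ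
  disjoint-all []      t = []
  disjoint-all (f ∷ τ) t = disjointE⇒ e f (proj₁ (T-∧⁻ t)) ∷ disjoint-all τ (proj₂ (T-∧⁻ t))

⇒isMatching : ∀ {n} {σ : List (Edge n)} → AllPairs Disjoint σ → T (isMatching σ)
⇒isMatching []                    = tt
⇒isMatching {σ = e ∷ σ} (ps ∷ pss) = T-∧⁺ (all-disjoint ps) (⇒isMatching pss)
  where
  all-disjoint : ∀ {τ} → All (Disjoint e) τ → T (foldr (λ f acc → disjointE e f ∧ acc) true τ)
  all-disjoint []       = tt
  all-disjoint (p ∷ ps) = T-∧⁺ (⇒disjointE e _ p) (all-disjoint ps)

select : ∀ {A : Set} (vs : List A) → Vec Bool (length vs) → List A
select []       []          = []
select (e ∷ vs) (true ∷ S)  = e ∷ select vs S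
select (e ∷ vs) (false ∷ S) = select vs S

select-⊆ : ∀ {A : Set} {x : A} vs S → x ∈ select vs S → x ∈ vs
select-⊆ []       []          ()
select-⊆ (e ∷ vs) (true ∷ S)  (here eq) = here eq
select-⊆ (e ∷ vs) (true ∷ S)  (there p) = there (select-⊆ vs S p)
select-⊆ (e ∷ vs) (false ∷ S) p         = there (select-⊆ vs S p)

head∉select : ∀ {A : Set} {e : A} {vs} → Unique (e ∷ vs) → ∀ S σ → e ∷ σ ≢ select vs S
head∉select {vs = vs} u S σ eq =
  Unique[x∷xs]⇒x∉xs u (select-⊆ vs S (subst (_ ∈_) eq (here refl)))

unique-tail : ∀ {A : Set} {e : A} {vs} → Unique (e ∷ vs) → Unique vs
unique-tail (_ ∷ u) = u

select-injective : ∀ {A : Set} {vs : List A} → Unique vs → ∀ S S′ → select vs S ≡ select vs S′ → S ≡ S′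
select-injective {vs = []}     u []          []           eq = refl
select-injective {vs = e ∷ vs} u (true ∷ S)  (true ∷ S′)  eq =
  cong (true ∷_) (select-injective (unique-tail u) S S′ (∷-injectiveʳ eq))
select-injective {vs = e ∷ vs} u (true ∷ S)  (false ∷ S′) eq = contradiction eq (head∉select u S′ _)
select-injective {vs = e ∷ vs} u (false ∷ S) (true ∷ S′)  eq = contradiction (sym eq) (head∉select u S _)
select-injective {vs = e ∷ vs} u (false ∷ S) (false ∷ S′) eq =
  cong (false ∷_) (select-injective (unique-tail u) S S′ eq)

∈-combs⁻ : ∀ {A : Set} s (vs : List A) {τ} → τ ∈ combs s vs →
  Σ (Vec Bool (length vs)) λ S → τ ≡ select vs S × card S ≡ s
∈-combs⁻ zero    []       (here refl) = [] , refl , refl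
∈-combs⁻ zero    (e ∷ vs) (here refl) with ∈-combs⁻ zero vs (here refl)
... | S , eq , size = false ∷ S , eq , size
∈-combs⁻ (suc s) (e ∷ vs) τ∈ with ∈-++⁻ (map (e ∷_) (combs s vs)) τ∈
... | inj₁ τ∈ˡ with ∈-map⁻ (e ∷_) τ∈ˡ
...   | τ′ , τ′∈ , refl with ∈-combs⁻ s vs τ′∈
...     | S , eq , size = true ∷ S , cong (e ∷_) eq , cong suc size
∈-combs⁻ (suc s) (e ∷ vs) τ∈ | inj₂ τ∈ʳ with ∈-combs⁻ (suc s) vs τ∈ʳ
... | S , eq , size = false ∷ S , eq , size

∈-combs⁺ : ∀ {A : Set} s (vs : List A) S → card S ≡ s → select vs S ∈ combs s vs
∈-combs⁺ zero    []       []          size = here refl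
∈-combs⁺ zero    (e ∷ vs) (false ∷ S) size with select vs S | ∈-combs⁺ zero vs S size
... | _ | here eq = here eq
∈-combs⁺ (suc s) []       []          ()
∈-combs⁺ (suc s) (e ∷ vs) (true ∷ S)  size = ∈-++⁺ˡ (∈-map⁺ (e ∷_) (∈-combs⁺ s vs S (suc-injective size)))
∈-combs⁺ (suc s) (e ∷ vs) (false ∷ S) size = ∈-++⁺ʳ (map (e ∷_) (combs s vs)) (∈-combs⁺ (suc s) vs S size)

combs-unique : ∀ {A : Set} s {vs : List A} → Unique vs → Unique (combs s vs)
combs-unique zero    u = [] ∷ []
combs-unique (suc s) {[]}     u = []
combs-unique (suc s) {e ∷ vs} u =
  ++⁺ (map⁺ ∷-injectiveʳ (combs-unique s (unique-tail u))) (combs-unique (suc s) (unique-tail u)) disjoint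
  where
  disjoint : ∀ {τ} → ¬ (τ ∈ map (e ∷_) (combs s vs) × τ ∈ combs (suc s) vs)
  disjoint (τ∈ˡ , τ∈ʳ) with ∈-map⁻ (e ∷_) τ∈ˡ | ∈-combs⁻ (suc s) vs τ∈ʳ
  ... | _ , _ , refl | S , eq , _ = head∉select u S _ eq

lookup-injective : ∀ {A : Set} {L : List A} → Unique L → ∀ i j → List.lookup L i ≡ List.lookup L j → i ≡ j
lookup-injective (p ∷ u) fz     fz     eq = refl
lookup-injective (p ∷ u) fz     (fs j) eq = contradiction eq (All.lookup p (∈-lookup j))
lookup-injective (p ∷ u) (fs i) fz     eq = contradiction (sym eq) (All.lookup p (∈-lookup i))
lookup-injective (p ∷ u) (fs i) (fs j) eq = cong fs (lookup-injective u i j eq)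

Clique : ∀ {n} (vs : List (Edge n)) → Vec Bool (length vs) → Set
Clique vs S = ∀ i j → lookup S i ≡ true → lookup S j ≡ true → i ≢ j →
  Disjoint (List.lookup vs i) (List.lookup vs j)

all-select⁺ : ∀ {A : Set} {P : A → Set} vs S →
  (∀ i → lookup S i ≡ true → P (List.lookup vs i)) → All P (select vs S)
all-select⁺ []       []          p = []
all-select⁺ (e ∷ vs) (true ∷ S)  p = p fz refl ∷ all-select⁺ vs S (p ∘ fs)
all-select⁺ (e ∷ vs) (false ∷ S) p = all-select⁺ vs S (p ∘ fs)

all-select⁻ : ∀ {A : Set} {P : A → Set} vs S → All P (select vs S) →
  ∀ i → lookup S i ≡ true → P (List.lookup vs i)
all-select⁻ (e ∷ vs) (true ∷ S)  (p ∷ ps) fz     i∈ = p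
all-select⁻ (e ∷ vs) (true ∷ S)  (p ∷ ps) (fs i) i∈ = all-select⁻ vs S ps i i∈
all-select⁻ (e ∷ vs) (false ∷ S) ps       (fs i) i∈ = all-select⁻ vs S ps i i∈

clique⇒allPairs : ∀ {n} (vs : List (Edge n)) S → Clique vs S → AllPairs Disjoint (select vs S)
clique⇒allPairs []       []          cl = []
clique⇒allPairs (e ∷ vs) (true ∷ S)  cl = all-select⁺ vs S (λ j j∈ → cl fz (fs j) refl j∈ λ ()) ∷
  clique⇒allPairs vs S λ i j i∈ j∈ i≢j → cl (fs i) (fs j) i∈ j∈ (i≢j ∘ Fin.suc-injective)
clique⇒allPairs (e ∷ vs) (false ∷ S) cl =
  clique⇒allPairs vs S λ i j i∈ j∈ i≢j → cl (fs i) (fs j) i∈ j∈ (i≢j ∘ Fin.suc-injective)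

allPairs⇒clique : ∀ {n} (vs : List (Edge n)) S → AllPairs Disjoint (select vs S) → Clique vs S
allPairs⇒clique (e ∷ vs) _ ps fz fz i∈ j∈ i≢j = contradiction refl i≢j
allPairs⇒clique (e ∷ vs) (true ∷ S) (p ∷ ps) fz (fs j) i∈ j∈ i≢j = all-select⁻ vs S p j j∈
allPairs⇒clique (e ∷ vs) (true ∷ S) (p ∷ ps) (fs i) fz i∈ j∈ i≢j = disjoint-sym (all-select⁻ vs S p i i∈)
allPairs⇒clique (e ∷ vs) (true ∷ S) (p ∷ ps) (fs i) (fs j) i∈ j∈ i≢j =
  allPairs⇒clique vs S ps i j i∈ j∈ (i≢j ∘ cong fs)
allPairs⇒clique (e ∷ vs) (false ∷ S) ps (fs i) (fs j) i∈ j∈ i≢j =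
  allPairs⇒clique vs S ps i j i∈ j∈ (i≢j ∘ cong fs)

∈-Faces⁻ : ∀ {n} (vs : List (Edge n)) s {τ} → τ ∈ Faces vs s →
  Σ (Vec Bool (length vs)) λ S → τ ≡ select vs S × card S ≡ s × Clique vs S
∈-Faces⁻ vs s τ∈ with ∈-filter⁻ (T? ∘ isMatching) {xs = combs s vs} τ∈
... | τ∈combs , t with ∈-combs⁻ s vs τ∈combs
...   | S , refl , size = S , refl , size , allPairs⇒clique vs S (isMatching⇒ _ t)

∈-Faces⁺ : ∀ {n} (vs : List (Edge n)) s S → card S ≡ s → Clique vs S → select vs S ∈ Faces vs s
∈-Faces⁺ vs s S size cl = ∈-filter⁺ (T? ∘ isMatching) (∈-combs⁺ s vs S size)
  (⇒isMatching (clique⇒allPairs vs S cl))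

Faces-unique : ∀ {n} {vs : List (Edge n)} s → Unique vs → Unique (Faces vs s)
Faces-unique s u = filter⁺ (T? ∘ isMatching) (combs-unique s u)

δ : ∀ {n} → List (Edge n) → List (Edge n) → 𝔽₃
δ σ τ = if σ ==L τ then 𝟙 else 𝟘

==E⇒≡ : ∀ {n} (e f : Edge n) → T (e ==E f) → e ≡ f
==E⇒≡ (a , b) (c , d) t with a Fin.≟ c | b Fin.≟ d
... | yes refl | yes refl = refl

==L⇒≡ : ∀ {n} (σ τ : List (Edge n)) → T (σ ==L τ) → σ ≡ τ
==L⇒≡ []      []      t = refl
==L⇒≡ (e ∷ σ) (f ∷ τ) t = cong₂ _∷_ (==E⇒≡ e f (proj₁ (T-∧⁻ t))) (==L⇒≡ σ τ (proj₂ (T-∧⁻ t)))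

==E-refl : ∀ {n} (e : Edge n) → (e ==E e) ≡ true
==E-refl (a , b) with a Fin.≟ a | b Fin.≟ b
... | yes _   | yes _   = refl
... | yes _   | no b≢b  = contradiction refl b≢b
... | no a≢a  | _       = contradiction refl a≢a

δ-∷ : ∀ {n} (e : Edge n) σ τ → δ (e ∷ σ) (e ∷ τ) ≡ δ σ τ
δ-∷ e σ τ rewrite ==E-refl e = refl

δ-refl : ∀ {n} (σ : List (Edge n)) → δ σ σ ≡ 𝟙
δ-refl []      = refl
δ-refl (e ∷ σ) = trans (δ-∷ e σ σ) (δ-refl σ)

δ-≢𝟘 : ∀ {n} (σ τ : List (Edge n)) → δ σ τ ≢ 𝟘 → σ ≡ τ
δ-≢𝟘 σ τ ne with σ ==L τ in eq
... | true  = ==L⇒≡ σ τ (subst T (sym eq) tt)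
... | false = contradiction refl ne

δ-≢ : ∀ {n} {σ τ : List (Edge n)} → σ ≢ τ → δ σ τ ≡ 𝟘
δ-≢ {σ = σ} {τ} σ≢τ with ≡𝟘? (δ σ τ)
... | yes eq = eq
... | no ne  = contradiction (δ-≢𝟘 σ τ ne) σ≢τ

incidenceSum : ∀ {n} → List (Edge n) → List (𝔽₃ × List (Edge n)) → 𝔽₃
incidenceSum σ []             = 𝟘
incidenceSum σ ((s , ρ) ∷ ds) = (δ ρ σ ⊗ s) ⊕ incidenceSum σ ds

mutual
  -- The summand of the fold in incidence, whose conditional is local to Defs and has no name here.
  incidenceStep : ∀ {n} → List (Edge n) → List (Edge n) → 𝔽₃ × List (Edge n) → 𝔽₃ → 𝔽₃
  incidenceStep σ τ = _

  incidence-fold : ∀ {n} (σ τ : List (Edge n)) → incidence σ τ ≡ foldr (incidenceStep σ τ) 𝟘 (deletions τ)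
  incidence-fold σ τ = refl

incidence-sum : ∀ {n} (σ τ : List (Edge n)) → incidence σ τ ≡ incidenceSum σ (deletions τ)
incidence-sum σ τ = trans (incidence-fold σ τ) (fold (deletions τ))
  where
  fold : ∀ ds → foldr (incidenceStep σ τ) 𝟘 ds ≡ incidenceSum σ ds
  fold []             = refl
  fold ((s , ρ) ∷ ds) with ρ ==L σ
  ... | true  = cong (s ⊕_) (fold ds)
  ... | false = fold ds

incidenceSum-zero : ∀ {n} {σ : List (Edge n)} ds → (∀ {s ρ} → (s , ρ) ∈ ds → ρ ≢ σ) →
  incidenceSum σ ds ≡ 𝟘
incidenceSum-zero []             ne = refl
incidenceSum-zero ((s , ρ) ∷ ds) ne =
  cong₂ _⊕_ (cong (_⊗ s) (δ-≢ (ne (here refl)))) (incidenceSum-zero ds (ne ∘ there))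

prepend : ∀ {n} → Edge n → 𝔽₃ × List (Edge n) → 𝔽₃ × List (Edge n)
prepend e p = ⊖ proj₁ p , e ∷ proj₂ p

incidenceSum-prepend : ∀ {n} (e : Edge n) σ ds →
  incidenceSum (e ∷ σ) (map (prepend e) ds) ≡ ⊖ incidenceSum σ ds
incidenceSum-prepend e σ []             = refl
incidenceSum-prepend e σ ((s , ρ) ∷ ds) = trans
  (cong₂ _⊕_ (cong (_⊗ (⊖ s)) (δ-∷ e ρ σ)) (incidenceSum-prepend e σ ds))
  (neg (δ ρ σ) s (incidenceSum σ ds))
  where
  neg : ∀ x s y → (x ⊗ (⊖ s)) ⊕ (⊖ y) ≡ ⊖ ((x ⊗ s) ⊕ y)
  neg = solve-∀ 𝔽₃-ring

deletions-⊆ : ∀ {n} {x : Edge n} τ {s ρ} → (s , ρ) ∈ deletions τ → x ∈ ρ → x ∈ τ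
deletions-⊆ (y ∷ τ) (here refl) x∈ = there x∈
deletions-⊆ (y ∷ τ) (there p∈) x∈ with ∈-map⁻ (prepend y) p∈
deletions-⊆ (y ∷ τ) (there p∈) (here refl) | _ , _ , refl   = here refl
deletions-⊆ (y ∷ τ) (there p∈) (there x∈) | _ , q∈ , refl = there (deletions-⊆ τ q∈ x∈)

-- Both sides use the same sign: `deletions` negates once for every edge before the deleted one, and
-- `bd` once for every earlier `true`. The recursion runs over the first edge of `vs`; uniqueness
-- separates the faces that contain it from those that do not.
bd-incidence : ∀ {n} {vs : List (Edge n)} → Unique vs → ∀ S S′ →
  bd (δ (select vs S′) ∘ select vs) S ≡ incidence (select vs S) (select vs S′)
bd-incidence {vs = []} u [] [] = refl
bd-incidence {vs = e ∷ vs} u (true ∷ S) (true ∷ S′) = begin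
  ⊖ bd (λ S₁ → δ (e ∷ σ′) (e ∷ select vs S₁)) S
    ≡⟨ cong ⊖_ (L-cong bd-linear (λ S₁ → δ-∷ e σ′ (select vs S₁)) S) ⟩
  ⊖ bd (δ σ′ ∘ select vs) S                       ≡⟨ cong ⊖_ (bd-incidence (unique-tail u) S S′) ⟩
  ⊖ incidence σ σ′                                ≡⟨ cong ⊖_ (incidence-sum σ σ′) ⟩
  ⊖ incidenceSum σ (deletions σ′)                 ≡⟨ sym (incidenceSum-prepend e σ (deletions σ′)) ⟩
  incidenceSum (e ∷ σ) (map (prepend e) (deletions σ′))
    ≡⟨ sym (cong (λ u → (u ⊗ 𝟙) ⊕ incidenceSum (e ∷ σ) (map (prepend e) (deletions σ′)))
         (δ-≢ (head∉select u S′ σ ∘ sym))) ⟩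
  incidenceSum (e ∷ σ) (deletions (e ∷ σ′))       ≡⟨ sym (incidence-sum (e ∷ σ) (e ∷ σ′)) ⟩
  incidence (e ∷ σ) (e ∷ σ′) ∎
  where
  open ≡-Reasoning
  σ = select vs S
  σ′ = select vs S′
bd-incidence {vs = e ∷ vs} u (false ∷ S) (true ∷ S′) = begin
  δ (e ∷ σ′) (e ∷ σ) ⊕ bd (λ S₁ → δ (e ∷ σ′) (select vs S₁)) S
    ≡⟨ cong₂ _⊕_ (δ-∷ e σ′ σ) (trans
         (L-cong bd-linear (λ S₁ → δ-≢ (head∉select u S₁ σ′)) S) (L-zero bd-linear S)) ⟩
  δ σ′ σ ⊕ 𝟘
    ≡⟨ cong₂ _⊕_ (⊗-comm 𝟙 (δ σ′ σ)) (sym (incidenceSum-zero (map (prepend e) (deletions σ′)) not-σ)) ⟩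
  incidenceSum σ (deletions (e ∷ σ′))      ≡⟨ sym (incidence-sum σ (e ∷ σ′)) ⟩
  incidence σ (e ∷ σ′) ∎
  where
  open ≡-Reasoning
  σ = select vs S
  σ′ = select vs S′
  not-σ : ∀ {s ρ} → (s , ρ) ∈ map (prepend e) (deletions σ′) → ρ ≢ σ
  not-σ p∈ eq with ∈-map⁻ (prepend e) p∈
  ... | (_ , ρ) , _ , refl = head∉select u S ρ eq
bd-incidence {vs = e ∷ vs} u (true ∷ S) (false ∷ S′) = begin
  ⊖ bd (λ S₁ → δ σ′ (e ∷ select vs S₁)) S
    ≡⟨ cong ⊖_ (trans (L-cong bd-linear (λ S₁ → δ-≢ (head∉select u S′ _ ∘ sym)) S) (L-zero bd-linear S)) ⟩
  𝟘                                      ≡⟨ sym (incidenceSum-zero (deletions σ′) not-σ) ⟩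
  incidenceSum (e ∷ σ) (deletions σ′)    ≡⟨ sym (incidence-sum (e ∷ σ) σ′) ⟩
  incidence (e ∷ σ) σ′ ∎
  where
  open ≡-Reasoning
  σ = select vs S
  σ′ = select vs S′
  not-σ : ∀ {s ρ} → (s , ρ) ∈ deletions σ′ → ρ ≢ e ∷ σ
  not-σ p∈ refl = Unique[x∷xs]⇒x∉xs u (select-⊆ vs S′ (deletions-⊆ σ′ p∈ (here refl)))
bd-incidence {vs = e ∷ vs} u (false ∷ S) (false ∷ S′) =
  trans (cong (_⊕ bd (δ (select vs S′) ∘ select vs) S) (δ-≢ (head∉select u S′ _ ∘ sym)))
    (bd-incidence (unique-tail u) S S′)

Σ𝔽-δ : ∀ {n} {L : List (List (Edge n))} → Unique L → ∀ (c : Fin (length L) → 𝔽₃) i →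
  Σ𝔽 (length L) (λ j → c j ⊗ δ (List.lookup L j) (List.lookup L i)) ≡ c i
Σ𝔽-δ {L = σ ∷ L} (p ∷ u) c fz = trans (cong₂ _⊕_
  (trans (cong (c fz ⊗_) (δ-refl σ)) (⊗-comm (c fz) 𝟙))
  (Σ𝔽-zero (length L) λ j → trans (cong (c (fs j) ⊗_) (δ-≢ (All.lookup p (∈-lookup j) ∘ sym))) (⊗-zeroʳ (c (fs j)))))
  (⊕-identityʳ (c fz))
Σ𝔽-δ {L = σ ∷ L} (p ∷ u) c (fs i) = cong₂ _⊕_
  (trans (cong (c fz ⊗_) (δ-≢ (All.lookup p (∈-lookup i)))) (⊗-zeroʳ (c fz)))
  (Σ𝔽-δ u (c ∘ fs) i)

-- Embedding simplicial chains into the exterior algebra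

module MatchingComplex {n : ℕ} (vs : List (Edge n)) where

  Compat : Fin (length vs) → Fin (length vs) → Set
  Compat i j = Disjoint (List.lookup vs i) (List.lookup vs j)

  open Complex Compat (λ {i} {j} → disjoint-sym {e = List.lookup vs i} {List.lookup vs j})
    (λ p → proj₁ p refl) public

  module _ (u : Unique vs) {A : Fin (length vs) → Set} (full : ∀ i → A i) where

    face : ∀ s (j : Fin (length (Faces vs s))) → Vec Bool (length vs)
    face s j = proj₁ (∈-Faces⁻ vs s (∈-lookup {xs = Faces vs s} j))

    select-face : ∀ s j → List.lookup (Faces vs s) j ≡ select vs (face s j)
    select-face s j = proj₁ (proj₂ (∈-Faces⁻ vs s (∈-lookup {xs = Faces vs s} j)))

    ∈-Faces⇒Face : ∀ {s S} → select vs S ∈ Faces vs s → Face A s S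
    ∈-Faces⇒Face {s} {S} S∈ with ∈-Faces⁻ vs s S∈
    ... | S′ , eq , size , cl with select-injective u S S′ eq
    ...   | refl = record { size = size ; allowed = λ i _ → full i ; clique = cl }

    Face⇒∈-Faces : ∀ {s S} → Face A s S → select vs S ∈ Faces vs s
    Face⇒∈-Faces {s} {S} f = ∈-Faces⁺ vs s S (Face.size f) (Face.clique f)

    _∈?_ : ∀ (σ : List (Edge n)) F → Dec (σ ∈ F)
    _∈?_ = DecMembership._∈?_ (List-≡-dec (×-≡-dec Fin._≟_ Fin._≟_))

    basis : ∀ s → Fin (length (Faces vs s)) → Λ (length vs)
    basis s j S = δ (List.lookup (Faces vs s) j) (select vs S)

    embed : ∀ s → Chain vs s → Λ (length vs)
    embed s c = combination (length (Faces vs s)) c (basis s)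

    embed-face : ∀ s (c : Chain vs s) j {S} → select vs S ≡ List.lookup (Faces vs s) j → embed s c S ≡ c j
    embed-face s c j eq = trans
      (Σ𝔽-cong (length (Faces vs s)) λ i → cong (λ σ → c i ⊗ δ (List.lookup (Faces vs s) i) σ) eq)
      (Σ𝔽-δ (Faces-unique s u) c j)

    embed-nonface : ∀ s (c : Chain vs s) {S} → select vs S ∉ Faces vs s → embed s c S ≡ 𝟘
    embed-nonface s c {S} S∉ = Σ𝔽-zero (length (Faces vs s)) λ j → trans
      (cong (c j ⊗_) (δ-≢ λ eq → S∉ (subst (_∈ Faces vs s) eq (∈-lookup {xs = Faces vs s} j)))) (⊗-zeroʳ (c j))

    embed-In : ∀ s (c : Chain vs s) → In A s (embed s c)
    embed-In s c S ne with select vs S ∈? Faces vs s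
    ... | yes S∈ = ∈-Faces⇒Face S∈
    ... | no S∉  = contradiction (embed-nonface s c S∉) ne

    bd-basis : ∀ s (j : Fin (length (Faces vs s))) S →
      bd (basis s j) S ≡ incidence (select vs S) (List.lookup (Faces vs s) j)
    bd-basis s j S = begin
      bd (basis s j) S                                     ≡⟨ cong (λ τ → bd (δ τ ∘ select vs) S) (select-face s j) ⟩
      bd (δ (select vs (face s j)) ∘ select vs) S          ≡⟨ bd-incidence u S (face s j) ⟩
      incidence (select vs S) (select vs (face s j))       ≡⟨ cong (incidence (select vs S)) (sym (select-face s j)) ⟩
      incidence (select vs S) (List.lookup (Faces vs s) j) ∎
      where open ≡-Reasoning

    embed-∂ : ∀ s (c : Chain vs (suc s)) S → embed s (∂ vs s c) S ≡ bd (embed (suc s) c) S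
    embed-∂ s c S with select vs S ∈? Faces vs s
    ... | yes S∈ = trans (embed-face s (∂ vs s c) (index S∈) (lookup-index S∈)) (sym (begin
      bd (embed (suc s) c) S
        ≡⟨ L-combination bd-linear N c (basis (suc s)) S ⟩
      Σ𝔽 N (λ j → c j ⊗ bd (basis (suc s) j) S)
        ≡⟨ Σ𝔽-cong N (λ j → trans (cong (c j ⊗_) (bd-basis (suc s) j S)) (⊗-comm (c j) _)) ⟩
      Σ𝔽 N (λ j → incidence (select vs S) (List.lookup (Faces vs (suc s)) j) ⊗ c j)
        ≡⟨ Σ𝔽-cong N (λ j → cong (λ σ → incidence σ (List.lookup (Faces vs (suc s)) j) ⊗ c j) (lookup-index S∈)) ⟩
      ∂ vs s c (index S∈) ∎))
      where
      open ≡-Reasoning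
      N = length (Faces vs (suc s))
    ... | no S∉ = trans (embed-nonface s (∂ vs s c) S∉) (sym vanish)
      where
      vanish : bd (embed (suc s) c) S ≡ 𝟘
      vanish with ≡𝟘? (bd (embed (suc s) c) S)
      ... | yes eq = eq
      ... | no ne  = contradiction (Face⇒∈-Faces (In-bd (embed-In (suc s) c) S ne)) S∉

    embed-cong : ∀ s {c d : Chain vs s} → (∀ j → c j ≡ d j) → ∀ S → embed s c S ≡ embed s d S
    embed-cong s eq S = Σ𝔽-cong (length (Faces vs s)) λ j → cong (_⊗ basis s j S) (eq j)

    embed-linComb : ∀ s h a (z : Fin h → Chain vs s) S →
      embed s (linComb h a z) S ≡ combination h a (embed s ∘ z) S
    embed-linComb s h a z S = begin
      Σ𝔽 N (λ j → Σ𝔽 h (λ i → a i ⊗ z i j) ⊗ basis s j S)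
        ≡⟨ Σ𝔽-cong N (λ j → trans (⊗-comm _ (basis s j S)) (sym (Σ𝔽-⊗ h (basis s j S) _))) ⟩
      Σ𝔽 N (λ j → Σ𝔽 h (λ i → basis s j S ⊗ (a i ⊗ z i j)))
        ≡⟨ Σ𝔽-swap N h _ ⟩
      Σ𝔽 h (λ i → Σ𝔽 N (λ j → basis s j S ⊗ (a i ⊗ z i j)))
        ≡⟨ Σ𝔽-cong h (λ i → trans (Σ𝔽-cong N (λ j → rotate (basis s j S) (a i) (z i j))) (Σ𝔽-⊗ N (a i) _)) ⟩
      Σ𝔽 h (λ i → a i ⊗ embed s (z i) S) ∎
      where
      open ≡-Reasoning
      N = length (Faces vs s)
      rotate : ∀ b a z → b ⊗ (a ⊗ z) ≡ a ⊗ (z ⊗ b)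
      rotate = solve-∀ 𝔽₃-ring

    embed-cycle : ∀ s (c : Chain vs s) → IsCycle vs s c → Cycle A s (embed s c)
    embed-cycle zero    c _  = embed-In 0 c , bd-size-0 (embed-In 0 c)
    embed-cycle (suc s) c ∂c = embed-In (suc s) c , λ S → trans (sym (embed-∂ s c S))
      (trans (embed-cong s ∂c S) (Σ𝔽-zero (length (Faces vs s)) λ _ → refl))

    -- The filling is read back as coefficients on the listed faces. Nothing is lost, because it is
    -- supported on faces.
    embed-boundary : ∀ s (c : Chain vs s) → Boundary A s (embed s c) → IsBoundary vs s c
    embed-boundary s c (y , y∈ , ∂y) = ŷ , λ j → begin
      ∂ vs s ŷ j                      ≡⟨ sym (embed-face s (∂ vs s ŷ) j (sym (select-face s j))) ⟩
      embed s (∂ vs s ŷ) (face s j)   ≡⟨ embed-∂ s ŷ (face s j) ⟩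
      bd (embed (suc s) ŷ) (face s j) ≡⟨ L-cong bd-linear embed-ŷ (face s j) ⟩
      bd y (face s j)                 ≡⟨ ∂y (face s j) ⟩
      embed s c (face s j)            ≡⟨ embed-face s c j (sym (select-face s j)) ⟩
      c j                             ∎
      where
      open ≡-Reasoning
      ŷ : Chain vs (suc s)
      ŷ = y ∘ face (suc s)
      embed-ŷ : ∀ S → embed (suc s) ŷ S ≡ y S
      embed-ŷ S with select vs S ∈? Faces vs (suc s)
      ... | yes S∈ = trans (embed-face (suc s) ŷ (index S∈) (lookup-index S∈)) (cong y
        (select-injective u _ S (trans (sym (select-face (suc s) (index S∈))) (sym (lookup-index S∈)))))
      ... | no S∉ with ≡𝟘? (y S)
      ...   | yes eq = trans (embed-nonface (suc s) ŷ S∉) (sym eq)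
      ...   | no ne  = contradiction (Face⇒∈-Faces (y∈ S ne)) S∉

    -- The coordinates of the classes `z` with respect to the spanning cycles form an h × N matrix.
    -- A relation among its rows makes the same combination of `z` a boundary, hence is trivial, and
    -- `independent⇒≤` applies. Decidability of `h ≤ N` removes the double negation.
    homDim-≤ : ∀ {s h N} → HomDim vs s h → DimBound A s N → h ≤ N
    homDim-≤ {s} {h} {N} (z , z∈ , indep , _) d = decidable-stable (h ≤? N) λ h≰N →
      d λ (w , _ , gen) →
        let coords = λ i → gen (embed s (z i)) (embed-cycle s (z i) (z∈ i)) in
        h≰N (independent⇒≤ h N (proj₁ ∘ coords) λ a aM≡𝟘 → indep a (embed-boundary s (linComb h a z)
          (respS (Boundary-subspace A s) (λ S → begin
            combination h a (λ i → embed s (z i) ⊝C combination N (proj₁ (coords i)) w) S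
              ≡⟨ residue a (λ i → embed s (z i) S) (proj₁ ∘ coords) (λ j → w j S) ⟩
            combination h a (embed s ∘ z) S ⊕ (⊖ combination N (λ j → combination h a (proj₁ ∘ coords) j) w S)
              ≡⟨ cong (λ v → combination h a (embed s ∘ z) S ⊕ (⊖ v))
                   (Σ𝔽-zero N λ j → cong (_⊗ w j S) (aM≡𝟘 j)) ⟩
            combination h a (embed s ∘ z) S ⊕ 𝟘
              ≡⟨ ⊕-identityʳ _ ⟩
            combination h a (embed s ∘ z) S
              ≡⟨ sym (embed-linComb s h a z S) ⟩
            embed s (linComb h a z) S ∎)
            (combinationS (Boundary-subspace A s) h a (proj₂ ∘ coords)))))
      where
      open ≡-Reasoning
      residue : ∀ a (x : Fin h → 𝔽₃) (M : Fin h → Fin N → 𝔽₃) (w : Fin N → 𝔽₃) →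
        Σ𝔽 h (λ i → a i ⊗ (x i ⊕ (⊖ Σ𝔽 N (λ j → M i j ⊗ w j)))) ≡
        Σ𝔽 h (λ i → a i ⊗ x i) ⊕ (⊖ Σ𝔽 N (λ j → Σ𝔽 h (λ i → a i ⊗ M i j) ⊗ w j))
      residue a x M w = begin
        Σ𝔽 h (λ i → a i ⊗ (x i ⊕ (⊖ Σ𝔽 N (λ j → M i j ⊗ w j))))
          ≡⟨ Σ𝔽-cong h (λ i → expand (a i) (x i) (Σ𝔽 N (λ j → M i j ⊗ w j))) ⟩
        Σ𝔽 h (λ i → (a i ⊗ x i) ⊕ (𝟚 ⊗ (a i ⊗ Σ𝔽 N (λ j → M i j ⊗ w j))))
          ≡⟨ Σ𝔽-⊕ h _ _ ⟩
        Σ𝔽 h (λ i → a i ⊗ x i) ⊕ Σ𝔽 h (λ i → 𝟚 ⊗ (a i ⊗ Σ𝔽 N (λ j → M i j ⊗ w j)))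
          ≡⟨ cong (Σ𝔽 h (λ i → a i ⊗ x i) ⊕_) (trans (Σ𝔽-⊗ h 𝟚 _) (trans (⊖-⊗ _) (cong ⊖_ exchange))) ⟩
        _ ∎
        where
        expand : ∀ a x y → a ⊗ (x ⊕ (⊖ y)) ≡ (a ⊗ x) ⊕ (𝟚 ⊗ (a ⊗ y))
        expand a x y = trans (distrib a x y) (cong ((a ⊗ x) ⊕_) (sym (⊖-⊗ (a ⊗ y))))
          where
          distrib : ∀ a x y → a ⊗ (x ⊕ (⊖ y)) ≡ (a ⊗ x) ⊕ (⊖ (a ⊗ y))
          distrib = solve-∀ 𝔽₃-ring
        exchange : Σ𝔽 h (λ i → a i ⊗ Σ𝔽 N (λ j → M i j ⊗ w j)) ≡
          Σ𝔽 N (λ j → Σ𝔽 h (λ i → a i ⊗ M i j) ⊗ w j)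
        exchange = begin
          Σ𝔽 h (λ i → a i ⊗ Σ𝔽 N (λ j → M i j ⊗ w j))
            ≡⟨ Σ𝔽-cong h (λ i → sym (Σ𝔽-⊗ N (a i) _)) ⟩
          Σ𝔽 h (λ i → Σ𝔽 N (λ j → a i ⊗ (M i j ⊗ w j)))
            ≡⟨ Σ𝔽-swap h N _ ⟩
          Σ𝔽 N (λ j → Σ𝔽 h (λ i → a i ⊗ (M i j ⊗ w j)))
            ≡⟨ Σ𝔽-cong N (λ j → trans (Σ𝔽-cong h (λ i → rotate (a i) (M i j) (w j)))
                 (trans (Σ𝔽-⊗ h (w j) _) (⊗-comm (w j) _))) ⟩
          Σ𝔽 N (λ j → Σ𝔽 h (λ i → a i ⊗ M i j) ⊗ w j) ∎
          where
          rotate : ∀ a m w → a ⊗ (m ⊗ w) ≡ w ⊗ (a ⊗ m)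
          rotate = solve-∀ 𝔽₃-ring

-- Matching complexes of graphs

remove : ∀ {A : Set} {a : A} {l} → Unique l → a ∈ l → Σ (List A) λ l′ → Unique l′ ×
  length l ≡ suc (length l′) × (∀ {v} → v ∈ l → v ≢ a → v ∈ l′) × (∀ {v} → v ∈ l′ → v ∈ l × v ≢ a)
remove {l = a ∷ l} u (here refl) = l , unique-tail u , refl ,
  (λ { (here eq) v≢a → contradiction eq v≢a ; (there v∈) _ → v∈ }) ,
  λ v∈ → there v∈ , λ { refl → Unique[x∷xs]⇒x∉xs u v∈ }
remove {l = x ∷ l} (p ∷ u) (there a∈) with remove u a∈
... | l′ , u′ , len , to , from = x ∷ l′ , All.tabulate (λ v∈ → All.lookup p (proj₁ (from v∈))) ∷ u′ ,
  cong suc len ,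
  (λ { (here eq) _ → here eq ; (there v∈) v≢a → there (to v∈ v≢a) }) ,
  λ { (here refl) → here refl , All.lookup p a∈ ; (there v∈) → there (proj₁ (from v∈)) , proj₂ (from v∈) }

-- Each edge may be recorded in either orientation, since only `Adj` enters the complex. A star can
-- thus be written from its centre alone.
Graph : ℕ → Set₁
Graph n = Fin n → Fin n → Set

Adj : ∀ {n} → Graph n → Graph n
Adj G u v = G u v ⊎ G v u

Outside : ∀ {n} → Fin n → Fin n → Fin n → Fin n → Set
Outside x a u v = (u ≢ x × u ≢ a) × (v ≢ x × v ≢ a)

Off : ∀ {n} → Graph n → Fin n → Fin n → Graph n
Off G x a u v = G u v × Outside x a u v

Star : ∀ {n} → Fin n → List (Fin n) → Graph n
Star x l u v = u ≡ x × v ∈ l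

_∪_ : ∀ {n} → Graph n → Graph n → Graph n
(G ∪ H) u v = G u v ⊎ H u v

Complete : ∀ {n} → List (Fin n) → Graph n
Complete l u v = u ∈ l × v ∈ l × u ≢ v

CompleteMinus : ∀ {n} → Fin n → Fin n → List (Fin n) → Graph n
CompleteMinus x y l = Star x l ∪ (Star y l ∪ Complete l)

module GraphComplex {n : ℕ} (vs : List (Edge n)) (uniq : Unique vs)
  (ordered : ∀ i → proj₁ (List.lookup vs i) Fin.< proj₂ (List.lookup vs i)) where

  open MatchingComplex vs

  Edges : Graph n → Fin (length vs) → Set
  Edges G i = Adj G (proj₁ (List.lookup vs i)) (proj₂ (List.lookup vs i))

  Joins : Fin (length vs) → Fin n → Fin n → Set
  Joins i u v = List.lookup vs i ≡ (u , v) ⊎ List.lookup vs i ≡ (v , u)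

  -- Every pair of the graph is stored in `vs`; in particular there are no loops. Carried as a
  -- hypothesis of `Bound`, it lets the same recurrences run over the edges of the complete graph
  -- and over those without 12.
  Covered : Graph n → Set
  Covered G = ∀ {u v} → G u v → Σ (Fin (length vs)) λ i → Joins i u v

  Bound : Graph n → ℕ → ℕ → Set
  Bound G s N = Covered G → DimBound (Edges G) s N

  joins-unique : ∀ {i j u v} → Joins i u v → Joins j u v → i ≡ j
  joins-unique (inj₁ p) (inj₁ q) = lookup-injective uniq _ _ (trans p (sym q))
  joins-unique (inj₂ p) (inj₂ q) = lookup-injective uniq _ _ (trans p (sym q))
  joins-unique {i} {j} (inj₁ p) (inj₂ q) = ⊥-elim (Fin.<-asym
    (subst (λ e → proj₁ e Fin.< proj₂ e) p (ordered i)) (subst (λ e → proj₁ e Fin.< proj₂ e) q (ordered j)))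
  joins-unique {i} {j} (inj₂ p) (inj₁ q) = ⊥-elim (Fin.<-asym
    (subst (λ e → proj₁ e Fin.< proj₂ e) p (ordered i)) (subst (λ e → proj₁ e Fin.< proj₂ e) q (ordered j)))

  joins-edge : ∀ {G i u v} → Joins i u v → Adj G u v → Edges G i
  joins-edge {G} (inj₁ p) g = subst (λ e → Adj G (proj₁ e) (proj₂ e)) (sym p) g
  joins-edge {G} (inj₂ p) g = subst (λ e → Adj G (proj₁ e) (proj₂ e)) (sym p) (swap g)

  edge-joins : ∀ {G i u v} → Joins i u v → Edges G i → Adj G u v
  edge-joins {G} (inj₁ p) g = subst (λ e → Adj G (proj₁ e) (proj₂ e)) p g
  edge-joins {G} (inj₂ p) g = swap (subst (λ e → Adj G (proj₁ e) (proj₂ e)) p g)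

  disjoint⇒outside : ∀ {i x a} → Joins i x a → ∀ j → Compat i j →
    Outside x a (proj₁ (List.lookup vs j)) (proj₂ (List.lookup vs j))
  disjoint⇒outside {i} (inj₁ p) j d rewrite p with d
  ... | q , r , s , t = (q ∘ sym , s ∘ sym) , (r ∘ sym , t ∘ sym)
  disjoint⇒outside {i} (inj₂ p) j d rewrite p with d
  ... | q , r , s , t = (s ∘ sym , q ∘ sym) , (t ∘ sym , r ∘ sym)

  outside⇒disjoint : ∀ {i x a} → Joins i x a → ∀ j →
    Outside x a (proj₁ (List.lookup vs j)) (proj₂ (List.lookup vs j)) → Compat i j
  outside⇒disjoint {i} (inj₁ p) j ((q , r) , (s , t)) rewrite p = q ∘ sym , s ∘ sym , r ∘ sym , t ∘ sym
  outside⇒disjoint {i} (inj₂ p) j ((q , r) , (s , t)) rewrite p = r ∘ sym , t ∘ sym , q ∘ sym , s ∘ sym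

  outside-swap : ∀ {x a u v : Fin n} → Outside x a u v → Outside x a v u
  outside-swap (p , q) = q , p

  bound-cong : ∀ {G H s N} → (∀ {u v} → G u v → Adj H u v) → (∀ {u v} → H u v → Adj G u v) →
    Bound G s N → Bound H s N
  bound-cong G⊆H H⊆G bound cov = dimBound-≅ (λ _ → [ G⊆H , swap ∘ G⊆H ]) (λ _ → [ H⊆G , swap ∘ H⊆G ])
    (bound λ g → [ cov , (λ h → let i , j = cov h in i , swap j) ] (G⊆H g))

  bound-≤ : ∀ {G s M N} → M ≤ N → Bound G s M → Bound G s N
  bound-≤ M≤N bound cov = dimBound-≤ M≤N (bound cov)

  bound-empty : ∀ {G} s → (∀ {u v} → ¬ G u v) → Bound G (suc s) 0
  bound-empty s empty _ = dimBound-empty s λ _ → [ empty , empty ]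

  bound-size-0 : ∀ {G} → Bound G 0 1
  bound-size-0 _ = dimBound-size-0 _

  bound-nonempty : ∀ {G x a} → G x a → Bound G 0 0
  bound-nonempty {G} g cov with cov g
  ... | i , j = dimBound-nonempty i (joins-edge {G} j (inj₁ g))

  bound-cone : ∀ {G} s x a → G x a → (∀ {u v} → G u v → (u ≡ x × v ≡ a) ⊎ Outside x a u v) → Bound G s 0
  bound-cone {G} s x a g cone cov with cov g
  ... | i , xa = dimBound-cone s i (joins-edge {G} xa (inj₁ g)) λ j Gj j≢i →
    outside⇒disjoint xa j (outside j j≢i Gj)
    where
    outside : ∀ j → j ≢ i → Edges G j →
      Outside x a (proj₁ (List.lookup vs j)) (proj₂ (List.lookup vs j))
    outside j j≢i (inj₁ h) with cone h
    ... | inj₁ (refl , refl) = contradiction (joins-unique (inj₁ refl) xa) j≢i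
    ... | inj₂ o             = o
    outside j j≢i (inj₂ h) with cone h
    ... | inj₁ (refl , refl) = contradiction (joins-unique (inj₂ refl) xa) j≢i
    ... | inj₂ o             = outside-swap o

  -- Double negation lets us assume that either the edge xa is already in H or it is not.
  bound-edge : ∀ {H s M N} x a → Bound H (suc s) M → Bound (Off H x a) s N →
    Bound (Star x (a ∷ []) ∪ H) (suc s) (N + M)
  bound-edge {H} {s} {M} {N} x a bH bOff cov with cov (inj₁ (refl , here refl))
  ... | i , xa = λ k → ¬¬-excluded-middle λ
    { (yes h) → dimBound-≅ (λ _ → [ inj₁ ∘ inj₂ , inj₂ ∘ inj₂ ])
        (λ _ → [ absorb h , swap ∘ absorb h ]) (dimBound-≤ (m≤n+m M N) (bH (cov ∘ inj₂))) k
    ; (no ¬h) → dimBound-delete i (joins-edge {G} xa (inj₁ (inj₁ (refl , here refl))))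
        (dimBound-≅ (λ j h → [ inj₁ ∘ inj₂ , inj₂ ∘ inj₂ ] h , λ { refl → ¬h (edge-joins {H} xa h) })
          to-H (bH (cov ∘ inj₂)))
        (dimBound-≅ to-link
          (λ j (g , d) → [ (λ g → inj₁ (from-link g (disjoint⇒outside xa j d))) ,
                           (λ g → inj₂ (from-link g (outside-swap (disjoint⇒outside xa j d)))) ] g)
          (bOff (cov ∘ inj₂ ∘ proj₁))) k }
    where
    G : Graph n
    G = Star x (a ∷ []) ∪ H
    absorb : Adj H x a → ∀ {u v} → G u v → Adj H u v
    absorb h (inj₁ (refl , here refl)) = h
    absorb h (inj₂ h′)                 = inj₁ h′
    to-H : ∀ j → Delete i (Edges G) j → Edges H j
    to-H j (inj₁ (inj₁ (refl , here refl)) , j≢i) = contradiction (joins-unique (inj₁ refl) xa) j≢i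
    to-H j (inj₁ (inj₂ h) , _)                    = inj₁ h
    to-H j (inj₂ (inj₁ (refl , here refl)) , j≢i) = contradiction (joins-unique (inj₂ refl) xa) j≢i
    to-H j (inj₂ (inj₂ h) , _)                    = inj₂ h
    to-link : ∀ j → Edges (Off H x a) j → Link i (Edges G) j
    to-link j (inj₁ (h , o)) = inj₁ (inj₂ h) , outside⇒disjoint xa j o
    to-link j (inj₂ (h , o)) = inj₂ (inj₂ h) , outside⇒disjoint xa j (outside-swap o)
    from-link : ∀ {u v} → G u v → Outside x a u v → Off H x a u v
    from-link (inj₁ (u≡x , _)) ((u≢x , _) , _) = contradiction u≡x u≢x
    from-link (inj₂ h)         o               = h , o

  -- The edges of the star all meet in `x`, so those not yet deleted never occur in a link: each
  -- deletion has a link taken from `H` alone and costs `N`.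
  bound-star : ∀ {H s M N} x l → Bound H (suc s) M → (∀ {a} → a ∈ l → Bound (Off H x a) s N) →
    Bound (Star x l ∪ H) (suc s) (length l * N + M)
  bound-star {H} x [] bH bOff = bound-cong (λ h → inj₁ (inj₂ h)) (λ { (inj₁ (_ , ())) ; (inj₂ h) → inj₁ h }) bH
  bound-star {H} {s} {M} {N} x (a ∷ l) bH bOff =
    subst (Bound _ (suc s)) (sym (+-assoc N (length l * N) M)) (bound-cong to from
      (bound-edge x a (bound-star x l bH (bOff ∘ there))
        (bound-cong (λ (h , o) → inj₁ (inj₂ h , o)) off (bOff (here refl)))))
    where
    off : ∀ {u v} → Off (Star x l ∪ H) x a u v → Adj (Off H x a) u v
    off (inj₁ (u≡x , _) , (u≢x , _) , _) = contradiction u≡x u≢x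
    off (inj₂ h , o)                     = inj₁ (h , o)
    to : ∀ {u v} → (Star x (a ∷ []) ∪ (Star x l ∪ H)) u v → Adj (Star x (a ∷ l) ∪ H) u v
    to (inj₁ (u≡x , here eq))   = inj₁ (inj₁ (u≡x , here eq))
    to (inj₂ (inj₁ (u≡x , v∈))) = inj₁ (inj₁ (u≡x , there v∈))
    to (inj₂ (inj₂ h))          = inj₁ (inj₂ h)
    from : ∀ {u v} → (Star x (a ∷ l) ∪ H) u v → Adj (Star x (a ∷ []) ∪ (Star x l ∪ H)) u v
    from (inj₁ (u≡x , here eq))  = inj₁ (inj₁ (u≡x , here eq))
    from (inj₁ (u≡x , there v∈)) = inj₁ (inj₂ (inj₁ (u≡x , v∈)))
    from (inj₂ h)                = inj₁ (inj₂ (inj₂ h))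

  -- Quantified over all vertex lists because links live on sublists while `vs` stays fixed. In
  -- `αBound` the first argument counts the vertices other than the non-adjacent `x` and `y`, so it
  -- is n - 2.
  βBound : ℕ → ℕ → ℕ → Set
  βBound p s N = ∀ l → Unique l → length l ≡ p → Bound (Complete l) s N

  αBound : ℕ → ℕ → ℕ → Set
  αBound t s N = ∀ x y l → Unique (x ∷ y ∷ l) → length l ≡ t → Bound (CompleteMinus x y l) s N

∉⇒≢ : ∀ {A : Set} {x u : A} {l} → x ∉ l → u ∈ l → u ≢ x
∉⇒≢ x∉ u∈ refl = x∉ u∈

unique-head : ∀ {A : Set} {x y : A} {l} → Unique (x ∷ y ∷ l) → x ≢ y
unique-head (p ∷ _) = All.lookup p (here refl)

unique-skip : ∀ {A : Set} {x y : A} {l} → Unique (x ∷ y ∷ l) → Unique (x ∷ l)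
unique-skip ((_ ∷ p) ∷ (_ ∷ u)) = p ∷ u

unique-replace : ∀ {A : Set} {x : A} {l l′} → Unique (x ∷ l) → Unique l′ → (∀ {v} → v ∈ l′ → v ∈ l) →
  Unique (x ∷ l′)
unique-replace (p ∷ _) u′ ⊆l = All.tabulate (All.lookup p ∘ ⊆l) ∷ u′

-- A computed deletion bound for M₇ ∖ 12

-- Breadth-first layers around `S` in the disjointness relation, later layers in front. An edge
-- followed by one disjoint from it has a non-empty link, so deleting it costs nothing in size 1.
grow : ∀ {n} → ℕ → List (Edge n) → List (Edge n) → List (Edge n)
grow zero    S R = R ++ S
grow (suc k) S R = grow k (filterᵇ touches R ++ S) (filterᵇ (not ∘ touches) R)
  where
  touches : _ → Bool
  touches e = any (disjointE e) S

-- Puts each edge in front of some edge disjoint from it where two rounds of search find one; any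
-- rearrangement would be sound.
reorder : ∀ {n} → List (Edge n) → List (Edge n)
reorder []      = []
reorder (e ∷ L) = grow 2 (e ∷ []) L

T-not : ∀ {b} → b ≡ false → T (not b)
T-not refl = tt

∈-grow⁺ : ∀ {n} k (S R : List (Edge n)) {e} → e ∈ S ⊎ e ∈ R → e ∈ grow k S R
∈-grow⁺ zero    S R (inj₁ e∈S) = ∈-++⁺ʳ R e∈S
∈-grow⁺ zero    S R (inj₂ e∈R) = ∈-++⁺ˡ e∈R
∈-grow⁺ (suc k) S R (inj₁ e∈S) = ∈-grow⁺ k _ _ (inj₁ (∈-++⁺ʳ (filterᵇ _ R) e∈S))
∈-grow⁺ (suc k) S R {e} (inj₂ e∈R) with any (disjointE e) S in eq
... | true  = ∈-grow⁺ k _ _ (inj₁ (∈-++⁺ˡ (∈-filter⁺ (T? ∘ (λ f → any (disjointE f) S)) e∈R (subst T (sym eq) tt))))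
... | false = ∈-grow⁺ k _ _ (inj₂ (∈-filter⁺ (T? ∘ (λ f → not (any (disjointE f) S))) e∈R (T-not eq)))

∈-grow⁻ : ∀ {n} k (S R : List (Edge n)) {e} → e ∈ grow k S R → e ∈ S ⊎ e ∈ R
∈-grow⁻ zero    S R e∈ = swap (∈-++⁻ R e∈)
∈-grow⁻ (suc k) S R e∈ with ∈-grow⁻ k _ _ e∈
... | inj₂ e∈R = inj₂ (proj₁ (∈-filter⁻ (T? ∘ (λ f → not (any (disjointE f) S))) {xs = R} e∈R))
... | inj₁ e∈′ with ∈-++⁻ (filterᵇ (λ f → any (disjointE f) S) R) e∈′
...   | inj₁ e∈R = inj₂ (proj₁ (∈-filter⁻ (T? ∘ (λ f → any (disjointE f) S)) {xs = R} e∈R))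
...   | inj₂ e∈S = inj₁ e∈S

∈-reorder⁺ : ∀ {n} (L : List (Edge n)) {e} → e ∈ L → e ∈ reorder L
∈-reorder⁺ (f ∷ L) (here eq)  = ∈-grow⁺ 2 (f ∷ []) L (inj₁ (here eq))
∈-reorder⁺ (f ∷ L) (there e∈) = ∈-grow⁺ 2 (f ∷ []) L (inj₂ e∈)

∈-reorder⁻ : ∀ {n} (L : List (Edge n)) {e} → e ∈ reorder L → e ∈ L
∈-reorder⁻ (f ∷ L) e∈ with ∈-grow⁻ 2 (f ∷ []) L e∈
... | inj₁ (here eq) = here eq
... | inj₂ e∈L       = there e∈L

-- The bound obtained by deleting the edges of a list in order until the first one is a cone point.
deletionCost : ∀ {n} → ℕ → List (Edge n) → ℕ
deletionCost zero    []      = 1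
deletionCost zero    (e ∷ L) = 0
deletionCost (suc s) []      = 0
deletionCost (suc s) (e ∷ L) = if all (disjointE e) L then 0
  else deletionCost s (reorder (filterᵇ (disjointE e) L)) + deletionCost (suc s) L

ListGraph : ∀ {k n} → (Fin k → Fin n) → List (Edge k) → Graph n
ListGraph {k} v L u w = Σ (Edge k) λ e → e ∈ L × u ≡ v (proj₁ e) × w ≡ v (proj₂ e)

-- In an order for which only one deletion contributes to the one-dimensional homology; found by a
-- computer search.
K₇-minus-edge : List (Edge 7)
K₇-minus-edge =
  (# 0 , # 2) ∷ (# 0 , # 3) ∷ (# 1 , # 4) ∷ (# 2 , # 5) ∷ (# 4 , # 5) ∷ (# 4 , # 6) ∷ (# 2 , # 3) ∷
  (# 1 , # 6) ∷ (# 3 , # 5) ∷ (# 0 , # 6) ∷ (# 1 , # 5) ∷ (# 0 , # 4) ∷ (# 1 , # 2) ∷ (# 0 , # 5) ∷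
  (# 1 , # 3) ∷ (# 2 , # 6) ∷ (# 3 , # 4) ∷ (# 2 , # 4) ∷ (# 3 , # 6) ∷ (# 5 , # 6) ∷ []

_∈?_ : ∀ (e : Edge 7) L → Dec (e ∈ L)
_∈?_ = DecMembership._∈?_ (×-≡-dec Fin._≟_ Fin._≟_)

K₇-edge-0 : ∀ k → (fz , fs (fs k)) ∈ K₇-minus-edge
K₇-edge-0 = toWitness {a? = Fin.all? λ k → (fz , fs (fs k)) ∈? K₇-minus-edge} tt

K₇-edge-1 : ∀ k → (fs fz , fs (fs k)) ∈ K₇-minus-edge
K₇-edge-1 = toWitness {a? = Fin.all? λ k → (fs fz , fs (fs k)) ∈? K₇-minus-edge} tt

K₇-edge : ∀ j k → j ≡ k ⊎ (fs (fs j) , fs (fs k)) ∈ K₇-minus-edge ⊎ (fs (fs k) , fs (fs j)) ∈ K₇-minus-edge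
K₇-edge = toWitness {a? = Fin.all? λ j → Fin.all? λ k → (j Fin.≟ k) ⊎-dec
  ((fs (fs j) , fs (fs k)) ∈? K₇-minus-edge) ⊎-dec ((fs (fs k) , fs (fs j)) ∈? K₇-minus-edge)} tt

K₇-increasing : All (λ e → proj₁ e Fin.< proj₂ e × 2 ≤ Fin.toℕ (proj₂ e)) K₇-minus-edge
K₇-increasing = toWitness {a? = All.all? (λ e → (proj₁ e Fin.<? proj₂ e) ×-dec (2 ≤? Fin.toℕ (proj₂ e)))
  K₇-minus-edge} tt

-- Opaque because its normal forms at the arguments needed below are enormous.
opaque
  crudeBound : ℕ → ℕ → ℕ
  crudeBound zero    p             = 1
  crudeBound (suc s) zero          = 0
  crudeBound (suc s) (suc zero)    = 0
  crudeBound (suc s) (suc (suc p)) = suc p * crudeBound s p + crudeBound (suc s) (suc p)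

-- Recurrences for complete graphs, with and without one edge

module _ {n : ℕ} (vs : List (Edge n)) (uniq : Unique vs)
  (ordered : ∀ i → proj₁ (List.lookup vs i) Fin.< proj₂ (List.lookup vs i)) where

  open GraphComplex vs uniq ordered

  complete-off : ∀ {l l′ : List (Fin n)} {x a} → x ∉ l → a ∉ l → (∀ {v} → v ∈ l′ → v ∈ l) →
    ∀ {u v} → Complete l′ u v → Outside x a u v
  complete-off x∉ a∉ ⊆l (u∈ , v∈ , _) =
    (∉⇒≢ x∉ (⊆l u∈) , ∉⇒≢ a∉ (⊆l u∈)) , (∉⇒≢ x∉ (⊆l v∈) , ∉⇒≢ a∉ (⊆l v∈))

  β-step : ∀ {p s M N} → βBound p s N → αBound p (suc s) M → βBound (2 + p) (suc s) (N + M)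
  β-step β α []          u ()
  β-step β α (x ∷ [])    u ()
  β-step β α (x ∷ y ∷ l) u eq = bound-cong to from
    (bound-edge x y (α x y l u len) (bound-cong (λ c → inj₁ (inj₂ (inj₂ c) ,
      complete-off x∉ y∉ id c)) off (β l (unique-tail (unique-tail u)) len)))
    where
    len = suc-injective (suc-injective eq)
    x∉ : x ∉ l
    x∉ = Unique[x∷xs]⇒x∉xs u ∘ there
    y∉ : y ∉ l
    y∉ = Unique[x∷xs]⇒x∉xs (unique-tail u)
    off : ∀ {u v} → Off (CompleteMinus x y l) x y u v → Adj (Complete l) u v
    off (inj₁ (u≡x , _) , (u≢x , _) , _)        = contradiction u≡x u≢x
    off (inj₂ (inj₁ (u≡y , _)) , (_ , u≢y) , _) = contradiction u≡y u≢y
    off (inj₂ (inj₂ c) , _)                     = inj₁ c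
    to : ∀ {u v} → (Star x (y ∷ []) ∪ CompleteMinus x y l) u v → Adj (Complete (x ∷ y ∷ l)) u v
    to (inj₁ (refl , here refl))              = inj₁ (here refl , there (here refl) , unique-head u)
    to (inj₂ (inj₁ (refl , v∈)))              = inj₁ (here refl , there (there v∈) , ∉⇒≢ x∉ v∈ ∘ sym)
    to (inj₂ (inj₂ (inj₁ (refl , v∈))))       = inj₁ (there (here refl) , there (there v∈) , ∉⇒≢ y∉ v∈ ∘ sym)
    to (inj₂ (inj₂ (inj₂ (u∈ , v∈ , u≢v))))   = inj₁ (there (there u∈) , there (there v∈) , u≢v)
    from : ∀ {u v} → Complete (x ∷ y ∷ l) u v → Adj (Star x (y ∷ []) ∪ CompleteMinus x y l) u v
    from (here refl , here refl , u≢v)                 = contradiction refl u≢v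
    from (here refl , there (here eq) , _)             = inj₁ (inj₁ (refl , here eq))
    from (here refl , there (there v∈) , _)            = inj₁ (inj₂ (inj₁ (refl , v∈)))
    from (there (here refl) , here refl , _)           = inj₂ (inj₁ (refl , here refl))
    from (there (here refl) , there (here refl) , u≢v) = contradiction refl u≢v
    from (there (here refl) , there (there v∈) , _)    = inj₁ (inj₂ (inj₂ (inj₁ (refl , v∈))))
    from (there (there u∈) , here refl , _)            = inj₂ (inj₂ (inj₁ (refl , u∈)))
    from (there (there u∈) , there (here refl) , _)    = inj₂ (inj₂ (inj₂ (inj₁ (refl , u∈))))
    from (there (there u∈) , there (there v∈) , u≢v)   = inj₁ (inj₂ (inj₂ (inj₂ (u∈ , v∈ , u≢v))))

  pendant-cone : ∀ s {x y l} → x ∉ l → y ∉ l → Bound (Star x (y ∷ []) ∪ Complete l) s 0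
  pendant-cone s {x} {y} x∉ y∉ = bound-cone s x y (inj₁ (refl , here refl)) λ
    { (inj₁ (u≡x , here v≡y)) → inj₁ (u≡x , v≡y) ; (inj₂ c) → inj₂ (complete-off x∉ y∉ id c) }

  -- The link of an edge from `x` to `l` in `α-step`: the edges from `z` to `l` are already gone
  -- there, so `z` hangs on `y` alone.
  Hook : Fin n → Fin n → List (Fin n) → Graph n
  Hook y z l = Star y l ∪ (Star z (y ∷ []) ∪ Complete l)

  HookBound : ℕ → ℕ → ℕ → Set
  HookBound t s N = ∀ y z l → Unique (y ∷ z ∷ l) → length l ≡ t → Bound (Hook y z l) s N

  hook-size-0 : ∀ {t} → HookBound t 0 0
  hook-size-0 y z l _ _ = bound-nonempty (inj₂ (inj₁ (refl , here refl)))

  -- Deleting the edges from `y` to `l` leaves `zy` as a separate component, hence a cone. Each link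
  -- isolates `z` and is complete on the other `t` vertices of `l`.
  hook-step : ∀ {t s N} → βBound t s N → HookBound (suc t) (suc s) (suc t * N)
  hook-step {t} {s} {N} β y z l u len = subst (Bound _ (suc s)) (trans (+-identityʳ _) (cong (_* N) len))
    (bound-star y l (pendant-cone (suc s) z∉ y∉) link)
    where
    y∉ : y ∉ l
    y∉ = Unique[x∷xs]⇒x∉xs u ∘ there
    z∉ : z ∉ l
    z∉ = Unique[x∷xs]⇒x∉xs (unique-tail u)
    link : ∀ {b} → b ∈ l → Bound (Off (Star z (y ∷ []) ∪ Complete l) y b) s N
    link {b} b∈ with remove (unique-tail (unique-tail u)) b∈
    ... | l′ , u′ , len′ , to , from = bound-cong
      (λ (u∈ , v∈ , u≢v) → inj₁ (inj₂ (proj₁ (from u∈) , proj₁ (from v∈) , u≢v) ,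
        (∉⇒≢ y∉ (proj₁ (from u∈)) , proj₂ (from u∈)) , (∉⇒≢ y∉ (proj₁ (from v∈)) , proj₂ (from v∈))))
      (λ { (inj₁ (_ , here v≡y) , _ , (v≢y , _)) → contradiction v≡y v≢y
         ; (inj₂ (u∈ , v∈ , u≢v) , (_ , u≢b) , (_ , v≢b)) → inj₁ (to u∈ u≢b , to v∈ v≢b , u≢v) })
      (β l′ u′ (suc-injective (trans (sym len′) len)))

  -- Here n = t + 4, and `l` has n - 3 vertices. The edges from `z` to `l` go first, with links of
  -- the α type; then those from `x` to `l`, with hooks as links; then those from `y` to `l`, with
  -- cones as links; then `zx`, whose link is complete on `l`. What remains is a cone over `zy`. In
  -- this order a term with the same k arises only from `zx`, hence only once.
  α-step : ∀ {t s A B M} → αBound t s A → HookBound t s B → βBound (suc t) s M →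
    αBound (2 + t) (suc s) (suc t * A + (suc t * B + M))
  α-step α hook β x y []      u ()
  α-step {t} {s} {A} {B} {M} α hook β x y (z ∷ l) u len =
    bound-cong to from (bound-≤′ (bound-star z l (bound-star x l (bound-star y l
      (bound-edge z x (pendant-cone (suc s) z∉ y∉) link-zx) link-y) link-x) link-z))
    where
    len-l : length l ≡ suc t
    len-l = suc-injective len
    x≢z : x ≢ z
    x≢z = unique-head (unique-skip u)
    y≢z : y ≢ z
    y≢z = unique-head (unique-tail u)
    x≢y : x ≢ y
    x≢y = unique-head u
    x∉ : x ∉ l
    x∉ = Unique[x∷xs]⇒x∉xs (unique-skip (unique-skip u))
    y∉ : y ∉ l
    y∉ = Unique[x∷xs]⇒x∉xs (unique-skip (unique-tail u))
    z∉ : z ∉ l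
    z∉ = Unique[x∷xs]⇒x∉xs (unique-tail (unique-tail u))
    unique-l : Unique l
    unique-l = unique-tail (unique-tail (unique-tail u))
    H₄ H₃ H₂ H₁ : Graph n
    H₄ = Star z (y ∷ []) ∪ Complete l
    H₃ = Star z (x ∷ []) ∪ H₄
    H₂ = Star y l ∪ H₃
    H₁ = Star x l ∪ H₂
    bound-≤′ : Bound (Star z l ∪ H₁) (suc s) (length l * A + (length l * B + (length l * 0 + (M + 0)))) →
      Bound (Star z l ∪ H₁) (suc s) (suc t * A + (suc t * B + M))
    bound-≤′ = subst (Bound _ (suc s)) (cong₂ (λ k m → k * A + (k * B + m)) len-l
      (cong₂ _+_ (*-zeroʳ (length l)) (+-identityʳ M)))
    link-zx : Bound (Off H₄ z x) s M
    link-zx = bound-cong (λ c → inj₁ (inj₂ c , complete-off z∉ x∉ id c))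
      (λ { (inj₁ (u≡z , _) , (u≢z , _) , _) → contradiction u≡z u≢z ; (inj₂ c , _) → inj₁ c })
      (β l unique-l len-l)
    link-y : ∀ {b} → b ∈ l → Bound (Off H₃ y b) s 0
    -- With `y` removed, and the other edges at `x` and `z` deleted before, `zx` is a component of
    -- its own.
    link-y {b} b∈ = bound-cone s z x
      (inj₁ (refl , here refl) , (y≢z ∘ sym , ∉⇒≢ z∉ b∈ ∘ sym) , (x≢y , ∉⇒≢ x∉ b∈ ∘ sym)) λ
      { (inj₁ (u≡z , here v≡x) , _)                   → inj₁ (u≡z , v≡x)
      ; (inj₂ (inj₁ (_ , here v≡y)) , _ , (v≢y , _)) → contradiction v≡y v≢y
      ; (inj₂ (inj₂ c) , _)                           → inj₂ (complete-off z∉ x∉ id c) }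
    link-x : ∀ {a} → a ∈ l → Bound (Off H₂ x a) s B
    link-x {a} a∈ with remove unique-l a∈
    ... | l′ , u′ , len′ , to , from = bound-cong
      (λ { (inj₁ (refl , v∈)) → inj₁ (inj₁ (refl , proj₁ (from v∈)) , (x≢y ∘ sym , ∉⇒≢ y∉ a∈ ∘ sym) , outside v∈)
         ; (inj₂ (inj₁ (refl , here refl))) → inj₁ (inj₂ (inj₂ (inj₁ (refl , here refl))) ,
             (x≢z ∘ sym , ∉⇒≢ z∉ a∈ ∘ sym) , (x≢y ∘ sym , ∉⇒≢ y∉ a∈ ∘ sym))
         ; (inj₂ (inj₂ (u∈ , v∈ , u≢v))) → inj₁ (inj₂ (inj₂ (inj₂ (proj₁ (from u∈) , proj₁ (from v∈) , u≢v))) ,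
             outside u∈ , outside v∈) })
      (λ { (inj₁ (u≡y , v∈) , _ , (_ , v≢a)) → inj₁ (inj₁ (u≡y , to v∈ v≢a))
         ; (inj₂ (inj₁ (_ , here v≡x)) , _ , (v≢x , _)) → contradiction v≡x v≢x
         ; (inj₂ (inj₂ (inj₁ e)) , _) → inj₁ (inj₂ (inj₁ e))
         ; (inj₂ (inj₂ (inj₂ (u∈ , v∈ , u≢v))) , (_ , u≢a) , (_ , v≢a)) →
             inj₁ (inj₂ (inj₂ (to u∈ u≢a , to v∈ v≢a , u≢v))) })
      (hook y z l′ (unique-replace₂ (unique-tail u) u′ (proj₁ ∘ from)) (suc-injective (trans (sym len′) len-l)))
      where
      outside : ∀ {v} → v ∈ l′ → v ≢ x × v ≢ a
      outside v∈ = ∉⇒≢ x∉ (proj₁ (from v∈)) , proj₂ (from v∈)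
      unique-replace₂ : ∀ {y z l} → Unique (y ∷ z ∷ l) → Unique l′ → (∀ {v} → v ∈ l′ → v ∈ l) → Unique (y ∷ z ∷ l′)
      unique-replace₂ {y} {z} u u′ ⊆l = unique-replace u (unique-replace (unique-tail u) u′ ⊆l)
        λ { (here eq) → here eq ; (there v∈) → there (⊆l v∈) }
    link-z : ∀ {a} → a ∈ l → Bound (Off H₁ z a) s A
    link-z {a} a∈ with remove unique-l a∈
    ... | l′ , u′ , len′ , to , from = bound-cong
      (λ { (inj₁ (refl , v∈)) → inj₁ (inj₁ (refl , proj₁ (from v∈)) , (x≢z , ∉⇒≢ x∉ a∈ ∘ sym) , outside v∈)
         ; (inj₂ (inj₁ (refl , v∈))) →
             inj₁ (inj₂ (inj₁ (refl , proj₁ (from v∈))) , (y≢z , ∉⇒≢ y∉ a∈ ∘ sym) , outside v∈)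
         ; (inj₂ (inj₂ (u∈ , v∈ , u≢v))) →
             inj₁ (inj₂ (inj₂ (inj₂ (inj₂ (proj₁ (from u∈) , proj₁ (from v∈) , u≢v)))) , outside u∈ , outside v∈) })
      (λ { (inj₁ (u≡x , v∈) , _ , (_ , v≢a)) → inj₁ (inj₁ (u≡x , to v∈ v≢a))
         ; (inj₂ (inj₁ (u≡y , v∈)) , _ , (_ , v≢a)) → inj₁ (inj₂ (inj₁ (u≡y , to v∈ v≢a)))
         ; (inj₂ (inj₂ (inj₁ (u≡z , _))) , (u≢z , _) , _) → contradiction u≡z u≢z
         ; (inj₂ (inj₂ (inj₂ (inj₁ (u≡z , _)))) , (u≢z , _) , _) → contradiction u≡z u≢z
         ; (inj₂ (inj₂ (inj₂ (inj₂ (u∈ , v∈ , u≢v)))) , (_ , u≢a) , (_ , v≢a)) →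
             inj₁ (inj₂ (inj₂ (to u∈ u≢a , to v∈ v≢a , u≢v))) })
      (α x y l′ (unique-replace (unique-skip′ u) (unique-replace (unique-skip (unique-tail u)) u′ (proj₁ ∘ from))
        (λ { (here eq) → here eq ; (there v∈) → there (proj₁ (from v∈)) })) (suc-injective (trans (sym len′) len-l)))
      where
      outside : ∀ {v} → v ∈ l′ → v ≢ z × v ≢ a
      outside v∈ = ∉⇒≢ z∉ (proj₁ (from v∈)) , proj₂ (from v∈)
      unique-skip′ : ∀ {x y z : Fin n} {l} → Unique (x ∷ y ∷ z ∷ l) → Unique (x ∷ y ∷ l)
      unique-skip′ ((p ∷ _ ∷ ps) ∷ u) = (p ∷ ps) ∷ unique-skip u
    to : ∀ {u v} → (Star z l ∪ H₁) u v → Adj (CompleteMinus x y (z ∷ l)) u v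
    to (inj₁ (refl , v∈)) = inj₁ (inj₂ (inj₂ (here refl , there v∈ , ∉⇒≢ z∉ v∈ ∘ sym)))
    to (inj₂ (inj₁ (u≡x , v∈))) = inj₁ (inj₁ (u≡x , there v∈))
    to (inj₂ (inj₂ (inj₁ (u≡y , v∈)))) = inj₁ (inj₂ (inj₁ (u≡y , there v∈)))
    to (inj₂ (inj₂ (inj₂ (inj₁ (refl , here v≡x))))) = inj₂ (inj₁ (v≡x , here refl))
    to (inj₂ (inj₂ (inj₂ (inj₂ (inj₁ (refl , here v≡y)))))) = inj₂ (inj₂ (inj₁ (v≡y , here refl)))
    to (inj₂ (inj₂ (inj₂ (inj₂ (inj₂ (u∈ , v∈ , u≢v)))))) = inj₁ (inj₂ (inj₂ (there u∈ , there v∈ , u≢v)))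
    from : ∀ {u v} → CompleteMinus x y (z ∷ l) u v → Adj (Star z l ∪ H₁) u v
    from (inj₁ (refl , here refl)) = inj₂ (inj₂ (inj₂ (inj₂ (inj₁ (refl , here refl)))))
    from (inj₁ (refl , there v∈)) = inj₁ (inj₂ (inj₁ (refl , v∈)))
    from (inj₂ (inj₁ (refl , here refl))) = inj₂ (inj₂ (inj₂ (inj₂ (inj₂ (inj₁ (refl , here refl))))))
    from (inj₂ (inj₁ (refl , there v∈))) = inj₁ (inj₂ (inj₂ (inj₁ (refl , v∈))))
    from (inj₂ (inj₂ (here refl , here refl , u≢v))) = contradiction refl u≢v
    from (inj₂ (inj₂ (here refl , there v∈ , _))) = inj₁ (inj₁ (refl , v∈))
    from (inj₂ (inj₂ (there u∈ , here refl , _))) = inj₂ (inj₁ (refl , u∈))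
    from (inj₂ (inj₂ (there u∈ , there v∈ , u≢v))) = inj₁ (inj₂ (inj₂ (inj₂ (inj₂ (inj₂ (u∈ , v∈ , u≢v))))))

  bound-list-∷ : ∀ {k} (v : Fin k → Fin n) → (∀ i j → v i ≡ v j → i ≡ j) → ∀ {s M N} e L →
    Bound (ListGraph v (reorder (filterᵇ (disjointE e) L))) s N → Bound (ListGraph v L) (suc s) M →
    Bound (ListGraph v (e ∷ L)) (suc s) (if all (disjointE e) L then 0 else N + M)
  bound-list-∷ v inj {s} {M} {N} e L bLink bDel with all (disjointE e) L in eq
  ... | true = bound-cone (suc s) _ _ (e , here refl , refl , refl) λ
    { (_ , here refl , u≡ , w≡)    → inj₁ (u≡ , w≡)
    ; (f , there f∈ , refl , refl) → inj₂ (outside f (disjointE⇒ e f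
        (All.lookup (All.all⁺ (disjointE e) L (subst T (sym eq) tt)) f∈))) }
    where
    outside : ∀ f → Disjoint e f → Outside (v (proj₁ e)) (v (proj₂ e)) (v (proj₁ f)) (v (proj₂ f))
    outside f (p , q , r , t) = (p ∘ sym ∘ inj _ _ , r ∘ sym ∘ inj _ _) , (q ∘ sym ∘ inj _ _ , t ∘ sym ∘ inj _ _)
  ... | false = bound-cong
    (λ { (inj₁ (refl , here refl)) → inj₁ (e , here refl , refl , refl)
       ; (inj₂ (f , f∈ , u≡ , w≡)) → inj₁ (f , there f∈ , u≡ , w≡) })
    (λ { (_ , here refl , u≡ , w≡) → inj₁ (inj₁ (u≡ , here w≡))
       ; (f , there f∈ , u≡ , w≡)  → inj₁ (inj₂ (f , f∈ , u≡ , w≡)) })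
    (bound-edge (v (proj₁ e)) (v (proj₂ e)) bDel (bound-cong to from bLink))
    where
    to : ∀ {u w} → ListGraph v (reorder (filterᵇ (disjointE e) L)) u w →
      Adj (Off (ListGraph v L) (v (proj₁ e)) (v (proj₂ e))) u w
    to (f , f∈ , refl , refl) with ∈-filter⁻ (T? ∘ disjointE e) {xs = L} (∈-reorder⁻ _ f∈)
    ... | f∈L , t with disjointE⇒ e f t
    ...   | p , q , r , t′ = inj₁ ((f , f∈L , refl , refl) ,
      (p ∘ sym ∘ inj _ _ , r ∘ sym ∘ inj _ _) , (q ∘ sym ∘ inj _ _ , t′ ∘ sym ∘ inj _ _))
    from : ∀ {u w} → Off (ListGraph v L) (v (proj₁ e)) (v (proj₂ e)) u w →
      Adj (ListGraph v (reorder (filterᵇ (disjointE e) L))) u w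
    from ((f , f∈ , refl , refl) , (p , r) , (q , t)) = inj₁ (f , ∈-reorder⁺ _
      (∈-filter⁺ (T? ∘ disjointE e) f∈ (⇒disjointE e f
        (p ∘ sym ∘ cong v , q ∘ sym ∘ cong v , r ∘ sym ∘ cong v , t ∘ sym ∘ cong v))) , refl , refl)

  bound-list : ∀ {k} (v : Fin k → Fin n) → (∀ i j → v i ≡ v j → i ≡ j) → ∀ s L →
    Bound (ListGraph v L) s (deletionCost s L)
  bound-list v inj zero    []      = bound-size-0
  bound-list v inj zero    (e ∷ L) = bound-nonempty (e , here refl , refl , refl)
  bound-list v inj (suc s) []      = bound-empty s λ { (_ , () , _) }
  bound-list v inj (suc s) (e ∷ L) = bound-list-∷ v inj e L
    (bound-list v inj s (reorder (filterᵇ (disjointE e) L))) (bound-list v inj (suc s) L)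

  -- The case (k, r) = (0, 2). The constant 1 is checked by evaluation of
  -- `deletionCost 2 K₇-minus-edge`.
  α-7 : αBound 5 2 1
  α-7 x y l u len with l | len
  ... | l@(_ ∷ _ ∷ _ ∷ _ ∷ _ ∷ []) | refl = bound-cong to from
    (bound-list v (lookup-injective u) 2 K₇-minus-edge)
    where
    v : Fin 7 → Fin n
    v = List.lookup (x ∷ y ∷ l)
    to : ∀ {u w} → ListGraph v K₇-minus-edge u w → Adj (CompleteMinus x y l) u w
    to ((i , j) , e∈ , refl , refl) with i | j | All.lookup K₇-increasing e∈
    ... | fz        | fs (fs k) | _         = inj₁ (inj₁ (refl , ∈-lookup k))
    ... | fs fz     | fs (fs k) | _         = inj₁ (inj₂ (inj₁ (refl , ∈-lookup k)))
    ... | fs (fs i) | fs (fs k) | i<k , _   = inj₁ (inj₂ (inj₂ (∈-lookup i , ∈-lookup k , λ eq →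
      Fin.<⇒≢ i<k (cong (λ i → fs (fs i)) (lookup-injective (unique-tail (unique-tail u)) i k eq)))))
    ... | _         | fs fz     | _ , s≤s ()
    from : ∀ {u w} → CompleteMinus x y l u w → Adj (ListGraph v K₇-minus-edge) u w
    from (inj₁ (refl , w∈))               = inj₁ (_ , K₇-edge-0 (index w∈) , refl , lookup-index w∈)
    from (inj₂ (inj₁ (refl , w∈)))        = inj₁ (_ , K₇-edge-1 (index w∈) , refl , lookup-index w∈)
    from (inj₂ (inj₂ (u∈ , w∈ , u≢w)))    =
      [ (λ eq → contradiction
          (trans (lookup-index u∈) (trans (cong (List.lookup l) eq) (sym (lookup-index w∈)))) u≢w)
      , [ (λ e∈ → inj₁ (_ , e∈ , lookup-index u∈ , lookup-index w∈))
        , (λ e∈ → inj₂ (_ , e∈ , lookup-index w∈ , lookup-index u∈)) ] ] (K₇-edge (index u∈) (index w∈))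

  -- The neighbourhood `H` may be smaller than `l`: this covers both a vertex joined to all others
  -- and one that misses `y`.
  extend-vertex : ∀ {s M N} x l → Unique (x ∷ l) → Bound (Complete l) (suc s) M →
    (∀ l′ → Unique l′ → length l ≡ suc (length l′) → (∀ {v} → v ∈ l′ → v ∈ l) → Bound (Complete l′) s N) →
    ∀ H → (∀ {v} → v ∈ H → v ∈ l) → Bound (Star x H ∪ Complete l) (suc s) (length H * N + M)
  extend-vertex x l u bound links H H⊆l = bound-star x H bound λ a∈ → link (H⊆l a∈)
    where
    x∉ : x ∉ l
    x∉ = Unique[x∷xs]⇒x∉xs u
    link : ∀ {a} → a ∈ l → Bound (Off (Complete l) x a) _ _
    link {a} a∈ with remove (unique-tail u) a∈
    ... | l′ , u′ , len′ , to , from = bound-cong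
      (λ (u∈ , v∈ , u≢v) → inj₁ ((proj₁ (from u∈) , proj₁ (from v∈) , u≢v) ,
        (∉⇒≢ x∉ (proj₁ (from u∈)) , proj₂ (from u∈)) , (∉⇒≢ x∉ (proj₁ (from v∈)) , proj₂ (from v∈))))
      (λ ((u∈ , v∈ , u≢v) , (_ , u≢a) , (_ , v≢a)) → inj₁ (to u∈ u≢a , to v∈ v≢a , u≢v))
      (links l′ u′ len′ (proj₁ ∘ from))

  -- Deletes the whole star of one vertex. The term with one vertex less and the same size has k + 1
  -- in place of k, so this yields a finite bound but no control of the growth in r.
  β-vertex : ∀ {s p M N} → βBound p s N → βBound (suc p) (suc s) M → βBound (2 + p) (suc s) (suc p * N + M)
  β-vertex bN bM []      u ()
  β-vertex {s} {p} {M} {N} bN bM (x ∷ l) u eq = subst (λ k → Bound (Complete (x ∷ l)) (suc s) (k * N + M)) len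
    (bound-cong to from (extend-vertex x l u (bM l (unique-tail u) len)
      (λ l′ u′ len′ _ → bN l′ u′ (suc-injective (trans (sym len′) len))) l id))
    where
    len : length l ≡ suc p
    len = suc-injective eq
    x∉ : x ∉ l
    x∉ = Unique[x∷xs]⇒x∉xs u
    to : ∀ {u v} → (Star x l ∪ Complete l) u v → Adj (Complete (x ∷ l)) u v
    to (inj₁ (refl , v∈))     = inj₁ (here refl , there v∈ , ∉⇒≢ x∉ v∈ ∘ sym)
    to (inj₂ (u∈ , v∈ , u≢v)) = inj₁ (there u∈ , there v∈ , u≢v)
    from : ∀ {u v} → Complete (x ∷ l) u v → Adj (Star x l ∪ Complete l) u v
    from (here refl , here refl , u≢v) = contradiction refl u≢v
    from (here refl , there v∈ , _)    = inj₁ (inj₁ (refl , v∈))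
    from (there u∈ , here refl , _)    = inj₂ (inj₁ (refl , u∈))
    from (there u∈ , there v∈ , u≢v)   = inj₁ (inj₂ (u∈ , v∈ , u≢v))

  opaque
    unfolding crudeBound

    β-crude : ∀ s p → βBound p s (crudeBound s p)
    β-crude zero    p             _ _ _        = bound-size-0
    β-crude (suc s) zero          [] _ _       = bound-empty s λ { (() , _) }
    β-crude (suc s) (suc zero)    (x ∷ []) _ _ = bound-empty s λ { (here refl , here refl , u≢v) → u≢v refl }
    β-crude (suc s) (suc (suc p)) = β-vertex (β-crude s p) (β-crude (suc s) (suc p))

    α-crude : ∀ s t → αBound t s (crudeBound s (2 + t))
    α-crude zero    t       _ _ _ _ _ = bound-size-0
    α-crude (suc s) t = λ x y l u len → bound-≤ (+-monoˡ-≤ M (*-monoˡ-≤ N (n≤1+n t))) (bound x y l u len)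
      where
      N M : ℕ
      N = crudeBound s t
      M = crudeBound (suc s) (suc t)
      bN : βBound t s N
      bN = β-crude s t
      bM : βBound (suc t) (suc s) M
      bM = β-crude (suc s) (suc t)
      bound : αBound t (suc s) (t * N + M)
      bound x y l u len = subst (λ k → Bound (CompleteMinus x y l) (suc s) (k * N + M)) len
        (bound-cong to from (extend-vertex x (y ∷ l) u (bM (y ∷ l) (unique-tail u) (cong suc len))
          (λ l′ u′ len′ _ → bN l′ u′ (trans (suc-injective (sym len′)) len)) l there))
        where
        y∉ : y ∉ l
        y∉ = Unique[x∷xs]⇒x∉xs (unique-tail u)
        to : ∀ {u v} → (Star x l ∪ Complete (y ∷ l)) u v → Adj (CompleteMinus x y l) u v
        to (inj₁ e)                               = inj₁ (inj₁ e)
        to (inj₂ (here refl , here refl , u≢v))   = contradiction refl u≢v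
        to (inj₂ (here refl , there v∈ , _))      = inj₁ (inj₂ (inj₁ (refl , v∈)))
        to (inj₂ (there u∈ , here refl , _))      = inj₂ (inj₂ (inj₁ (refl , u∈)))
        to (inj₂ (there u∈ , there v∈ , u≢v))     = inj₁ (inj₂ (inj₂ (u∈ , v∈ , u≢v)))
        from : ∀ {u v} → CompleteMinus x y l u v → Adj (Star x l ∪ Complete (y ∷ l)) u v
        from (inj₁ e)                         = inj₁ (inj₁ e)
        from (inj₂ (inj₁ (refl , v∈)))        = inj₁ (inj₂ (here refl , there v∈ , ∉⇒≢ y∉ v∈ ∘ sym))
        from (inj₂ (inj₂ (u∈ , v∈ , u≢v)))    = inj₁ (inj₂ (there u∈ , there v∈ , u≢v))

-- Bounds on the dimensions

-- A common bound for the two homology groups at r = k + 2 + j.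
homologyBound : ℕ → ℕ → ℕ
homologyBound zero    j       = 1
homologyBound (suc k) zero    = crudeBound (2 + (suc k * 2 + 0)) (7 + (suc k * 5 + 0 * 3))
homologyBound (suc k) (suc j) = homologyBound k (2 + j) + (suc m * homologyBound k (2 + j) +
    (suc m * (m * homologyBound k (1 + j)) + homologyBound (suc k) j))
  where m = 11 + (k * 5 + j * 3)

module _ {n : ℕ} (vs : List (Edge n)) (uniq : Unique vs)
  (ordered : ∀ i → proj₁ (List.lookup vs i) Fin.< proj₂ (List.lookup vs i)) where

  open GraphComplex vs uniq ordered

  mutual
    -- The range is k < 0, and no term of the recurrences has a larger k. For s = 0 an edge must be
    -- present to kill the class of the empty face, whence `1 ≤ t`.
    α-vanishes : ∀ s {t} → 3 * s ≤ t → 1 ≤ t → αBound t s 0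
    α-vanishes zero _ (s≤s _) x y []      u ()
    α-vanishes zero _ _       x y (z ∷ l) u len = bound-nonempty (inj₁ (refl , here refl))
    α-vanishes (suc s) {t} 3s≤t _ = from-step s (subst (_≤ t) (*-suc 3 s) 3s≤t)

    from-step : ∀ s {t} → 3 + 3 * s ≤ t → αBound t (suc s) 0
    from-step s {suc (suc t)} (s≤s (s≤s 3s<t)) = subst (αBound (2 + t) (suc s))
      (cong₂ (λ u v → u + (v + 0)) (*-zeroʳ (suc t)) (*-zeroʳ (suc t)))
      (α-step vs uniq ordered (α-vanishes s (≤-trans (n≤1+n _) 3s<t) (≤-trans (s≤s z≤n) 3s<t))
        (hook-vanishes s 3s<t) (β-vanishes s (s≤s 3s<t)))

    hook-vanishes : ∀ s {t} → 1 + 3 * s ≤ t → HookBound vs uniq ordered t s 0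
    hook-vanishes zero    _ = hook-size-0 vs uniq ordered
    hook-vanishes (suc s) {suc t} (s≤s 3s≤t) = subst (HookBound vs uniq ordered (suc t) (suc s)) (*-zeroʳ (suc t))
      (hook-step vs uniq ordered (β-vanishes s (≤-trans (n≤1+n _) (subst (_≤ t) (*-suc 3 s) 3s≤t))))

    β-vanishes : ∀ s {p} → 2 + 3 * s ≤ p → βBound p s 0
    β-vanishes zero _ (x ∷ y ∷ l) u len =
      bound-nonempty (here refl , there (here refl) , unique-head u)
    β-vanishes zero (s≤s ()) (_ ∷ []) _ refl
    β-vanishes zero (s≤s _) [] _ ()
    β-vanishes (suc s) {suc (suc p)} (s≤s (s≤s 3s≤p)) = β-step vs uniq ordered
      (β-vanishes s (≤-trans (n≤1+n _) 3+3s≤p)) (from-step s 3+3s≤p)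
      where
      3+3s≤p : 3 + 3 * s ≤ p
      3+3s≤p = subst (_≤ p) (*-suc 3 s) 3s≤p

  -- The offsets place (q, s) = (0, 0) at n = 7 and size 2, which is (k, r) = (0, 2).
  HomologyBound : ℕ → ℕ → ℕ → Set
  HomologyBound q s N = αBound (5 + q) (2 + s) N × βBound (7 + q) (2 + s) N

  αBound-≤ : ∀ {t s M N} → M ≤ N → αBound t s M → αBound t s N
  αBound-≤ M≤N α x y l u len = bound-≤ M≤N (α x y l u len)

  -- The case k = 0: every term with k - 1 vanishes, so the bound 1 passes unchanged along (n, s) ↦
  -- (n + 3, s + 1).
  bottom-bound : ∀ j → HomologyBound (j * 3) j 1
  bottom-bound j = α j , β-step vs uniq ordered (β-vanishes (1 + j)
    (≤-reflexive (cong (λ u → 2 + u) (*-comm 3 (1 + j))))) (α j)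
    where
    α : ∀ j → αBound (5 + j * 3) (2 + j) 1
    α zero    = α-7 vs uniq ordered
    α (suc j) = subst (αBound (8 + j * 3) (3 + j))
      (cong₂ (λ u v → u + (v + 1)) (*-zeroʳ (7 + j * 3)) (*-zeroʳ (7 + j * 3)))
      (α-step vs uniq ordered (α-vanishes (2 + j) 3s≤t (s≤s z≤n))
        (subst (HookBound vs uniq ordered (6 + j * 3) (2 + j)) (*-zeroʳ (6 + j * 3))
          (hook-step vs uniq ordered (β-vanishes (1 + j) (≤-reflexive (cong (λ u → 2 + u) (*-comm 3 (1 + j)))))))
        (proj₂ (bottom-bound j)))
      where
      3s≤t : 3 * (2 + j) ≤ 6 + j * 3
      3s≤t = ≤-reflexive (*-comm 3 (2 + j))

  -- For the new pair n = 15 + q, so m = n - 4. `N₀`, `N₁` and `N₂` belong to n - 3, n - 5 and n - 2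
  -- vertices. The extra summand `N₂` pays for passing from α to β, so one number bounds both.
  homology-step : ∀ q s {N₀ N₁ N₂} → HomologyBound (5 + q) (2 + s) N₀ → HomologyBound (3 + q) (1 + s) N₁ →
    HomologyBound (6 + q) (2 + s) N₂ → let m = 11 + q in
    HomologyBound (8 + q) (3 + s) (N₂ + (suc m * N₂ + (suc m * (m * N₁) + N₀)))
  homology-step q s {N₀} {N₁} {N₂} (_ , β₀) (_ , β₁) (α₂ , β₂) =
    αBound-≤ (m≤n+m _ N₂) α , β-step vs uniq ordered β₂ α
    where
    m : ℕ
    m = 11 + q
    α : αBound (2 + m) (5 + s) (suc m * N₂ + (suc m * (m * N₁) + N₀))
    α = α-step vs uniq ordered α₂ (hook-step vs uniq ordered β₁) β₀

  homology-bound : ∀ k j {q s} → q ≡ k * 5 + j * 3 → s ≡ k * 2 + j → HomologyBound q s (homologyBound k j)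
  homology-bound zero    j       refl refl = bottom-bound j
  homology-bound (suc k) zero    refl refl = α-crude vs uniq ordered _ _ , β-crude vs uniq ordered _ _
  homology-bound (suc k) (suc j) eq-q eq-s = subst₂ (λ q s → HomologyBound q s (homologyBound (suc k) (suc j)))
    (sym (trans eq-q (shift-q (suc k) 1 j))) (sym (trans eq-s (shift-s (suc k) 1 j)))
    (homology-step (k * 5 + j * 3) (k * 2 + j) (homology-bound (suc k) j refl refl)
      (homology-bound k (1 + j) (sym (shift-q k 1 j)) (sym (shift-s k 1 j)))
      (homology-bound k (2 + j) (sym (shift-q k 2 j)) (sym (shift-s k 2 j))))
    where
    shift-q : ∀ k i j → k * 5 + (i + j) * 3 ≡ i * 3 + (k * 5 + j * 3)
    shift-q = ℕ-Solver.solve-∀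
    shift-s : ∀ k i j → k * 2 + (i + j) ≡ i + (k * 2 + j)
    shift-s = ℕ-Solver.solve-∀

-- Polynomial growth of the recursive bound

shift : ℕ → ℕ
shift zero    = 0
-- The last summand pays for the crude starting value at j = 0. The summand k + 2 makes the new base
-- exceed those at level k, and makes three times the base exceed m + 2.
shift (suc k) = shift k + ((k + 2) + (suc k) ! * homologyBound (suc k) 0)

-- The two highest terms of the binomial expansion: a discrete derivative of the power, which
-- absorbs the increment from j to j + 1.
power-step : ∀ y e → y ^ suc e + suc e * y ^ e ≤ suc y ^ suc e
power-step y zero    = ≤-reflexive (identity y)
  where
  identity : ∀ y → y * 1 + 1 * 1 ≡ suc y * 1
  identity = ℕ-Solver.solve-∀
power-step y (suc e) = begin
  -- The added term makes the sum divisible by `suc y`, with the left-hand side for `e` as quotient.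
  y * y ^ suc e + suc (suc e) * y ^ suc e            ≤⟨ m≤m+n _ (suc e * y ^ e) ⟩
  y * y ^ suc e + suc (suc e) * y ^ suc e + suc e * y ^ e
    ≡⟨ identity y (y ^ e) e ⟩
  suc y * (y ^ suc e + suc e * y ^ e)                ≤⟨ *-monoʳ-≤ (suc y) (power-step y e) ⟩
  suc y * suc y ^ suc e                              ∎
  where
  open ≤-Reasoning
  identity : ∀ y z e → y * (y * z) + suc (suc e) * (y * z) + suc e * z ≡ suc y * (y * z + suc e * z)
  identity = ℕ-Solver.solve-∀

x≤x^suc : ∀ x e → x ≤ x ^ suc e
x≤x^suc zero    e = z≤n
x≤x^suc (suc x) e = subst (_≤ suc x ^ suc e) (*-identityʳ (suc x)) (*-monoʳ-≤ (suc x) (m^n>0 (suc x) e))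

-- Writing Y for the base at (k + 1, j), the increment from j to j + 1 is at most
-- (k + 1) 3ᵏ (m + 2)² Y³ᵏ with m + 2 ≤ 3 Y, hence at most (3k + 3) 3ᵏ⁺¹ Y³ᵏ⁺², which power-step absorbs.
homologyBound-≤ : ∀ k j → k ! * homologyBound k j ≤ 3 ^ k * ((k + 2 + j) + shift k) ^ (3 * k)
homologyBound-≤ zero    j    = ≤-refl
homologyBound-≤ (suc k) zero = begin
  c                                                          ≤⟨ m≤n+m c (shift k + (k + 2)) ⟩
  shift k + (k + 2) + c                                      ≡⟨ +-assoc (shift k) (k + 2) c ⟩
  shift (suc k)                                              ≤⟨ m≤n+m (shift (suc k)) (suc k + 2 + 0) ⟩
  -- The exponent is `3 * suc k` unfolded to a successor.
  (suc k + 2 + 0) + shift (suc k)                            ≤⟨ x≤x^suc _ (k + (suc k + (suc k + 0))) ⟩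
  ((suc k + 2 + 0) + shift (suc k)) ^ (3 * suc k)            ≡⟨ sym (+-identityʳ _) ⟩
  1 * ((suc k + 2 + 0) + shift (suc k)) ^ (3 * suc k)        ≤⟨ *-monoˡ-≤ _ (m^n>0 3 (suc k)) ⟩
  3 ^ suc k * ((suc k + 2 + 0) + shift (suc k)) ^ (3 * suc k) ∎
  where
  open ≤-Reasoning
  c = (suc k) ! * homologyBound (suc k) 0
homologyBound-≤ (suc k) (suc j) = begin
  suc k * k ! * (c₂ + (suc m * c₂ + (suc m * (m * c₁) + c₀)))
    ≡⟨ expand (suc k) (k !) c₀ c₁ c₂ m ⟩
  suc k * ((2 + m) * (k ! * c₂) + suc m * m * (k ! * c₁)) + suc k * k ! * c₀
    ≤⟨ +-mono-≤ (*-monoʳ-≤ (suc k) (+-mono-≤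
         (*-monoʳ-≤ (2 + m) (≤-trans (homologyBound-≤ k (2 + j)) (mono X₂≤Y)))
         (*-monoʳ-≤ (suc m * m) (≤-trans (homologyBound-≤ k (1 + j)) (mono X₁≤Y)))))
         (homologyBound-≤ (suc k) j) ⟩
  suc k * ((2 + m) * (3 ^ k * Y ^ (3 * k)) + suc m * m * (3 ^ k * Y ^ (3 * k))) + 3 ^ suc k * Y ^ (3 * suc k)
    ≡⟨ cong (_+ 3 ^ suc k * Y ^ (3 * suc k)) (collect (suc k) m (3 ^ k) (Y ^ (3 * k))) ⟩
  suc k * 3 ^ k * (2 + m + suc m * m) * Y ^ (3 * k) + 3 ^ suc k * Y ^ (3 * suc k)
    ≤⟨ +-monoˡ-≤ _ (*-monoˡ-≤ (Y ^ (3 * k)) (*-monoʳ-≤ (suc k * 3 ^ k) square)) ⟩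
  suc k * 3 ^ k * ((3 * Y) * (3 * Y)) * Y ^ (3 * k) + 3 ^ suc k * Y ^ (3 * suc k)
    ≡⟨ cong (λ e → suc k * 3 ^ k * ((3 * Y) * (3 * Y)) * Y ^ (3 * k) + 3 ^ suc k * Y ^ e) (*-suc 3 k) ⟩
  suc k * 3 ^ k * ((3 * Y) * (3 * Y)) * Y ^ (3 * k) + 3 * 3 ^ k * (Y * (Y * (Y * Y ^ (3 * k))))
    -- 9 (k + 1) 3ᵏ = 3ᵏ⁺¹ (3 k + 3): the increment matches the derivative of the power exactly, so
    -- the coefficient 3ᵏ / k! is kept without loss.
    ≡⟨ regroup k (3 ^ k) Y (Y ^ (3 * k)) ⟩
  3 * 3 ^ k * (Y * (Y * (Y * Y ^ (3 * k))) + suc (suc (suc (3 * k))) * (Y * (Y * Y ^ (3 * k))))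
    ≤⟨ *-monoʳ-≤ (3 ^ suc k) (power-step Y (2 + 3 * k)) ⟩
  3 ^ suc k * suc Y ^ (3 + 3 * k)
    ≡⟨ cong₂ (λ y e → 3 ^ suc k * y ^ e) (cong (_+ shift (suc k)) (sym (+-suc (suc k + 2) j))) (sym (*-suc 3 k)) ⟩
  3 ^ suc k * ((suc k + 2 + suc j) + shift (suc k)) ^ (3 * suc k) ∎
  where
  open ≤-Reasoning
  m c₀ c₁ c₂ Y : ℕ
  m = 11 + (k * 5 + j * 3)
  c₀ = homologyBound (suc k) j
  c₁ = homologyBound k (1 + j)
  c₂ = homologyBound k (2 + j)
  Y = (suc k + 2 + j) + shift (suc k)
  mono : ∀ {x} → x ≤ Y → 3 ^ k * x ^ (3 * k) ≤ 3 ^ k * Y ^ (3 * k)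
  mono x≤Y = *-monoʳ-≤ (3 ^ k) (^-monoˡ-≤ (3 * k) x≤Y)
  expand : ∀ a f c₀ c₁ c₂ m → a * f * (c₂ + (suc m * c₂ + (suc m * (m * c₁) + c₀))) ≡
    a * ((2 + m) * (f * c₂) + suc m * m * (f * c₁)) + a * f * c₀
  expand = ℕ-Solver.solve-∀
  collect : ∀ a m p y → a * ((2 + m) * (p * y) + suc m * m * (p * y)) ≡ a * p * (2 + m + suc m * m) * y
  collect = ℕ-Solver.solve-∀
  regroup : ∀ k p Y y → suc k * p * ((3 * Y) * (3 * Y)) * y + 3 * p * (Y * (Y * (Y * y))) ≡
    3 * p * (Y * (Y * (Y * y)) + suc (suc (suc (3 * k))) * (Y * (Y * y)))
  regroup = ℕ-Solver.solve-∀
  g : ℕ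
  g = (suc k) ! * homologyBound (suc k) 0
  X₂≤Y : (k + 2 + (2 + j)) + shift k ≤ Y
  X₂≤Y = subst₂ _≤_ refl (slack k j (shift k) g) (m≤m+n _ (k + 1 + g))
    where
    slack : ∀ k j s g → (k + 2 + (2 + j)) + s + (k + 1 + g) ≡ (suc k + 2 + j) + (s + ((k + 2) + g))
    slack = ℕ-Solver.solve-∀
  X₁≤Y : (k + 2 + (1 + j)) + shift k ≤ Y
  X₁≤Y = ≤-trans (+-monoˡ-≤ (shift k) (+-monoʳ-≤ (k + 2) (n≤1+n (1 + j)))) X₂≤Y
  m+2≤3Y : 2 + m ≤ 3 * Y
  m+2≤3Y = subst₂ _≤_ refl (slack k j (shift k) g) (m≤m+n _ (k + 2 + 3 * (shift k + g)))
    where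
    slack : ∀ k j s g → 2 + (11 + (k * 5 + j * 3)) + (k + 2 + 3 * (s + g)) ≡ 3 * ((suc k + 2 + j) + (s + ((k + 2) + g)))
    slack = ℕ-Solver.solve-∀
  square : 2 + m + suc m * m ≤ (3 * Y) * (3 * Y)
  square = ≤-trans (≤-trans (m≤m+n _ (2 * m + 2)) (≤-reflexive (slack m))) (*-mono-≤ m+2≤3Y m+2≤3Y)
    where
    slack : ∀ m → 2 + m + suc m * m + (2 * m + 2) ≡ (2 + m) * (2 + m)
    slack = ℕ-Solver.solve-∀

-- The theorem for the given complexes

edgesFrom : ∀ n → Fin n → List (Edge n)
edgesFrom n a = map (λ b → (a , b)) (filterᵇ (λ b → toℕ a <ᵇ toℕ b) (allFin n))

∈-edgesFrom⁻ : ∀ n a {e} → e ∈ edgesFrom n a → proj₁ e ≡ a × proj₁ e Fin.< proj₂ e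
∈-edgesFrom⁻ n a e∈ with ∈-map⁻ (λ b → (a , b)) e∈
... | b , b∈ , refl = refl , <ᵇ⇒< (toℕ a) (toℕ b)
  (proj₂ (∈-filter⁻ (T? ∘ λ b → toℕ a <ᵇ toℕ b) {xs = allFin n} b∈))

∈-allEdges⁻ : ∀ n {e} → e ∈ allEdges n → proj₁ e Fin.< proj₂ e
∈-allEdges⁻ n e∈ with satisfied (∈-concatMap⁻ (edgesFrom n) {xs = allFin n} e∈)
... | a , e∈′ = proj₂ (∈-edgesFrom⁻ n a e∈′)

∈-allEdges⁺ : ∀ n {a b} → a Fin.< b → (a , b) ∈ allEdges n
∈-allEdges⁺ n {a} {b} a<b = ∈-concatMap⁺ (edgesFrom n) (lose (∈-allFin a) (∈-map⁺ (λ b → (a , b))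
  (∈-filter⁺ (T? ∘ λ b → toℕ a <ᵇ toℕ b) (∈-allFin b) (<⇒<ᵇ a<b))))

allEdges-unique : ∀ n → Unique (allEdges n)
allEdges-unique n = concat⁺
  (All.map⁺ (All.tabulate λ _ → map⁺ ,-injectiveʳ (filter⁺ (T? ∘ _) (allFin⁺ n))))
  (AllPairs.map⁺ (AllPairs.map disjoint (allFin⁺ n)))
  where
  disjoint : ∀ {a b} → a ≢ b → ∀ {e} → ¬ (e ∈ edgesFrom n a × e ∈ edgesFrom n b)
  disjoint {a} {b} a≢b (e∈a , e∈b) =
    a≢b (trans (sym (proj₁ (∈-edgesFrom⁻ n a e∈a))) (proj₁ (∈-edgesFrom⁻ n b e∈b)))

allEdges-ordered : ∀ n i → proj₁ (List.lookup (allEdges n) i) Fin.< proj₂ (List.lookup (allEdges n) i)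
allEdges-ordered n i = ∈-allEdges⁻ n (∈-lookup i)

minus12-unique : ∀ n → Unique (allEdgesMinus12 n)
minus12-unique n = filter⁺ (T? ∘ (not ∘ is12)) (allEdges-unique n)

∈-minus12⁻ : ∀ n {e} → e ∈ allEdgesMinus12 n → e ∈ allEdges n × T (not (is12 e))
∈-minus12⁻ n = ∈-filter⁻ (T? ∘ (not ∘ is12)) {xs = allEdges n}

minus12-ordered : ∀ n i →
  proj₁ (List.lookup (allEdgesMinus12 n) i) Fin.< proj₂ (List.lookup (allEdgesMinus12 n) i)
minus12-ordered n i = ∈-allEdges⁻ n (proj₁ (∈-minus12⁻ n (∈-lookup i)))

βdim-≤ : ∀ n {s h N} → GraphComplex.βBound (allEdges n) (allEdges-unique n) (allEdges-ordered n) n s N →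
  βdim n s h → h ≤ N
βdim-≤ n bound hom = homDim-≤ (allEdges-unique n)
  (λ i → inj₁ (∈-allFin _ , ∈-allFin _ , Fin.<⇒≢ (allEdges-ordered n i))) hom
  (bound (allFin n) (allFin⁺ n) (length-tabulate id) covered)
  where
  open GraphComplex (allEdges n) (allEdges-unique n) (allEdges-ordered n)
  open MatchingComplex (allEdges n)
  covered : Covered (Complete (allFin n))
  covered {u} {v} (_ , _ , u≢v) with Fin.<-cmp u v
  ... | tri< u<v _ _ = index (∈-allEdges⁺ n u<v) , inj₁ (sym (lookup-index (∈-allEdges⁺ n u<v)))
  ... | tri≈ _ u≡v _ = contradiction u≡v u≢v
  ... | tri> _ _ v<u = index (∈-allEdges⁺ n v<u) , inj₂ (sym (lookup-index (∈-allEdges⁺ n v<u)))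

-- The vertices 1 and 2 are `fz` and `fs fz`, and `allFin` unfolds to them followed by `rest`. Both
-- inclusions are needed: `full` puts every stored edge into the graph, `covered` finds every edge
-- of the graph in the list.
αdim-≤ : ∀ t {s h N} →
  GraphComplex.αBound (allEdgesMinus12 (2 + t)) (minus12-unique (2 + t)) (minus12-ordered (2 + t)) t s N →
  αdim (2 + t) s h → h ≤ N
αdim-≤ t bound hom = homDim-≤ (minus12-unique n) (λ i → full i) hom
  (bound fz (fs fz) rest (allFin⁺ n) (length-tabulate (λ i → fs (fs i))) covered)
  where
  n = 2 + t
  rest : List (Fin n)
  rest = tabulate λ i → fs (fs i)
  open GraphComplex (allEdgesMinus12 n) (minus12-unique n) (minus12-ordered n)
  open MatchingComplex (allEdgesMinus12 n)
  G : Graph n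
  G = CompleteMinus fz (fs fz) rest
  adjacent : ∀ a b → a Fin.< b → T (not (is12 (a , b))) → G a b
  adjacent fz          (fs fz)     _   ()
  adjacent fz          (fs (fs b)) _   _ = inj₁ (refl , ∈-tabulate⁺ b)
  adjacent (fs fz)     (fs (fs b)) _   _ = inj₂ (inj₁ (refl , ∈-tabulate⁺ b))
  adjacent (fs fz)     (fs fz)     (s≤s ()) _
  adjacent (fs (fs a)) (fs fz)     (s≤s ()) _
  adjacent (fs (fs a)) (fs (fs b)) a<b _ = inj₂ (inj₂ (∈-tabulate⁺ a , ∈-tabulate⁺ b , Fin.<⇒≢ a<b))
  full : ∀ i → Edges G i
  full i = inj₁ (adjacent _ _ (minus12-ordered n i) (proj₂ (∈-minus12⁻ n (∈-lookup i))))
  edge : ∀ {a b} → a Fin.< b → T (not (is12 (a , b))) →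
    Σ (Fin (length (allEdgesMinus12 n))) λ i → List.lookup (allEdgesMinus12 n) i ≡ (a , b)
  edge a<b t = index ab∈ , sym (lookup-index ab∈)
    where ab∈ = ∈-filter⁺ (T? ∘ (not ∘ is12)) (∈-allEdges⁺ n a<b) t
  joins₁ : ∀ {a b} → (Σ (Fin (length (allEdgesMinus12 n))) λ i → List.lookup (allEdgesMinus12 n) i ≡ (a , b)) →
    Σ (Fin (length (allEdgesMinus12 n))) λ i → Joins i a b
  joins₁ (i , eq) = i , inj₁ eq
  covered : Covered G
  covered (inj₁ (refl , v∈)) with ∈-tabulate⁻ v∈
  ... | b , refl = joins₁ (edge (s≤s z≤n) tt)
  covered (inj₂ (inj₁ (refl , v∈))) with ∈-tabulate⁻ v∈
  ... | b , refl = joins₁ (edge (s≤s (s≤s z≤n)) tt)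
  covered (inj₂ (inj₂ (u∈ , v∈ , u≢v))) with ∈-tabulate⁻ u∈ | ∈-tabulate⁻ v∈
  ... | a , refl | b , refl with Fin.<-cmp (fs (fs a)) (fs (fs b))
  ...   | tri< a<b _ _ = joins₁ (edge a<b tt)
  ...   | tri≈ _ a≡b _ = contradiction a≡b u≢v
  ...   | tri> _ _ b<a = let i , eq = edge b<a tt in i , inj₂ eq

-- Rational polynomials and the passage from ℕ to ℚ

ℚ-ring : AlmostCommutativeRing 0ℓ 0ℓ
ℚ-ring = fromCommutativeRing ℚ.+-*-commutativeRing λ _ → nothing

addConstant : ∀ {m} → ℚ → Vec ℚ (suc m) → Vec ℚ (suc m)
addConstant c (e ∷ es) = (c +ℚ e) ∷ es

-- Multiplication by x + d on coefficients, constant term first: (x + d) (c + x q) = d c + x (c + (x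
-- + d) q).
timesLinear : ∀ {m} → ℚ → Vec ℚ m → Vec ℚ (suc m)
timesLinear d []       = 0ℚ ∷ []
timesLinear d (c ∷ cs) = (d *ℚ c) ∷ addConstant c (timesLinear d cs)

eval-addConstant : ∀ {m} c (p : Vec ℚ (suc m)) x → evalPoly (addConstant c p) x ≡ c +ℚ evalPoly p x
eval-addConstant c (e ∷ es) x = ℚ.+-assoc c e _

eval-timesLinear : ∀ {m} d (p : Vec ℚ m) x → evalPoly (timesLinear d p) x ≡ (x +ℚ d) *ℚ evalPoly p x
eval-timesLinear d [] x = trans (ℚ.+-identityˡ _) (trans (ℚ.*-zeroʳ x) (sym (ℚ.*-zeroʳ (x +ℚ d))))
eval-timesLinear d (c ∷ cs) x = trans
  (cong (λ u → (d *ℚ c) +ℚ (x *ℚ u)) (trans (eval-addConstant c (timesLinear d cs) x)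
    (cong (c +ℚ_) (eval-timesLinear d cs x))))
  (identity d c x (evalPoly cs x))
  where
  identity : ∀ d c x q → (d *ℚ c) +ℚ (x *ℚ (c +ℚ ((x +ℚ d) *ℚ q))) ≡ (x +ℚ d) *ℚ (c +ℚ (x *ℚ q))
  identity = solve-∀ ℚ-ring

last-addConstant : ∀ {m} c (p : Vec ℚ (suc (suc m))) → last (addConstant c p) ≡ last p
last-addConstant c (e ∷ es) = refl

last-timesLinear : ∀ {m} d (p : Vec ℚ (suc m)) → last (timesLinear d p) ≡ last p
last-timesLinear d (c ∷ [])      = ℚ.+-identityʳ c
last-timesLinear d (c ∷ c′ ∷ cs) = trans (last-addConstant c (timesLinear d (c′ ∷ cs))) (last-timesLinear d (c′ ∷ cs))

-- The polynomial a (x + d)ᵉ, whose leading coefficient is a for every d.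
shiftedPower : ℚ → ℚ → ∀ e → Vec ℚ (suc e)
shiftedPower a d zero    = a ∷ []
shiftedPower a d (suc e) = timesLinear d (shiftedPower a d e)

last-shiftedPower : ∀ a d e → last (shiftedPower a d e) ≡ a
last-shiftedPower a d zero    = refl
last-shiftedPower a d (suc e) = trans (last-timesLinear d (shiftedPower a d e)) (last-shiftedPower a d e)

ι : ℕ → ℚ
ι n = + n / 1

toℚᵘ-/ : ∀ a b → toℚᵘ (+ a / suc b) ℚᵘ.≃ mkℚᵘ (+ a) b
toℚᵘ-/ a b = ℚ.toℚᵘ-fromℚᵘ (mkℚᵘ (+ a) b)

ι-+ : ∀ m n → ι m +ℚ ι n ≡ ι (m + n)
ι-+ m n = ℚ.toℚᵘ-injective (begin
  toℚᵘ (ι m +ℚ ι n)             ≈⟨ ℚ.toℚᵘ-homo-+ (ι m) (ι n) ⟩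
  toℚᵘ (ι m) ℚᵘ.+ toℚᵘ (ι n)    ≈⟨ ℚᵘ.+-cong (toℚᵘ-/ m 0) (toℚᵘ-/ n 0) ⟩
  mkℚᵘ (+ m) 0 ℚᵘ.+ mkℚᵘ (+ n) 0
    ≈⟨ *≡* (cong (ℤ._* + 1) (cong₂ ℤ._+_ (ℤ.*-identityʳ (+ m)) (ℤ.*-identityʳ (+ n)))) ⟩
  mkℚᵘ (+ (m + n)) 0            ≈⟨ ℚᵘ.≃-sym (toℚᵘ-/ (m + n) 0) ⟩
  toℚᵘ (ι (m + n))              ∎)
  where open import Relation.Binary.Reasoning.Setoid ℚᵘ.≃-setoid

ι-* : ∀ m n → ι m *ℚ ι n ≡ ι (m * n)
ι-* m n = ℚ.toℚᵘ-injective (begin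
  toℚᵘ (ι m *ℚ ι n)             ≈⟨ ℚ.toℚᵘ-homo-* (ι m) (ι n) ⟩
  toℚᵘ (ι m) ℚᵘ.* toℚᵘ (ι n)    ≈⟨ ℚᵘ.*-cong (toℚᵘ-/ m 0) (toℚᵘ-/ n 0) ⟩
  mkℚᵘ (+ m) 0 ℚᵘ.* mkℚᵘ (+ n) 0 ≈⟨ *≡* (cong (ℤ._* + 1) (sym (ℤ.pos-* m n))) ⟩
  mkℚᵘ (+ (m * n)) 0            ≈⟨ ℚᵘ.≃-sym (toℚᵘ-/ (m * n) 0) ⟩
  toℚᵘ (ι (m * n))              ∎)
  where open import Relation.Binary.Reasoning.Setoid ℚᵘ.≃-setoid

eval-shiftedPower : ∀ a d r e → evalPoly (shiftedPower a (ι d) e) (ι r) ≡ a *ℚ ι ((r + d) ^ e)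
eval-shiftedPower a d r zero    =
  trans (cong (a +ℚ_) (ℚ.*-zeroʳ (ι r))) (trans (ℚ.+-identityʳ a) (sym (ℚ.*-identityʳ a)))
eval-shiftedPower a d r (suc e) = begin
  evalPoly (timesLinear (ι d) (shiftedPower a (ι d) e)) (ι r)
    ≡⟨ eval-timesLinear (ι d) (shiftedPower a (ι d) e) (ι r) ⟩
  (ι r +ℚ ι d) *ℚ evalPoly (shiftedPower a (ι d) e) (ι r)
    ≡⟨ cong₂ _*ℚ_ (ι-+ r d) (eval-shiftedPower a d r e) ⟩
  ι (r + d) *ℚ (a *ℚ ι ((r + d) ^ e))
    ≡⟨ rotate (ι (r + d)) a (ι ((r + d) ^ e)) ⟩
  a *ℚ (ι (r + d) *ℚ ι ((r + d) ^ e))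
    ≡⟨ cong (a *ℚ_) (ι-* (r + d) ((r + d) ^ e)) ⟩
  a *ℚ ι ((r + d) ^ suc e) ∎
  where
  open ≡-Reasoning
  rotate : ∀ x a y → x *ℚ (a *ℚ y) ≡ a *ℚ (x *ℚ y)
  rotate = solve-∀ ℚ-ring

-- Clears the denominator k! of the leading coefficient, so that the growth estimate can be made
-- entirely in ℕ.
ι-≤-/ : ∀ a b {{_ : NonZero b}} h y → b * h ≤ a * y → ι h ≤ℚ (+ a / b) *ℚ ι y
ι-≤-/ a (suc b) h y bh≤ay = ℚ.toℚᵘ-cancel-≤ (begin
  toℚᵘ (ι h)                          ≃⟨ toℚᵘ-/ h 0 ⟩
  mkℚᵘ (+ h) 0                        ≤⟨ *≤* cross ⟩
  mkℚᵘ (+ a) b ℚᵘ.* mkℚᵘ (+ y) 0      ≃⟨ ℚᵘ.≃-sym (ℚᵘ.*-cong (toℚᵘ-/ a b) (toℚᵘ-/ y 0)) ⟩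
  toℚᵘ (+ a / suc b) ℚᵘ.* toℚᵘ (ι y)  ≃⟨ ℚᵘ.≃-sym (ℚ.toℚᵘ-homo-* (+ a / suc b) (ι y)) ⟩
  toℚᵘ ((+ a / suc b) *ℚ ι y)         ∎)
  where
  open ℚᵘ.≤-Reasoning
  commute : ∀ b h → suc b * h ≡ h * (suc b * 1)
  commute = ℕ-Solver.solve-∀
  cross : + h ℤ.* + (suc b * 1) ℤ.≤ (+ a ℤ.* + y) ℤ.* + 1
  cross = subst₂ ℤ._≤_ (trans (cong +_ (commute b h)) (ℤ.pos-* h (suc b * 1)))
    (trans (ℤ.pos-* a y) (sym (ℤ.*-identityʳ (+ a ℤ.* + y)))) (ℤ.+≤+ bh≤ay)

vertex-count : ∀ k j → 2 * k + 1 + 3 * (k + 2 + j) ≡ 7 + (k * 5 + j * 3)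
vertex-count = ℕ-Solver.solve-∀

face-size : ∀ k j → k + (k + 2 + j) ≡ 2 + (k * 2 + j)
face-size = ℕ-Solver.solve-∀

homologyBound-poly : ∀ k j h → h ≤ homologyBound k j →
  ι h ≤ℚ evalPoly (shiftedPower (leadCoeff k) (ι (shift k)) (3 * k)) (ι (k + 2 + j))
homologyBound-poly k j h h≤ = subst (ι h ≤ℚ_) (sym (eval-shiftedPower (leadCoeff k) (shift k) (k + 2 + j) (3 * k)))
  (ι-≤-/ (3 ^ k) (k !) {{k !≢0}} h _ (≤-trans (*-monoʳ-≤ (k !) h≤) (homologyBound-≤ k j)))

theorem5p14 : (k : ℕ) →
    Σ (Vec ℚ (suc (3 * k))) λ f → Σ (Vec ℚ (suc (3 * k))) λ g →
    (last f ≡ leadCoeff k) × (last g ≡ leadCoeff k)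
    × (∀ (r : ℕ) → k + 2 ≤ r → ∀ (h : ℕ) → βdim (2 * k + 1 + 3 * r) (k + r) h →
    (+ h / 1) ≤ℚ evalPoly f (+ r / 1))
    × (∀ (r : ℕ) → k + 2 ≤ r → ∀ (h : ℕ) → αdim (2 * k + 1 + 3 * r) (k + r) h →
    (+ h / 1) ≤ℚ evalPoly g (+ r / 1))
-- `homologyBound` bounds both groups, so 3ᵏ / k! · (x + shift k)³ᵏ serves as both polynomials.
theorem5p14 k = f , f , last-f , last-f , β , α
  where
  f : Vec ℚ (suc (3 * k))
  f = shiftedPower (leadCoeff k) (ι (shift k)) (3 * k)
  last-f : last f ≡ leadCoeff k
  last-f = last-shiftedPower (leadCoeff k) (ι (shift k)) (3 * k)
  β : ∀ r → k + 2 ≤ r → ∀ h → βdim (2 * k + 1 + 3 * r) (k + r) h → ι h ≤ℚ evalPoly f (ι r)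
  β r k+2≤r h hom with m≤n⇒∃[o]m+o≡n k+2≤r
  ... | j , refl = homologyBound-poly k j h (βdim-≤ (7 + (k * 5 + j * 3))
    (proj₂ (homology-bound (allEdges _) (allEdges-unique _) (allEdges-ordered _) k j refl refl))
    (subst₂ (λ n s → βdim n s h) (vertex-count k j) (face-size k j) hom))
  α : ∀ r → k + 2 ≤ r → ∀ h → αdim (2 * k + 1 + 3 * r) (k + r) h → ι h ≤ℚ evalPoly f (ι r)
  α r k+2≤r h hom with m≤n⇒∃[o]m+o≡n k+2≤r
  ... | j , refl = homologyBound-poly k j h (αdim-≤ (5 + (k * 5 + j * 3))
    (proj₁ (homology-bound (allEdgesMinus12 _) (minus12-unique _) (minus12-ordered _) k j refl refl))
    (subst₂ (λ n s → αdim n s h) (vertex-count k j) (face-size k j) hom))
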